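{- There is an algorithm that, given a cograph $G$ without isolated vertices, computes the Grundy double domination number $\gamma_{gr}^{\times 2}(G)$ and a Grundy double dominating sequence of $G$ in time linear in $|V(G)|+|E(G)|$.
   Context: All graphs are finite, simple and undirected. $N[v]$ denotes the closed neighborhood of $v$; a vertex $u$ is dominated by $v$ if $u\in N[v]$. A sequence $S=(v_1,\dots,v_k)$ of distinct vertices of $G$ is a double neighborhood sequence (DNS) if for each $i$ there is a vertex $u\in N[v_i]$ with $|\{j<i : u\in N[v_j]\}|\le 1$. A set $D\subseteq V(G)$ is a double dominating set if $|N[w]\cap D|\ge 2$ for every $w\in V(G)$. A DNS whose vertex set is a double dominating set is a double dominating sequence (DDS). For a graph without isolated vertices, a DDS of maximum length is a Grundy double dominating sequence (GDDS), and its length is the Grundy double domination number $\gamma_{gr}^{\times 2}(G)$. A cograph is a graph containing no induced path on four vertices ($P_4$-free graph). -}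

module Defs where

open import Data.Bool using (if_then_else_)
open import Data.Fin using (Fin; toℕ)
import Data.Fin as Fin
import Data.Fin.Properties as Fin
open import Data.Fin.Subset using (Subset; _∈_; ⁅_⁆; _∪_; _∩_; ⋃; ∣_∣)
open import Data.Fin.Subset.Properties using (_∈?_)
open import Data.List using
  (List; []; _∷_; length; map; filter; take; lookup; concatMap; allFin; cartesianProduct)
import Data.List.Membership.Propositional as List
open import Data.List.Relation.Unary.Unique.Propositional using (Unique)
open import Data.Nat using (ℕ; zero; suc; _+_; _*_; _∸_; _^_; _≤_; _≥_; _≟_)
open import Data.Nat.Properties using (1+n≢n)
open import Data.Product using (Σ-syntax; ∃-syntax; _×_; _,_)
open import Data.Sum using (_⊎_; [_,_]′; swap)
open import Data.Unit using (⊤)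
open import Data.Vec using (tabulate)
open import Function.Bundles using (_⇔_)
open import Function.Definitions using (Injective)
open import Level using (0ℓ)
open import Relation.Binary using (Rel; Decidable; Symmetric)
open import Relation.Binary.PropositionalEquality using (_≡_; _≢_)
open import Relation.Nullary using (¬_; does)
open import Relation.Nullary.Decidable using (_×-dec_; _⊎-dec_)

record Graph (n : ℕ) : Set₁ where
  infix 4 _~_ _~?_
  field
    _~_      : Rel (Fin n) 0ℓ
    _~?_     : Decidable _~_
    ~-sym    : Symmetric _~_
    ~-irrefl : ∀ v → ¬ (v ~ v)

  N⟨_⟩ : Fin n → Subset n
  N⟨ v ⟩ = tabulate (λ u → does (v ~? u))

  N[_] : Fin n → Subset n
  N[ v ] = ⁅ v ⁆ ∪ N⟨ v ⟩

  -- Each edge is listed once, with its smaller endpoint first.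
  edges : List (Fin n × Fin n)
  edges = filter (λ (u , v) → (u Fin.<? v) ×-dec (u ~? v))
                 (cartesianProduct (allFin n) (allFin n))

  ∣V∣ ∣E∣ : ℕ
  ∣V∣ = n
  ∣E∣ = length edges

open Graph

Path : ∀ n → Graph n
Path n ._~_ i j    = (suc (toℕ i) ≡ toℕ j) ⊎ (suc (toℕ j) ≡ toℕ i)
Path n ._~?_ i j   = (suc (toℕ i) ≟ toℕ j) ⊎-dec (suc (toℕ j) ≟ toℕ i)
Path n .~-sym      = swap
Path n .~-irrefl v = [ 1+n≢n , 1+n≢n ]′

InducedIn : ∀ {k n} → Graph k → Graph n → Set
InducedIn {k} {n} H G =
  Σ[ f ∈ (Fin k → Fin n) ]
    (Injective _≡_ _≡_ f × (∀ i j → _~_ H i j ⇔ _~_ G (f i) (f j)))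

IsCograph : ∀ {n} → Graph n → Set
IsCograph G = ¬ InducedIn (Path 4) G

NoIsolatedVertices : ∀ {n} → Graph n → Set
NoIsolatedVertices G = ∀ v → ∃[ u ] _~_ G v u

module _ {n : ℕ} (G : Graph n) where

  vertexSet : List (Fin n) → Subset n
  vertexSet S = ⋃ (map ⁅_⁆ S)

  timesDominated : Fin n → List (Fin n) → ℕ
  timesDominated u S = length (filter (λ v → u ∈? N[_] G v) S)

  record IsDNS (S : List (Fin n)) : Set where
    field
      distinct  : Unique S
      footprint : ∀ (i : Fin (length S)) →
                  ∃[ u ] (u ∈ N[_] G (lookup S i) ×
                          timesDominated u (take (toℕ i) S) ≤ 1)

  IsDoubleDominating : Subset n → Set
  IsDoubleDominating D = ∀ w → ∣ N[_] G w ∩ D ∣ ≥ 2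

  IsDDS : List (Fin n) → Set
  IsDDS S = IsDNS S × IsDoubleDominating (vertexSet S)

  IsGDDS : List (Fin n) → Set
  IsGDDS S = IsDDS S × (∀ T → IsDDS T → length T ≤ length S)

  IsGrundyDoubleDominationNumber : ℕ → Set
  IsGrundyDoubleDominationNumber k = ∃[ S ] (IsGDDS S × length S ≡ k)

-- Programs for a random access machine with unit-cost operations on bounded
-- words.  A program uses finitely many registers and finitely many arrays,
-- both named by numerals; array indices are computed at run time.  There is
-- no multiplication, and a step producing a number larger than the word bound
-- W is undefined, so the unit cost cannot be exploited by packing data into
-- large numbers.

infixl 6 _⊕_ _⊖_
infixr 7 _!_

data Exp : Set where
  const   : ℕ → Exp
  reg     : ℕ → Exp
  _!_     : ℕ → Exp → Exp
  _⊕_ _⊖_ : Exp → Exp → Exp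

infix  5 _:=_ _[_]:=_ ifNonzero_then_else_ whileNonzero_loop_
infixr 4 _⨾_

data Program : Set where
  skip                 : Program
  _:=_                 : ℕ → Exp → Program
  _[_]:=_              : ℕ → Exp → Exp → Program
  _⨾_                  : Program → Program → Program
  ifNonzero_then_else_ : Exp → Program → Program → Program
  whileNonzero_loop_   : Exp → Program → Program

record State : Set where
  constructor ⟨_,_⟩
  field
    regs   : ℕ → ℕ
    arrays : ℕ → ℕ → ℕ

open State

_[_↦_] : {A : Set} → (ℕ → A) → ℕ → A → (ℕ → A)
(f [ i ↦ a ]) j = if does (i ≟ j) then a else f j

setReg : ℕ → ℕ → State → State
setReg x a σ = ⟨ regs σ [ x ↦ a ] , arrays σ ⟩

setCell : ℕ → ℕ → ℕ → State → State
setCell b i a σ = ⟨ regs σ , arrays σ [ b ↦ arrays σ b [ i ↦ a ] ] ⟩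

⟦_⟧ : Exp → State → ℕ
⟦ const k ⟧ σ = k
⟦ reg x ⟧   σ = regs σ x
⟦ b ! e ⟧   σ = arrays σ b (⟦ e ⟧ σ)
⟦ e ⊕ f ⟧   σ = ⟦ e ⟧ σ + ⟦ f ⟧ σ
⟦ e ⊖ f ⟧   σ = ⟦ e ⟧ σ ∸ ⟦ f ⟧ σ

-- Evaluating the expression in the given state produces no number above W.
-- Stored values need no check: they were checked when computed or belong to
-- the input.
NoOverflow : ℕ → State → Exp → Set
NoOverflow W σ (const k) = k ≤ W
NoOverflow W σ (reg x)   = ⊤
NoOverflow W σ (b ! e)   = NoOverflow W σ e
NoOverflow W σ (e ⊕ f)   =
  NoOverflow W σ e × NoOverflow W σ f × ⟦ e ⟧ σ + ⟦ f ⟧ σ ≤ W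
NoOverflow W σ (e ⊖ f)   = NoOverflow W σ e × NoOverflow W σ f

cost : Exp → ℕ
cost (const k) = 1
cost (reg x)   = 1
cost (b ! e)   = 1 + cost e
cost (e ⊕ f)   = 1 + cost e + cost f
cost (e ⊖ f)   = 1 + cost e + cost f

-- Run W P σ t τ: with word bound W, the program P started in state σ halts
-- in state τ after t steps.
data Run (W : ℕ) : Program → State → ℕ → State → Set where

  run-skip : ∀ {σ} → Run W skip σ 1 σ

  run-reg : ∀ {x e σ} →
    NoOverflow W σ e →
    Run W (x := e) σ (1 + cost e) (setReg x (⟦ e ⟧ σ) σ)

  run-array : ∀ {b e f σ} →
    NoOverflow W σ e → NoOverflow W σ f →
    Run W (b [ e ]:= f) σ (1 + cost e + cost f) (setCell b (⟦ e ⟧ σ) (⟦ f ⟧ σ) σ)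

  run-seq : ∀ {P Q σ τ υ s t} →
    Run W P σ s τ → Run W Q τ t υ →
    Run W (P ⨾ Q) σ (s + t) υ

  run-then : ∀ {e P Q σ τ t} →
    NoOverflow W σ e → ⟦ e ⟧ σ ≢ 0 →
    Run W P σ t τ →
    Run W (ifNonzero e then P else Q) σ (1 + cost e + t) τ

  run-else : ∀ {e P Q σ τ t} →
    NoOverflow W σ e → ⟦ e ⟧ σ ≡ 0 →
    Run W Q σ t τ →
    Run W (ifNonzero e then P else Q) σ (1 + cost e + t) τ

  run-exit : ∀ {e P σ} →
    NoOverflow W σ e → ⟦ e ⟧ σ ≡ 0 →
    Run W (whileNonzero e loop P) σ (1 + cost e) σ

  run-loop : ∀ {e P σ τ υ s t} →
    NoOverflow W σ e → ⟦ e ⟧ σ ≢ 0 →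
    Run W P σ s τ → Run W (whileNonzero e loop P) τ t υ →
    Run W (whileNonzero e loop P) σ (1 + cost e + s + t) υ

-- The neighbours of a vertex may be listed in any order.
record AdjacencyLists {n : ℕ} (G : Graph n) : Set where
  field
    neighbours : Fin n → List (Fin n)
    unique     : ∀ v → Unique (neighbours v)
    correct    : ∀ v u → (u List.∈ neighbours v) ⇔ _~_ G v u

open AdjacencyLists

-- The number of vertices, followed for each vertex by its degree and the
-- list of its neighbours.
encode : ∀ {n} {G : Graph n} → AdjacencyLists G → List ℕ
encode {n} A =
  n ∷ concatMap (λ v → length (neighbours A v) ∷ map toℕ (neighbours A v))
                (allFin n)

-- The contents of an array holding the given list, padded with zeros.
contents : List ℕ → ℕ → ℕ
contents []       i       = 0
contents (x ∷ xs) zero    = x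
contents (x ∷ xs) (suc i) = contents xs i

-- The input is placed in array 0; everything else is initially zero.
initial : List ℕ → State
initial input = ⟨ (λ _ → 0) , (λ _ _ → 0) [ 0 ↦ contents input ] ⟩

-- The output is read from the start of array 1.
Outputs : State → List ℕ → Set
Outputs σ output = ∀ i → arrays σ 1 (toℕ i) ≡ lookup output i

size : ∀ {n} → Graph n → ℕ
size G = ∣V∣ G + ∣E∣ G

-- A polynomial bound, i.e. words of O(log N) bits; the exponent is positive so
-- that every number in the input of a graph of size N fits into a word.
wordBound : ℕ → ℕ → ℕ
wordBound d N = (2 + N) ^ suc d

{-# OPTIONS --safe #-}
-- For a set X of vertices, consider the longest double neighbourhood sequence of G[X].  Its length adds up
-- over disjoint unions.  In a join of X and Y, look at the footprint u of the last vertex, say in X: each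
-- vertex of Y dominates u, so at most one vertex of Y occurs before.  Hence the maximum over the join is the
-- larger of the two values for X and Y, where a side with an isolated vertex counts one more, since then a
-- vertex of the other side can be appended.  Both rules are evaluated bottom-up in a cotree, with sequences
-- stored as linked lists.
--
-- The cotree is built by inserting the vertices one at a time (Corneil, Perl and Stewart).  The nodes all of
-- whose leaves are neighbours of the new vertex x are found by counting finished children; since inner nodes
-- have at least two children, there are at most twice as many of them as neighbours.  As there is no induced
-- P4, the partially full nodes form a path from the root, off which everything is full at joins and empty at
-- unions; x is inserted at its lower end u.  Types alternate, so every join on the path has a full child, and
-- u is the only node with a full child that has no such partially full node one or two levels below.
module Submission where

open import Data.Bool using (Bool; true; false; if_then_else_; not; _∧_) renaming (T to True)
open import Data.Empty using (⊥; ⊥-elim)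
open import Data.Fin using (Fin; zero; suc; toℕ; fromℕ<)
import Data.Fin as FinB
import Data.Fin.Properties as Fin
open import Data.Fin.Subset using (Subset; ⁅_⁆; ∣_∣; _-_) renaming (_∈_ to _∈ₛ_; ⊤ to ⊤ₛ)
open import Data.Fin.Subset.Properties using
  (_∈?_; x∈p∪q⁺; x∈p∪q⁻; x∈⁅x⁆; x∈⁅y⁆⇒x≡y; x∈p∩q⁺; x∈p∧x≢y⇒x∈p-y; x∈p⇒∣p-x∣<∣p∣; ∈⊤; ∣p∣≤n)
open import Data.List using
  (List; []; _∷_; length; _++_; map; filter; reverse; take; drop; lookup; replicate; _ʳ++_; tabulate; concatMap; allFin)
import Data.List.Membership.DecPropositional as DecMem
open import Data.List.Membership.Propositional using (_∈_; _∉_; find; lose)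
open import Data.List.Membership.Propositional.Properties using
  (∈-∃++; ∈-++⁻; ∈-++⁺ˡ; ∈-++⁺ʳ; ∈-filter⁺; ∈-filter⁻; ∈-cartesianProduct⁺; ∈-allFin; ∈-map⁻)
open import Data.List.Properties using
  (length-++; length-map; length-tabulate; length-replicate; length-reverse; filter-accept; filter-reject;
   unfold-reverse; reverse-++; reverse-involutive; take-suc; take-all; take++drop≡id)
open import Data.List.Relation.Binary.Permutation.Propositional using (↭-sym; ↭⇒↭ₛ)
open import Data.List.Relation.Binary.Permutation.Propositional.Properties using (↭-reverse)
open import Data.List.Relation.Binary.Permutation.Setoid.Properties using (Unique-resp-↭)
open import Data.List.Relation.Unary.All.Properties using (¬Any⇒All¬; All¬⇒¬Any)
open import Data.List.Relation.Unary.Any using (here; there; any?; satisfied)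
import Data.List.Relation.Unary.Any as Any
open import Data.List.Relation.Unary.Unique.Propositional using (Unique; []; _∷_)
import Data.List.Relation.Unary.Unique.Propositional.Properties as Uniqueₚ
open import Data.Nat using
  (ℕ; zero; suc; _+_; _*_; _∸_; _^_; _≤_; _<_; _≟_; z≤n; s≤s; _≤?_; _<?_; _≤ᵇ_)
open import Data.Nat.Properties
open import Data.Nat.Tactic.RingSolver using (solve-∀)
open import Data.Product using (Σ-syntax; ∃-syntax; _×_; _,_; proj₁; proj₂; swap)
open import Data.Sum using (_⊎_; inj₁; inj₂; [_,_]′) renaming (swap to ⊎-swap)
open import Data.Unit using (⊤; tt)
open import Data.Vec.Properties using (lookup∘tabulate; []=⇒lookup; lookup⇒[]=)
open import Function.Base using (_∘_)
open import Function.Bundles using (mk⇔; module Equivalence)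
open import Relation.Binary using (tri<; tri≈; tri>)
open import Relation.Binary.PropositionalEquality hiding (J)
open import Relation.Nullary using (¬_; yes; no; does; Dec)
open import Relation.Nullary.Decidable using (_×-dec_; ¬?; decidable-stable; dec-true; dec-false)
open import Relation.Unary using (Decidable)
open import Defs

open State
open DecMem _≟_ using () renaming (_∈?_ to _∈ℕ?_)

-- Running programs

-- An insertion may only take time proportional to the degree of `x`, while a node can have far more
-- children that are not full. Hence no child lists are kept: a parent array with counts and sums
-- suffices to ask whether all children of a node are full and which single child is not, and within
-- an insertion only the queue of full nodes is ever enumerated. The sums are the largest numbers
-- that occur; they are quadratic in the number of nodes and so fit into a word.
--
-- The tree invariant avoids lowest common ancestors. Adjacency is read off at pairs of distinct
-- siblings, a condition that can be followed through every single change of a parent. Reshaping is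
-- composed of three elementary moves with their own preservation proofs, and the alternation of
-- types is suspended at one node `z` until the new vertex is in place.
--
-- Sequences are handled last vertex first, so that appending a vertex, the step needed at a join,
-- is a cons on lists and one new link in memory.

module ProgramLogic where

  Exec : ℕ → Program → State → ℕ → (State → Set) → Set
  Exec W P σ T Q = Σ[ t ∈ ℕ ] Σ[ τ ∈ State ] (Run W P σ t τ × t ≤ T × Q τ)

  private variable
    W T T₁ T₂ : ℕ
    P P₁ P₂ : Program
    σ : State
    Q R : State → Set

  exec-mono : Exec W P σ T₁ Q → T₁ ≤ T₂ → (∀ τ → Q τ → R τ) → Exec W P σ T₂ R
  exec-mono (t , τ , r , le , q) le' f = t , τ , r , ≤-trans le le' , f τ q

  exec-seq : Exec W P₁ σ T₁ (λ τ → Exec W P₂ τ T₂ R) → Exec W (P₁ ⨾ P₂) σ (T₁ + T₂) R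
  exec-seq (t , τ , r , le , (t' , τ' , r' , le' , q)) = t + t' , τ' , run-seq r r' , +-mono-≤ le le' , q

  loopFree : Program → Bool
  loopFree skip = true
  loopFree (x := e) = true
  loopFree (b [ e ]:= f) = true
  loopFree (P ⨾ Q) = loopFree P ∧ loopFree Q
  loopFree (ifNonzero e then P else Q) = loopFree P ∧ loopFree Q
  loopFree (whileNonzero e loop P) = false

  -- Both branches of a conditional are added instead of taking a maximum: the bound remains a plain
  -- sum, at the price of a constant factor. Loops are excluded by `wp`, which is empty for them,
  -- and get their bound from `exec-while`.
  time : Program → ℕ
  time skip = 1
  time (x := e) = 1 + cost e
  time (b [ e ]:= f) = 1 + cost e + cost f
  time (P ⨾ Q) = time P + time Q
  time (ifNonzero e then P else Q) = 1 + cost e + (time P + time Q)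
  time (whileNonzero e loop P) = 0

  wp : ℕ → Program → (State → Set) → State → Set
  wp W skip Q σ = Q σ
  wp W (x := e) Q σ = NoOverflow W σ e × Q (setReg x (⟦ e ⟧ σ) σ)
  wp W (b [ e ]:= f) Q σ = NoOverflow W σ e × NoOverflow W σ f × Q (setCell b (⟦ e ⟧ σ) (⟦ f ⟧ σ) σ)
  wp W (P₁ ⨾ P₂) Q σ = wp W P₁ (wp W P₂ Q) σ
  wp W (ifNonzero e then P₁ else P₂) Q σ =
    NoOverflow W σ e × (⟦ e ⟧ σ ≢ 0 → wp W P₁ Q σ) × (⟦ e ⟧ σ ≡ 0 → wp W P₂ Q σ)
  wp W (whileNonzero e loop P) Q σ = ⊥

  wp-sound : ∀ P {Q} σ → wp W P Q σ → Exec W P σ (time P) Q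
  wp-sound skip σ q = 1 , σ , run-skip , ≤-refl , q
  wp-sound (x := e) σ (o , q) = _ , _ , run-reg o , ≤-refl , q
  wp-sound (b [ e ]:= f) σ (o , o' , q) = _ , _ , run-array o o' , ≤-refl , q
  wp-sound (P₁ ⨾ P₂) σ q with wp-sound P₁ σ q
  ... | (t , τ , r , le , q') = exec-seq (t , τ , r , le , wp-sound P₂ τ q')
  wp-sound (ifNonzero e then P₁ else P₂) σ (o , f , g) with ⟦ e ⟧ σ ≟ 0
  ... | yes z with wp-sound P₂ σ (g z)
  ... | (t , τ , r , le , q) = _ , τ , run-else o z r , +-monoʳ-≤ (1 + cost e) (≤-trans le (m≤n+m _ _)) , q
  wp-sound (ifNonzero e then P₁ else P₂) σ (o , f , g) | no z with wp-sound P₁ σ (f z)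
  ... | (t , τ , r , le , q) = _ , τ , run-then o z r , +-monoʳ-≤ (1 + cost e) (≤-trans le (m≤m+n _ _)) , q
  wp-sound (whileNonzero e loop P) σ ()

  exec-if : ∀ {e T'} → NoOverflow W σ e →
    (⟦ e ⟧ σ ≢ 0 → Exec W P₁ σ T Q) → (⟦ e ⟧ σ ≡ 0 → Exec W P₂ σ T' Q) →
    Exec W (ifNonzero e then P₁ else P₂) σ (1 + cost e + (T + T')) Q
  exec-if {σ = σ} {e = e} o f g with ⟦ e ⟧ σ ≟ 0
  ... | no z with f z
  ... | (t , τ , r , le , q) = _ , τ , run-then o z r , +-monoʳ-≤ (1 + cost e) (≤-trans le (m≤m+n _ _)) , q
  exec-if {σ = σ} {e = e} o f g | yes z with g z
  ... | (t , τ , r , le , q) = _ , τ , run-else o z r , +-monoʳ-≤ (1 + cost e) (≤-trans le (m≤n+m _ _)) , q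

  totalCost : {A : Set} → ℕ → (A → ℕ) → List A → ℕ
  totalCost g c [] = g
  totalCost g c (a ∷ l) = g + c a + totalCost g c l

  -- The list is the work still ahead: its length proves termination, and adding up the costs `c` of
  -- its elements gives amortised bounds. The guard may fail before the list is used up, so the
  -- postcondition speaks of some remaining list `l'`.
  exec-while : {A : Set} (J : List A → State → Set) (e : Exp) (c : A → ℕ) →
    (∀ l σ → J l σ → NoOverflow W σ e) →
    (∀ σ → J [] σ → ⟦ e ⟧ σ ≡ 0) →
    (∀ a l σ → J (a ∷ l) σ → ⟦ e ⟧ σ ≢ 0 → Exec W P σ (c a) (J l)) →
    ∀ l σ → J l σ →
    Exec W (whileNonzero e loop P) σ (totalCost (1 + cost e) c l)
      (λ τ → ∃[ l' ] (J l' τ × ⟦ e ⟧ τ ≡ 0))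
  exec-while J e c ov stop step l σ j with ⟦ e ⟧ σ ≟ 0
  exec-while J e c ov stop step [] σ j | yes z = _ , σ , run-exit (ov _ σ j) z , ≤-refl , _ , j , z
  exec-while J e c ov stop step (a ∷ l) σ j | yes z =
    _ , σ , run-exit (ov _ σ j) z , ≤-trans (m≤m+n _ (c a)) (m≤m+n _ _) , _ , j , z
  exec-while J e c ov stop step [] σ j | no z = ⊥-elim (z (stop σ j))
  exec-while J e c ov stop step (a ∷ l) σ j | no z with step a l σ j z
  ... | (t , τ , r , le , j') with exec-while J e c ov stop step l τ j'
  ... | (t' , τ' , r' , le' , q) =
    _ , τ' , run-loop (ov _ σ j) z r r' , +-mono-≤ (+-monoʳ-≤ (1 + cost e) le) le' , q

  totalCost-const : {A : Set} (g c : ℕ) (l : List A) → totalCost g (λ _ → c) l ≡ g + (g + c) * Data.List.length l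
  totalCost-const g c [] = sym (trans (cong (g +_) (*-zeroʳ (g + c))) (+-identityʳ g))
  totalCost-const g c (a ∷ l) = trans (cong (g + c +_) (totalCost-const g c l)) (lem g c (Data.List.length l))
    where
    lem : ∀ g c k → g + c + (g + (g + c) * k) ≡ g + (g + c) * suc k
    lem = solve-∀

  -- Boolean tests, because for a concrete program `True (notReg r P)` normalises to the unit type;
  -- frame conditions are then implicit arguments that are found by computation.
  notReg notArr : ℕ → Program → Bool
  notReg r skip = true
  notReg r (x := e) = not (does (x ≟ r))
  notReg r (b [ e ]:= f) = true
  notReg r (P ⨾ Q) = notReg r P ∧ notReg r Q
  notReg r (ifNonzero e then P else Q) = notReg r P ∧ notReg r Q
  notReg r (whileNonzero e loop P) = notReg r P
  notArr r skip = true
  notArr r (x := e) = true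
  notArr r (b [ e ]:= f) = not (does (b ≟ r))
  notArr r (P ⨾ Q) = notArr r P ∧ notArr r Q
  notArr r (ifNonzero e then P else Q) = notArr r P ∧ notArr r Q
  notArr r (whileNonzero e loop P) = notArr r P

  T-∧ : ∀ a {b} → True (a ∧ b) → True a × True b
  T-∧ true p = tt , p

  update-other : {A : Set} (f : ℕ → A) {i j : ℕ} {a : A} → True (not (does (i ≟ j))) → (f [ i ↦ a ]) j ≡ f j
  update-other f {i} {j} p with does (i ≟ j)
  ... | false = refl

  run-reg-frame : ∀ {τ t} r → Run W P σ t τ → True (notReg r P) → regs τ r ≡ regs σ r
  run-reg-frame r run-skip p = refl
  run-reg-frame {σ = σ} r (run-reg {x = x} _) p = update-other (regs σ) {i = x} p
  run-reg-frame r (run-array _ _) p = refl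
  run-reg-frame r (run-seq {P = P₁} a b) p with T-∧ (notReg r P₁) p
  ... | p₁ , p₂ = trans (run-reg-frame r b p₂) (run-reg-frame r a p₁)
  run-reg-frame r (run-then {P = P₁} _ _ a) p = run-reg-frame r a (proj₁ (T-∧ (notReg r P₁) p))
  run-reg-frame r (run-else {P = P₁} _ _ a) p = run-reg-frame r a (proj₂ (T-∧ (notReg r P₁) p))
  run-reg-frame r (run-exit _ _) p = refl
  run-reg-frame r (run-loop _ _ a b) p = trans (run-reg-frame r b p) (run-reg-frame r a p)

  -- The equation is between whole arrays as functions. An assignment changes only the entry of the
  -- assigned array's name, so no extensionality is involved and the equation can be used for
  -- rewriting anywhere.
  run-arr-frame : ∀ {τ t} r → Run W P σ t τ → True (notArr r P) → arrays τ r ≡ arrays σ r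
  run-arr-frame r run-skip p = refl
  run-arr-frame r (run-reg _) p = refl
  run-arr-frame {σ = σ} r (run-array {b = b} _ _) p = update-other (arrays σ) {i = b} p
  run-arr-frame r (run-seq {P = P₁} a b) p with T-∧ (notArr r P₁) p
  ... | p₁ , p₂ = trans (run-arr-frame r b p₂) (run-arr-frame r a p₁)
  run-arr-frame r (run-then {P = P₁} _ _ a) p = run-arr-frame r a (proj₁ (T-∧ (notArr r P₁) p))
  run-arr-frame r (run-else {P = P₁} _ _ a) p = run-arr-frame r a (proj₂ (T-∧ (notArr r P₁) p))
  run-arr-frame r (run-exit _ _) p = refl
  run-arr-frame r (run-loop _ _ a b) p = trans (run-arr-frame r b p) (run-arr-frame r a p)

  record Frame (P : Program) (σ τ : State) : Set where
    field
      reg≡ : ∀ r → {True (notReg r P)} → regs τ r ≡ regs σ r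
      arr≡ : ∀ b → {True (notArr b P)} → arrays τ b ≡ arrays σ b
  open Frame public

  exec-frame : Exec W P σ T Q → Exec W P σ T (λ τ → Frame P σ τ × Q τ)
  exec-frame (t , τ , r , le , q) =
    t , τ , r , le , record { reg≡ = λ x {p} → run-reg-frame x r p ; arr≡ = λ x {p} → run-arr-frame x r p } , q

  update-eq : {A : Set} (f : ℕ → A) (i : ℕ) {a : A} {j : ℕ} → i ≡ j → (f [ i ↦ a ]) j ≡ a
  update-eq f i {j = j} e rewrite dec-true (i ≟ j) e = refl

  update-neq : {A : Set} (f : ℕ → A) (i : ℕ) {a : A} {j : ℕ} → i ≢ j → (f [ i ↦ a ]) j ≡ f j
  update-neq f i {j = j} e rewrite dec-false (i ≟ j) e = refl

  -- The only test of the machine is for nonzero, so equality becomes two truncated differences.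
  ifEq : Exp → Exp → Program → Program → Program
  ifEq e f P Q = ifNonzero e ⊖ f then Q else (ifNonzero f ⊖ e then Q else P)

  wp-ifEq : ∀ e f P₁ P₂ {Q} → NoOverflow W σ e → NoOverflow W σ f →
    (⟦ e ⟧ σ ≡ ⟦ f ⟧ σ → wp W P₁ Q σ) → (⟦ e ⟧ σ ≢ ⟦ f ⟧ σ → wp W P₂ Q σ) → wp W (ifEq e f P₁ P₂) Q σ
  wp-ifEq {σ = σ} e f P₁ P₂ oe of a b = (oe , of) , (λ z → b (λ eq → z (trans (cong (_∸ ⟦ f ⟧ σ) eq) (n∸n≡0 (⟦ f ⟧ σ))))) ,
    (λ z → (of , oe) , (λ z' → b (λ eq → z' (trans (cong (⟦ f ⟧ σ ∸_) eq) (n∸n≡0 (⟦ f ⟧ σ))))) ,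
       λ z' → a (≤-antisym (m∸n≡0⇒m≤n z) (m∸n≡0⇒m≤n z')))

  exec-ifEq : ∀ {e f} → NoOverflow W σ e → NoOverflow W σ f →
    (⟦ e ⟧ σ ≡ ⟦ f ⟧ σ → Exec W P₁ σ T₁ Q) → (⟦ e ⟧ σ ≢ ⟦ f ⟧ σ → Exec W P₂ σ T₂ Q) →
    Exec W (ifEq e f P₁ P₂) σ (1 + cost (e ⊖ f) + (T₂ + (1 + cost (f ⊖ e) + (T₂ + T₁)))) Q
  exec-ifEq {σ = σ} {e = e} {f} oe of a b =
    exec-if (oe , of) (λ z → b (λ eq → z (trans (cong (_∸ ⟦ f ⟧ σ) eq) (n∸n≡0 (⟦ f ⟧ σ)))))
    (λ z → exec-if (of , oe) (λ z' → b (λ eq → z' (trans (cong (⟦ f ⟧ σ ∸_) eq) (n∸n≡0 (⟦ f ⟧ σ)))))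
       λ z' → a (≤-antisym (m∸n≡0⇒m≤n z) (m∸n≡0⇒m≤n z')))

open ProgramLogic

-- Counting in arrays and lists

-- The first k cells of an array, last cell first.
slice : (ℕ → ℕ) → ℕ → List ℕ
slice f zero = []
slice f (suc k) = f k ∷ slice f k

ids : ℕ → List ℕ
ids = slice (λ i → i)

slice-ext : ∀ {f g} k → (∀ i → i < k → f i ≡ g i) → slice f k ≡ slice g k
slice-ext zero h = refl
slice-ext (suc k) h = cong₂ _∷_ (h k ≤-refl) (slice-ext k (λ i p → h i (m≤n⇒m≤1+n p)))

slice-push : ∀ f k a → slice (f [ k ↦ a ]) (suc k) ≡ a ∷ slice f k
slice-push f k a = cong₂ _∷_ (update-eq f k refl) (slice-ext k (λ i p → update-neq f k (λ e → <⇒≢ p (sym e))))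

length-slice : ∀ f k → length (slice f k) ≡ k
length-slice f zero = refl
length-slice f (suc k) = cong suc (length-slice f k)

∈-ids : ∀ {c} M → c < M → c ∈ ids M
∈-ids {c} (suc M) (s≤s p) with c ≟ M
... | yes refl = here refl
... | no ne = there (∈-ids M (≤∧≢⇒< p ne))

∈-ids⁻ : ∀ {c} M → c ∈ ids M → c < M
∈-ids⁻ (suc M) (here refl) = ≤-refl
∈-ids⁻ (suc M) (there m) = m≤n⇒m≤1+n (∈-ids⁻ M m)

ids-unique : ∀ M → Unique (ids M)
ids-unique zero = []
ids-unique (suc M) = ¬Any⇒All¬ _ (λ m → <-irrefl refl (∈-ids⁻ M m)) ∷ ids-unique M

unique-head : {A : Set} {a : A} {l : List A} → Unique (a ∷ l) → a ∉ l
unique-head (p ∷ _) = All¬⇒¬Any p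

unique-cons : {A : Set} {a : A} {l : List A} → a ∉ l → Unique l → Unique (a ∷ l)
unique-cons m u = ¬Any⇒All¬ _ m ∷ u

unique-tail : {A : Set} {a : A} {l : List A} → Unique (a ∷ l) → Unique l
unique-tail (_ ∷ u) = u

bounded-search : {P : ℕ → Set} → Decidable P → ∀ M → (∃[ c ] P c) ⊎ (∀ c → c < M → ¬ P c)
bounded-search P? M with any? P? (ids M)
... | yes p = inj₁ (satisfied p)
... | no ¬p = inj₂ (λ c lt p → ¬p (Any.map (λ { refl → p }) (∈-ids M lt)))

weight : (g par : ℕ → ℕ) → ℕ → ℕ → ℕ
weight g par p c = if does (par c ≟ p) then g c else 0

total : (g par : ℕ → ℕ) → ℕ → List ℕ → ℕ
total g par p [] = 0
total g par p (c ∷ l) = weight g par p c + total g par p l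

weight-yes : ∀ g par {p c} → par c ≡ p → weight g par p c ≡ g c
weight-yes g par {p} {c} e = cong (λ b → if b then g c else 0) (dec-true (par c ≟ p) e)

weight-no : ∀ g par {p c} → par c ≢ p → weight g par p c ≡ 0
weight-no g par {p} {c} e = cong (λ b → if b then g c else 0) (dec-false (par c ≟ p) e)

weight≤ : ∀ g par p c → weight g par p c ≤ g c
weight≤ g par p c with par c ≟ p
... | yes e = ≤-reflexive (weight-yes g par e)
... | no ne = ≤-trans (≤-reflexive (weight-no g par ne)) z≤n

total-++ : ∀ g par p l l' → total g par p (l ++ l') ≡ total g par p l + total g par p l'
total-++ g par p [] l' = refl
total-++ g par p (c ∷ l) l' = trans (cong (weight g par p c +_) (total-++ g par p l l')) (sym (+-assoc (weight g par p c) _ _))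

total-mid : ∀ g par p l {c} l' → total g par p (l ++ c ∷ l') ≡ weight g par p c + total g par p (l ++ l')
total-mid g par p l {c} l' rewrite total-++ g par p l (c ∷ l') | total-++ g par p l l' =
  lem (total g par p l) (weight g par p c) (total g par p l')
  where
  lem : ∀ a b c → a + (b + c) ≡ b + (a + c)
  lem = solve-∀

-- Every child of `p` in `l` is matched with its occurrence in `l'`, which is then deleted;
-- distinctness of `l` ensures that no occurrence is asked for twice.
total-mono : ∀ g par p {l l'} → Unique l → (∀ {x} → x ∈ l → par x ≡ p → x ∈ l') → total g par p l ≤ total g par p l'
total-mono g par p {[]} u sub = z≤n
total-mono g par p {x ∷ l} {l'} u sub with par x ≟ p
... | no ne rewrite weight-no g par ne = total-mono g par p (unique-tail u) (λ m → sub (there m))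
... | yes e with ∈-∃++ (sub (here refl) e)
... | as , bs , refl rewrite total-mid g par p as {x} bs | weight-yes g par e =
  +-monoʳ-≤ (g x) (total-mono g par p (unique-tail u) sub')
  where
  sub' : ∀ {y} → y ∈ l → par y ≡ p → y ∈ as ++ bs
  sub' {y} m e' with ∈-++⁻ as (sub (there m) e')
  ... | inj₁ q = ∈-++⁺ˡ q
  ... | inj₂ (here refl) = ⊥-elim (unique-head u m)
  ... | inj₂ (there q) = ∈-++⁺ʳ as q

one : ℕ → ℕ
one _ = 1

occ : (ℕ → ℕ) → ℕ → List ℕ → ℕ
occ = total one

-- Under a constant parent map all elements are siblings, which makes `total-mono` serve as the
-- pigeonhole principle for lengths.
length-occ : ∀ l → length l ≡ occ (λ _ → 0) 0 l
length-occ [] = refl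
length-occ (_ ∷ l) = cong suc (length-occ l)

occ≤length : ∀ par p l → occ par p l ≤ length l
occ≤length par p [] = z≤n
occ≤length par p (c ∷ l) = +-mono-≤ (weight≤ one par p c) (occ≤length par p l)

total-id≤ : ∀ par p M → total (λ i → i) par p (ids M) ≤ M * M
total-id≤ par p zero = z≤n
total-id≤ par p (suc M) = ≤-trans (+-mono-≤ (weight≤ (λ i → i) par p M) (total-id≤ par p M)) (≤-trans (m≤n+m (M + M * M) (suc M)) (≤-reflexive (lem M)))
  where
  lem : ∀ M → suc M + (M + M * M) ≡ suc M * suc M
  lem = solve-∀

occ-ids≤ : ∀ par p M → occ par p (ids M) ≤ M
occ-ids≤ par p M = ≤-trans (occ≤length par p (ids M)) (≤-reflexive (length-slice _ M))

weight≤total : ∀ g par p {c l} → c ∈ l → weight g par p c ≤ total g par p l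
weight≤total g par p (here refl) = m≤m+n _ _
weight≤total g par p {l = d ∷ l} (there m) = ≤-trans (weight≤total g par p m) (m≤n+m _ (weight g par p d))

total-ext : ∀ g {par par'} p l → (∀ {c} → c ∈ l → par c ≡ par' c) → total g par p l ≡ total g par' p l
total-ext g p [] h = refl
total-ext g {par} {par'} p (c ∷ l) h = cong₂ _+_ (cong (λ a → if does (a ≟ p) then g c else 0) (h (here refl))) (total-ext g p l (λ m → h (there m)))

-- Each side adds the contribution that `c` makes on the other one. This avoids subtraction and
-- treats alike the cases in which `c` leaves `p`, arrives at `p`, both or neither.
total-update : ∀ g par c q p M → c < M →
  total g (par [ c ↦ q ]) p (ids M) + weight g par p c ≡ total g par p (ids M) + weight g (par [ c ↦ q ]) p c
total-update g par c q p (suc M) (s≤s lt) with c ≟ M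
... | yes refl = trans (cong (λ t → weight g par' p c + t + weight g par p c) (total-ext g p (ids c) (λ m → update-neq par c (λ e → <-irrefl (sym e) (∈-ids⁻ c m)))))
    (lem (weight g par' p c) (total g par p (ids c)) (weight g par p c))
  where
  par' = par [ c ↦ q ]
  lem : ∀ a b c → a + b + c ≡ c + b + a
  lem = solve-∀
... | no ne = trans (+-assoc (weight g par' p M) _ _) (trans (cong₂ _+_
      (cong (λ a → if does (a ≟ p) then g M else 0) (update-neq par c ne))
      (total-update g par c q p M (≤∧≢⇒< lt ne))) (sym (+-assoc (weight g par p M) _ _)))
  where
  par' = par [ c ↦ q ]

-- The addition reads the array after the subtraction, so the result is also right when `c` is moved
-- to the parent it already has.
move-total : ∀ g par (f : ℕ → ℕ) c q M → c < M → (∀ p → f p ≡ total g par p (ids M)) →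
  let f₁ = f [ par c ↦ f (par c) ∸ g c ] in
  ∀ p → (f₁ [ q ↦ f₁ q + g c ]) p ≡ total g (par [ c ↦ q ]) p (ids M)
move-total g par f c q M lt h p with total-update g par c q p M lt | q ≟ p | par c ≟ p
... | eq | yes refl | yes e = trans (update-eq (f [ par c ↦ f (par c) ∸ g c ]) q refl) (trans (cong (_+ g c) (trans (update-eq f (par c) e) (cong (λ t → f t ∸ g c) e)))
  (trans (m∸n+n≡m (subst₂ _≤_ (weight-yes g par e) (sym (h q)) (weight≤total g par q (∈-ids M lt))))
    (trans (h q) (sym (+-cancelʳ-≡ (g c) _ _ (subst₂ (λ a b → total g (par [ c ↦ q ]) q (ids M) + a ≡ total g par q (ids M) + b)
       (weight-yes g par e) (weight-yes g (par [ c ↦ q ]) (update-eq par c refl)) eq))))))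
... | eq | yes refl | no e = trans (update-eq (f [ par c ↦ f (par c) ∸ g c ]) q refl) (trans (cong (_+ g c) (trans (update-neq f (par c) e) (h q)))
    (sym (trans (sym (+-identityʳ _)) (subst₂ (λ a b → total g (par [ c ↦ q ]) q (ids M) + a ≡ total g par q (ids M) + b)
       (weight-no g par e) (weight-yes g (par [ c ↦ q ]) (update-eq par c refl)) eq))))
... | eq | no e' | yes refl = trans (update-neq (f [ par c ↦ f (par c) ∸ g c ]) q e') (trans (update-eq f (par c) refl) (trans (cong (_∸ g c) (trans (h (par c))
    (trans (sym (+-identityʳ _)) (sym (subst₂ (λ a b → total g (par [ c ↦ q ]) (par c) (ids M) + a ≡ total g par (par c) (ids M) + b)
       (weight-yes g par refl) (weight-no g (par [ c ↦ q ]) (λ e → e' (trans (sym (update-eq par c refl)) e))) eq)))))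
    (m+n∸n≡m (total g (par [ c ↦ q ]) (par c) (ids M)) (g c))))
... | eq | no e' | no e = trans (update-neq (f [ par c ↦ f (par c) ∸ g c ]) q e') (trans (update-neq f (par c) e) (trans (h p)
    (sym (trans (sym (+-identityʳ _)) (trans (subst₂ (λ a b → total g (par [ c ↦ q ]) p (ids M) + a ≡ total g par p (ids M) + b)
       (weight-no g par e) (weight-no g (par [ c ↦ q ]) (λ e → e' (trans (sym (update-eq par c refl)) e))) eq) (+-identityʳ _))))))

sumOver : (ℕ → ℕ) → List ℕ → ℕ
sumOver f [] = 0
sumOver f (p ∷ I) = f p + sumOver f I

sumOver-weight : ∀ par c I → Unique I → sumOver (λ p → weight one par p c) I ≤ 1
sumOver-weight par c [] u = z≤n
sumOver-weight par c (p ∷ I) u with par c ≟ p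
... | no ne rewrite weight-no one par ne = sumOver-weight par c I (unique-tail u)
... | yes refl = +-mono-≤ (weight≤ one par (par c) c) (≤-reflexive (zeros I (unique-head u)))
  where
  zeros : ∀ I → par c ∉ I → sumOver (λ p → weight one par p c) I ≡ 0
  zeros [] m = refl
  zeros (q ∷ I) m = cong₂ _+_ (weight-no one par (λ e → m (here e))) (zeros I (λ m' → m (there m')))

sumOver-+ : ∀ f g I → sumOver (λ p → f p + g p) I ≡ sumOver f I + sumOver g I
sumOver-+ f g [] = refl
sumOver-+ f g (p ∷ I) = trans (cong (f p + g p +_) (sumOver-+ f g I)) (lem (f p) (g p) _ _)
  where
  lem : ∀ a b c d → a + b + (c + d) ≡ a + c + (b + d)
  lem = solve-∀

-- Each element of l has one parent, so summing over distinct parents counts it at most once.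
sumOver-occ : ∀ par I l → Unique I → sumOver (λ p → occ par p l) I ≤ length l
sumOver-occ par I [] u = ≤-reflexive (zeros I)
  where
  zeros : ∀ I → sumOver (λ p → 0) I ≡ 0
  zeros [] = refl
  zeros (_ ∷ I) = zeros I
sumOver-occ par I (c ∷ l) u = ≤-trans (≤-reflexive (sumOver-+ (λ p → weight one par p c) (λ p → occ par p l) I))
  (+-mono-≤ (sumOver-weight par c I u) (sumOver-occ par I l u))

sumOver-≥ : ∀ f I k → (∀ {p} → p ∈ I → k ≤ f p) → length I * k ≤ sumOver f I
sumOver-≥ f [] k h = z≤n
sumOver-≥ f (p ∷ I) k h = +-mono-≤ (h (here refl)) (sumOver-≥ f I k (λ m → h (there m)))

argmin : {P : ℕ → Set} (f : ℕ → ℕ) → Decidable P → ∀ l → (∃[ a ] (a ∈ l × P a)) →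
  ∃[ a ] (a ∈ l × P a × (∀ {b} → b ∈ l → P b → f a ≤ f b))
argmin f P? [] (_ , () , _)
argmin {P} f P? (c ∷ l) (a , m , p) with any? P? l
... | no none = c , here refl , pc , λ { (here refl) _ → ≤-refl ; (there m') p' → ⊥-elim (none (lose m' p')) }
  where
  pc : P c
  pc = [ (λ e → subst P e p) , (λ m' → ⊥-elim (none (lose m' p))) ]′ (split m)
    where
    split : a ∈ c ∷ l → a ≡ c ⊎ a ∈ l
    split (here e) = inj₁ e
    split (there m) = inj₂ m
... | yes some with argmin f P? l (find some) | P? c
... | b , mb , pb , mn | no np = b , there mb , pb , λ { (here refl) p' → ⊥-elim (np p') ; (there m') p' → mn m' p' }
... | b , mb , pb , mn | yes pc with f c ≤? f b
... | yes le = c , here refl , pc , λ { (here refl) _ → ≤-refl ; (there m') p' → ≤-trans le (mn m' p') }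
... | no nle = b , there mb , pb , λ { (here refl) _ → <⇒≤ (≰⇒> nle) ; (there m') p' → mn m' p' }

argmax : (f : ℕ → ℕ) → ∀ a l → ∃[ b ] (b ∈ a ∷ l × (∀ {c} → c ∈ a ∷ l → f c ≤ f b))
argmax f a [] = a , here refl , λ { (here refl) → ≤-refl }
argmax f a (d ∷ l) with argmax f d l
... | b , mb , mx with f a ≤? f b
... | yes le = b , there mb , λ { (here refl) → le ; (there m) → mx m }
... | no nle = a , here refl , λ { (here refl) → ≤-refl ; (there m) → ≤-trans (mx m) (<⇒≤ (≰⇒> nle)) }

-- Operations on the parent array

-- Node 0 is the root of the cotree, a union; vertex v is node 1 + v, and the inner nodes are numbered
-- from n + 1 on.  Unused nodes and vertices not yet inserted are children of the root.
rN rPos rNx rX rDeg rTail rH rA rP rI rG rU rF rS rK rZ rTg rW rT rQ rC rMc rMq : ℕ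
rN = 0
rPos = 1
rNx = 2
rX = 3
rDeg = 4
rTail = 5
rH = 6
rA = 7
rP = 8
rI = 9
rG = 10
rU = 11
rF = 12
rS = 13
rK = 14
rZ = 15
rTg = 16
rW = 17
rT = 18
rQ = 19
rC = 20
rMc = 21
rMq = 22

input output parent count sumOf type done mark queue gam iso hd tl nxt : ℕ
input = 0
output = 1
parent = 2
count = 3
sumOf = 4
type = 5
done = 6
mark = 7
queue = 8
gam = 9
iso = 10
hd = 11
tl = 12
nxt = 13

moveP : Program
moveP = rT := parent ! reg rMc
  ⨾ count [ reg rT ]:= count ! reg rT ⊖ const 1
  ⨾ sumOf [ reg rT ]:= sumOf ! reg rT ⊖ reg rMc
  ⨾ parent [ reg rMc ]:= reg rMq
  ⨾ count [ reg rMq ]:= count ! reg rMq ⊕ const 1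
  ⨾ sumOf [ reg rMq ]:= sumOf ! reg rMq ⊕ reg rMc

move : ℕ → ℕ → Program
move c q = rMc := reg c ⨾ rMq := reg q ⨾ moveP

-- The index is decremented before use: cells are visited from the last to the first, which is the
-- order of `slice`.
forQueue : Program → Program
forQueue P = rI := reg rTail ⨾ whileNonzero reg rI loop (rI := reg rI ⊖ const 1 ⨾ rG := queue ! reg rI ⨾ P)

closeB : Program
closeB = rA := queue ! reg rH
  ⨾ rH := reg rH ⊕ const 1
  ⨾ rP := parent ! reg rA
  ⨾ done [ reg rP ]:= done ! reg rP ⊕ const 1
  ⨾ ifEq (done ! reg rP) (count ! reg rP) (queue [ reg rTail ]:= reg rP ⨾ rTail := reg rTail ⊕ const 1) skip

-- A node enters the queue when its last child leaves it, so children precede their parents.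
closeP : Program
closeP = rH := const 0 ⨾ whileNonzero reg rTail ⊖ reg rH loop closeB

exec-bind : ∀ {W P P' σ T T' Q R} → Exec W P σ T Q → (∀ τ → Frame P σ τ → Q τ → Exec W P' τ T' R) → Exec W (P ⨾ P') σ (T + T') R
exec-bind e f = exec-seq (exec-mono (exec-frame e) ≤-refl (λ τ (fr , q) → f τ fr q))

closed≤ : ∀ a b → {True (a Data.Nat.≤ᵇ b)} → a ≤ b
closed≤ a b {p} = ≤ᵇ⇒≤ a b p

-- The sum of the children gives access to the last child left when all others are known.
Counted : ℕ → State → Set
Counted M σ = (∀ p → arrays σ count p ≡ occ (arrays σ parent) p (ids M)) × (∀ p → arrays σ sumOf p ≡ total (λ i → i) (arrays σ parent) p (ids M))

counted-frame : ∀ {M σ τ} → arrays τ parent ≡ arrays σ parent → arrays τ count ≡ arrays σ count → arrays τ sumOf ≡ arrays σ sumOf → Counted M σ → Counted M τ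
counted-frame e e' e'' (c , s) rewrite e | e' | e'' = c , s

-- Equal counts turn inclusion into equality: a child missing from `P` could be added to it, and the
-- longer list would exceed the number of all children.
occ-full : ∀ par p M {P} → Unique P → occ par p P ≡ occ par p (ids M) → (∀ {d} → d ∈ P → d < M) → ∀ c → c < M → par c ≡ p → c ∈ P
occ-full par p M {P} u e lt c c<M pc = decidable-stable (c ∈ℕ? P) λ c∉P →
  <⇒≱ (≤-reflexive (sym (trans (cong (_+ occ par p P) (weight-yes one par pc)) (cong suc e))))
    (total-mono one par p {c ∷ P} (unique-cons c∉P u) (λ { (here refl) _ → ∈-ids M c<M ; (there m) _ → ∈-ids M (lt m) }))

occ-two : ∀ par p M {d d'} → d < M → d' < M → d ≢ d' → par d ≡ p → par d' ≡ p → 2 ≤ occ par p (ids M)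
occ-two par p M {d} {d'} l l' ne e e' = ≤-trans
  (≤-reflexive (sym (cong₂ (λ a b → a + (b + 0)) (weight-yes one par e) (weight-yes one par e'))))
  (total-mono one par p {d ∷ d' ∷ []} (unique-cons (λ { (here r) → ne r }) (unique-cons (λ ()) []))
    (λ { (here refl) _ → ∈-ids M l ; (there (here refl)) _ → ∈-ids M l' }))

slice-⊆ : ∀ f {h t} → h ≤ t → ∀ {c} → c ∈ slice f h → c ∈ slice f t
slice-⊆ f {h} {zero} z≤n m = m
slice-⊆ f {h} {suc t} le m with h ≟ suc t
... | yes refl = m
... | no ne = there (slice-⊆ f (≤-pred (≤∧≢⇒< le ne)) m)

slice-unique : ∀ f {h t} → h ≤ t → Unique (slice f t) → Unique (slice f h)
slice-unique f {h} {zero} z≤n u = u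
slice-unique f {h} {suc t} le u with h ≟ suc t
... | yes refl = u
... | no ne = slice-unique f (≤-pred (≤∧≢⇒< le ne)) (unique-tail u)

nonzero : ∀ {m} → m ≢ 0 → ∃[ k ] m ≡ suc k
nonzero {zero} ne = ⊥-elim (ne refl)
nonzero {suc k} ne = k , refl

module _ (W : ℕ) (1≤W : 1 ≤ W) where

  -- Each cell costs `T` for the body and 9 for the rest: 2 for the guard, 4 for the decrement, 3
  -- for the fetch. The remaining 4 steps are the initial assignment and the last test.
  exec-forQueue : ∀ (P : Program) (J : List ℕ → State → Set) {T} →
    {True (notReg rI P)} → {True (notArr queue P)} →
    (∀ l σ a → J l σ → J l (setReg rI a σ)) → (∀ l σ a → J l σ → J l (setReg rG a σ)) →
    (∀ g l τ → J (g ∷ l) τ → regs τ rG ≡ g → Exec W P τ T (J l)) →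
    ∀ σ → J (slice (arrays σ queue) (regs σ rTail)) σ →
    Exec W (forQueue P) σ (4 + (9 + T) * regs σ rTail) (λ τ → J [] τ)
  exec-forQueue P J {T} {nI} {nQ} stI stG step σ j =
    exec-mono (exec-seq (wp-sound (rI := reg rTail) σ (tt ,
      exec-while I (reg rI) (λ _ → 7 + T) (λ _ _ _ → tt) stop body (slice (arrays σ queue) (regs σ rTail)) _ (stI _ σ _ j , refl))))
      (≤-trans (≤-reflexive (cong (2 +_) (trans (totalCost-const 2 (7 + T) (slice (arrays σ queue) (regs σ rTail))) (cong (λ t → 2 + (9 + T) * t) (length-slice (arrays σ queue) (regs σ rTail)))))) ≤-refl)
      fin
    where
    I : List ℕ → State → Set
    I l τ = J l τ × slice (arrays τ queue) (regs τ rI) ≡ l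
    stop : ∀ τ → I [] τ → regs τ rI ≡ 0
    stop τ (_ , e) with regs τ rI
    ... | zero = refl
    body : ∀ g l τ → I (g ∷ l) τ → regs τ rI ≢ 0 → Exec W (rI := reg rI ⊖ const 1 ⨾ rG := queue ! reg rI ⨾ P) τ (7 + T) (I l)
    body g l τ (j , e) nz = exec-mono
      (exec-seq (wp-sound (rI := reg rI ⊖ const 1) τ ((tt , 1≤W) , exec-seq (wp-sound (rG := queue ! reg rI) _ (tt ,
        exec-mono (exec-frame (step g l _ (stG _ _ _ (stI _ _ _ j)) (proj₁ gl))) ≤-refl
          (λ τ' (fr , j') → j' , trans (cong₂ slice (arr≡ fr queue {nQ}) (reg≡ fr rI {nI})) (proj₂ gl)))))))
      ≤-refl (λ _ q → q)
      where
      gl : arrays τ queue (regs τ rI ∸ 1) ≡ g × slice (arrays τ queue) (regs τ rI ∸ 1) ≡ l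
      gl = pop (arrays τ queue) (regs τ rI) nz e
        where
        pop : ∀ f i {g l} → i ≢ 0 → slice f i ≡ g ∷ l → f (i ∸ 1) ≡ g × slice f (i ∸ 1) ≡ l
        pop f zero ne e = ⊥-elim (ne refl)
        pop f (suc i) ne refl = refl , refl
    fin : ∀ τ → ∃[ l' ] (I l' τ × regs τ rI ≡ 0) → J [] τ
    fin τ (l' , (j , e) , z) = subst (λ l → J l τ) (trans (sym e) (cong (slice (arrays τ queue)) z)) j

  module _ (M : ℕ) (M≤W : M ≤ W) (MM≤W : M * M ≤ W) where

    -- Overflow is excluded because the new entries are again a number of children and a sum of
    -- their numbers, at most `M` and `M * M`. This is what makes a quadratic word bound necessary.
    exec-moveP : ∀ σ → regs σ rMc < M → Counted M σ → Exec W moveP σ (time moveP)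
      (λ τ → arrays τ parent ≡ arrays σ parent [ regs σ rMc ↦ regs σ rMq ] × Counted M τ)
    exec-moveP σ lt (c , s) = wp-sound moveP σ (tt , tt , (tt , 1≤W) , tt , (tt , tt) , tt , tt ,
      tt , (tt , 1≤W , ≤-trans (≤-reflexive cq) (≤-trans (occ-ids≤ _ _ M) M≤W)) ,
      tt , (tt , tt , ≤-trans (≤-reflexive sq) (≤-trans (total-id≤ _ _ M) MM≤W)) ,
      refl , c' , s')
      where
      x = regs σ rMc
      q = regs σ rMq
      par = arrays σ parent
      c' = move-total one par (arrays σ count) x q M lt c
      s' = move-total (λ i → i) par (arrays σ sumOf) x q M lt s
      cq = trans (sym (update-eq (arrays σ count [ par x ↦ arrays σ count (par x) ∸ 1 ]) q refl)) (c' q)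
      sq = trans (sym (update-eq (arrays σ sumOf [ par x ↦ arrays σ sumOf (par x) ∸ x ]) q refl)) (s' q)

    exec-move : ∀ a b σ → {True (not (does (rMc ≟ b)))} → regs σ a < M → Counted M σ → Exec W (move a b) σ 40
      (λ τ → arrays τ parent ≡ arrays σ parent [ regs σ a ↦ regs σ b ] × Counted M τ)
    exec-move a b σ {p} lt cs = exec-mono (exec-seq (wp-sound (rMc := reg a) σ (tt ,
      exec-seq (wp-sound (rMq := reg b) _ (tt , exec-moveP _ lt cs)))))
      (closed≤ (2 + (2 + time moveP)) 40) (λ τ (e , c) → trans e (cong (λ t → arrays σ parent [ regs σ a ↦ t ]) (update-other (regs σ) {rMc} {b} p)) , c)

-- Passes over the queue of full nodes

record Closure (n nx : ℕ) (par : ℕ → ℕ) (Y D : List ℕ) : Set where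
  field
    unique : Unique D
    start  : ∀ {y} → y ∈ Y → y ∈ D
    kind   : ∀ {d} → d ∈ D → d ∈ Y ⊎ (n < d × d < nx)
    down   : ∀ {a c} → n < a → a ∈ D → par c ≡ a → c ∈ D
    up     : ∀ {a} → n < a → a < nx → (∀ c → par c ≡ a → c ∈ D) → a ∈ D
    small  : length D ≤ length Y + length Y

-- Marks are time stamps: the stored value is the node number of the current vertex, larger than all
-- earlier marks, so nothing has to be erased. `resetB` brings `done` back to zero by undoing the
-- increments of the closing pass; on the way it subtracts the full children of `u` from `rS`, which
-- leaves the sum of the others.
markB selectB resetB transferB : Program
markB = rP := parent ! reg rG
  ⨾ ifNonzero count ! reg rP ⊖ done ! reg rP
    then (ifNonzero reg rP
      then (rT := parent ! reg rP ⨾ mark [ reg rT ]:= reg rX ⨾ rT := parent ! reg rT ⨾ mark [ reg rT ]:= reg rX)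
      else skip)
    else skip
selectB = rP := parent ! reg rG
  ⨾ ifNonzero count ! reg rP ⊖ done ! reg rP
    then (ifNonzero reg rX ⊖ mark ! reg rP then (rF := reg rG ⨾ rU := reg rP) else skip)
    else skip
resetB = rP := parent ! reg rG
  ⨾ done [ reg rP ]:= done ! reg rP ⊖ const 1
  ⨾ ifEq (reg rP) (reg rU) (rS := reg rS ⊖ reg rG) skip
transferB = ifEq (parent ! reg rG) (reg rU) (move rG rTg) skip

-- What marking and selecting read but never change; `view-frame` transports all statements about it
-- by a single equation.
record View : Set where
  constructor view-of
  field
    par cnt dn : ℕ → ℕ
    D : List ℕ
    X : ℕ

view : State → View
view σ = view-of (arrays σ parent) (arrays σ count) (arrays σ done) (slice (arrays σ queue) (regs σ rTail)) (regs σ rX)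

view-frame : ∀ {P σ τ} → Frame P σ τ → {True (notArr parent P)} → {True (notArr count P)} → {True (notArr done P)} →
  {True (notArr queue P)} → {True (notReg rTail P)} → {True (notReg rX P)} → view τ ≡ view σ
view-frame {P} {σ} {τ} fr {a} {b} {c} {d} {e} {f} with arr≡ fr parent {a} | arr≡ fr count {b} | arr≡ fr done {c} | arr≡ fr queue {d} | reg≡ fr rTail {e} | reg≡ fr rX {f}
... | p | q | r | s | t | u = lem p q r (cong₂ slice s t) u
  where
  lem : ∀ {p p' q q' r r' : ℕ → ℕ} {s s' : List ℕ} {u u' : ℕ} → p ≡ p' → q ≡ q' → r ≡ r' → s ≡ s' → u ≡ u' →
    view-of p q r s u ≡ view-of p' q' r' s' u'
  lem refl refl refl refl refl = refl

-- Unions and joins alternate, so any other partially full node lies one or two levels above such a node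
-- unless it is the lowest one.
Marks : View → ℕ → ℕ → Set
Marks V g a = cnt (par g) ∸ dn (par g) ≢ 0 × par g ≢ 0 × (par (par g) ≡ a ⊎ par (par (par g)) ≡ a)
  where open View V

record Marked (V : View) (l : List ℕ) (mk : ℕ → ℕ) : Set where
  field
    sound    : ∀ a → mk a < View.X V ⊎ (mk a ≡ View.X V × ∃[ g ] (g ∈ View.D V × Marks V g a))
    complete : ∀ {g} → g ∈ View.D V → g ∈ l ⊎ (∀ a → Marks V g a → mk a ≡ View.X V)
    sub      : ∀ {g} → g ∈ l → g ∈ View.D V

Candidate : View → (ℕ → ℕ) → ℕ → Set
Candidate V mk g = cnt (par g) ∸ dn (par g) ≢ 0 × X ∸ mk (par g) ≢ 0
  where open View V

Selected : View → (ℕ → ℕ) → ℕ → ℕ → Set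
Selected V mk f u = f ∈ View.D V × Candidate V mk f × u ≡ View.par V f

module _ (W : ℕ) (1≤W : 1 ≤ W) where

  exec-mark : ∀ σ → (∀ a → arrays σ mark a < regs σ rX) →
    Exec W (forQueue markB) σ (4 + 60 * regs σ rTail) (λ τ → Marked (view σ) [] (arrays τ mark))
  exec-mark σ lt = exec-mono (exec-frame (exec-forQueue W 1≤W markB J (λ _ _ _ j → j) (λ _ _ _ j → j) step σ init))
    (+-monoʳ-≤ 4 (*-monoˡ-≤ (regs σ rTail) (closed≤ (9 + time markB) 60)))
    (λ τ (fr , j) → subst (λ V → Marked V [] (arrays τ mark)) (view-frame fr) j)
    where
    J : List ℕ → State → Set
    J l τ = Marked (view τ) l (arrays τ mark)
    init : J _ σ
    init = record { sound = λ a → inj₁ (lt a) ; complete = inj₁ ; sub = λ m → m }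
    skipped : ∀ {V g l mk} → Marked V (g ∷ l) mk → (∀ a → ¬ Marks V g a) → Marked V l mk
    skipped j none .Marked.sound = Marked.sound j
    skipped j none .Marked.complete m with Marked.complete j m
    ... | inj₁ (here refl) = inj₂ (λ a ms → ⊥-elim (none a ms))
    ... | inj₁ (there m') = inj₁ m'
    ... | inj₂ h = inj₂ h
    skipped j none .Marked.sub m = Marked.sub j (there m)
    step : ∀ g l τ → J (g ∷ l) τ → regs τ rG ≡ g → Exec W markB τ (time markB) (J l)
    step g l τ j refl = wp-sound markB τ (tt , (tt , tt) , full , (λ z → skipped j (λ a (nz , _) → nz z)))
      where
      V = view τ
      par = arrays τ parent
      p = par g
      full : arrays τ count p ∸ arrays τ done p ≢ 0 → _
      full nz = tt , (λ p≢0 → tt , tt , tt , tt , tt , tt , record { sound = snd p≢0 ; complete = cmp ; sub = λ m → Marked.sub j (there m) })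
          , (λ p≡0 → skipped j (λ a (_ , p≢0 , _) → p≢0 p≡0))
        where
        X = regs τ rX
        mk = arrays τ mark
        mk₁ = mk [ par p ↦ X ]
        mk₂ = mk₁ [ par (par p) ↦ X ]
        new : ∀ a → (par p ≡ a ⊎ par (par p) ≡ a) → mk₂ a ≡ X
        new a h with par (par p) ≟ a
        ... | yes e = update-eq mk₁ (par (par p)) e
        new a (inj₁ e) | no ne = trans (update-neq mk₁ (par (par p)) ne) (update-eq mk (par p) e)
        new a (inj₂ e) | no ne = ⊥-elim (ne e)
        old : ∀ a → par p ≢ a → par (par p) ≢ a → mk₂ a ≡ mk a
        old a n₁ n₂ = trans (update-neq mk₁ (par (par p)) n₂) (update-neq mk (par p) n₁)
        snd : p ≢ 0 → ∀ a → mk₂ a < X ⊎ (mk₂ a ≡ X × ∃[ g ] (g ∈ View.D V × Marks V g a))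
        snd p≢0 a with par p ≟ a | par (par p) ≟ a
        ... | yes e | _ = inj₂ (new a (inj₁ e) , g , Marked.sub j (here refl) , nz , p≢0 , inj₁ e)
        ... | no _ | yes e = inj₂ (new a (inj₂ e) , g , Marked.sub j (here refl) , nz , p≢0 , inj₂ e)
        ... | no n₁ | no n₂ with Marked.sound j a
        ...   | inj₁ lt' = inj₁ (subst (_< X) (sym (old a n₁ n₂)) lt')
        ...   | inj₂ (e , r) = inj₂ (trans (old a n₁ n₂) e , r)
        cmp : ∀ {g'} → g' ∈ View.D V → g' ∈ l ⊎ (∀ a → Marks V g' a → mk₂ a ≡ X)
        cmp m with Marked.complete j m
        ... | inj₁ (here refl) = inj₂ (λ a (_ , _ , h) → new a h)
        ... | inj₁ (there m') = inj₁ m'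
        ... | inj₂ h = inj₂ h'
          where
          h' : ∀ a → _ → mk₂ a ≡ X
          h' a ms with par p ≟ a | par (par p) ≟ a
          ... | yes e | _ = new a (inj₁ e)
          ... | no _ | yes e = new a (inj₂ e)
          ... | no n₁ | no n₂ = trans (old a n₁ n₂) (h a ms)

  -- The invariant is a disjunction: either a candidate is stored already, or all candidates are
  -- still ahead. The assumed candidate rules out that the list ends in the second case.
  exec-select : ∀ σ → (∃[ f ] (f ∈ View.D (view σ) × Candidate (view σ) (arrays σ mark) f)) →
    Exec W (forQueue selectB) σ (4 + 60 * regs σ rTail) (λ τ → Selected (view σ) (arrays σ mark) (regs τ rF) (regs τ rU))
  exec-select σ (f , f∈D , cf) = exec-mono (exec-frame (exec-forQueue W 1≤W selectB J (λ _ _ _ j → j) (λ _ _ _ j → j) step σ ((λ _ m → m) , inj₂ (λ _ m _ → m))))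
    (+-monoʳ-≤ 4 (*-monoˡ-≤ (regs σ rTail) (closed≤ (9 + time selectB) 60))) fin
    where
    J : List ℕ → State → Set
    J l τ = (∀ g → g ∈ l → g ∈ View.D (view τ)) × (Selected (view τ) (arrays τ mark) (regs τ rF) (regs τ rU)
          ⊎ (∀ g → g ∈ View.D (view τ) → Candidate (view τ) (arrays τ mark) g → g ∈ l))
    fin : ∀ τ → Frame (forQueue selectB) σ τ × J [] τ → Selected (view σ) (arrays σ mark) (regs τ rF) (regs τ rU)
    fin τ (fr , _ , inj₁ s) = subst₂ (λ V mk → Selected V mk (regs τ rF) (regs τ rU)) (view-frame fr) (arr≡ fr mark) s
    fin τ (fr , _ , inj₂ h) with subst₂ (λ V mk → f ∈ View.D V × Candidate V mk f) (sym (view-frame fr)) (sym (arr≡ fr mark)) (f∈D , cf)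
    ... | m , c with h f m c
    ... | ()
    step : ∀ g l τ → J (g ∷ l) τ → regs τ rG ≡ g → Exec W selectB τ (time selectB) (J l)
    step g l τ (sub , j) refl = wp-sound selectB τ (tt , (tt , tt) ,
        (λ nz → (tt , tt) , (λ nz' → tt , tt , (λ _ m → sub _ (there m)) , inj₁ (sub _ (here refl) , (nz , nz') , refl)) , (λ z → (λ _ m → sub _ (there m)) , dismiss {V = view τ} {arrays τ mark} (λ (_ , c) → c z) j)) ,
        (λ z → (λ _ m → sub _ (there m)) , dismiss {V = view τ} {arrays τ mark} (λ (c , _) → c z) j))
      where
      dismiss : ∀ {S : Set} {V : View} {mk : ℕ → ℕ} → ¬ Candidate V mk g → S ⊎ (∀ g' → g' ∈ View.D V → Candidate V mk g' → g' ∈ g ∷ l) →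
        S ⊎ (∀ g' → g' ∈ View.D V → Candidate V mk g' → g' ∈ l)
      dismiss nc (inj₁ s) = inj₁ s
      dismiss {V = V} {mk} nc (inj₂ h) = inj₂ λ g' m c → tail (h g' m c) c
        where
        tail : ∀ {g'} → g' ∈ g ∷ l → Candidate V mk g' → g' ∈ l
        tail (here refl) c = ⊥-elim (nc c)
        tail (there m) c = m

  -- Writing `rS` as `R` plus the part still to be subtracted shows that no truncated difference
  -- ever cuts off, although the subtraction proceeds one child at a time.
  exec-reset : ∀ σ R → (∀ p → arrays σ done p ≡ occ (arrays σ parent) p (View.D (view σ))) →
    regs σ rS ≡ R + total (λ i → i) (arrays σ parent) (regs σ rU) (View.D (view σ)) →
    Exec W (forQueue resetB) σ (4 + 60 * regs σ rTail) (λ τ → (∀ p → arrays τ done p ≡ 0) × regs τ rS ≡ R)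
  exec-reset σ R dn s = exec-mono (exec-forQueue W 1≤W resetB J (λ _ _ _ j → j) (λ _ _ _ j → j) step σ (dn , s))
    (+-monoʳ-≤ 4 (*-monoˡ-≤ (regs σ rTail) (closed≤ (9 + time resetB) 60))) (λ τ (d , e) → d , trans e (+-identityʳ R))
    where
    J : List ℕ → State → Set
    J l τ = (∀ p → arrays τ done p ≡ occ (arrays τ parent) p l) × regs τ rS ≡ R + total (λ i → i) (arrays τ parent) (regs τ rU) l
    step : ∀ g l τ → J (g ∷ l) τ → regs τ rG ≡ g → Exec W resetB τ (time resetB) (J l)
    step g l τ (d , e) refl = wp-sound resetB τ (tt , tt , (tt , 1≤W) ,
        wp-ifEq {W = W} {σ = σ₁} (reg rP) (reg rU) (rS := reg rS ⊖ reg rG) skip {J l} tt tt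
          (λ eq → (tt , tt) , d' , trans (cong (_∸ regs τ rG) (trans e (cong (λ t → R + (t + total (λ i → i) par (regs τ rU) l)) (weight-yes (λ i → i) par eq)))) (lem R (regs τ rG) _))
          (λ ne → d' , trans e (cong (λ t → R + (t + total (λ i → i) par (regs τ rU) l)) (weight-no (λ i → i) par ne))))
      where
      par = arrays τ parent
      p = par (regs τ rG)
      σ₁ = setCell done p (arrays τ done p ∸ 1) (setReg rP p τ)
      lem : ∀ R a b → R + (a + b) ∸ a ≡ R + b
      lem R a b = trans (cong (_∸ a) (trans (+-comm R (a + b)) (+-assoc a b R))) (trans (m+n∸m≡n a (b + R)) (+-comm b R))
      d' : ∀ q → (arrays τ done [ p ↦ arrays τ done p ∸ 1 ]) q ≡ occ par q l
      d' q with p ≟ q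
      ... | yes refl = trans (update-eq (arrays τ done) p refl) (trans (cong (_∸ 1) (d p)) (cong (λ t → t + occ par p l ∸ 1) (weight-yes one par refl)))
      ... | no ne = trans (update-neq (arrays τ done) p ne) (trans (d q) (cong (_+ occ par q l) (weight-no one par ne)))

  -- The loop tests the array that it modifies, whereas the result refers to the initial array
  -- `par₀`. Both agree on nodes still ahead, since no node occurs twice in the queue.
  exec-transfer : ∀ M → M ≤ W → M * M ≤ W → ∀ σ → let D = View.D (view σ) ; par₀ = arrays σ parent in
    Unique D → (∀ {d} → d ∈ D → d < M) → Counted M σ → regs σ rTg ≢ regs σ rU →
    Exec W (forQueue transferB) σ (4 + 100 * regs σ rTail)
      (λ τ → (∀ c → ((c ∈ D × par₀ c ≡ regs σ rU) × arrays τ parent c ≡ regs σ rTg) ⊎ (¬ (c ∈ D × par₀ c ≡ regs σ rU) × arrays τ parent c ≡ par₀ c)) × Counted M τ)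
  exec-transfer M M≤W MM≤W σ uD D<M cs tg≢u = exec-mono (exec-forQueue W 1≤W transferB J (λ _ _ _ j → record { J j }) (λ _ _ _ j → record { J j }) step σ init)
    (+-monoʳ-≤ 4 (*-monoˡ-≤ (regs σ rTail) (closed≤ (9 + 58) 100)))
    fin
    where
    D = View.D (view σ)
    par₀ = arrays σ parent
    u = regs σ rU
    tg = regs σ rTg
    record J (l : List ℕ) (τ : State) : Set where
      field
        ru : regs τ rU ≡ u
        rtg : regs τ rTg ≡ tg
        counted : Counted M τ
        values : ∀ c → arrays τ parent c ≡ par₀ c ⊎ ((c ∈ D × par₀ c ≡ u) × arrays τ parent c ≡ tg)
        moved : ∀ {c} → c ∈ D → par₀ c ≡ u → c ∈ l ⊎ arrays τ parent c ≡ tg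
        later : ∀ {c} → c ∈ l → arrays τ parent c ≡ par₀ c
        uniq : Unique l
        sub : ∀ {c} → c ∈ l → c ∈ D
    init : J D σ
    init = record { ru = refl ; rtg = refl ; counted = cs ; values = λ c → inj₁ refl ; moved = λ m _ → inj₁ m ; later = λ _ → refl ; uniq = uD ; sub = λ m → m }
    fin : ∀ τ → J [] τ → (∀ c → ((c ∈ D × par₀ c ≡ u) × arrays τ parent c ≡ tg) ⊎ (¬ (c ∈ D × par₀ c ≡ u) × arrays τ parent c ≡ par₀ c)) × Counted M τ
    fin τ j = cases , J.counted j
      where
      cases : ∀ c → ((c ∈ D × par₀ c ≡ u) × arrays τ parent c ≡ tg) ⊎ (¬ (c ∈ D × par₀ c ≡ u) × arrays τ parent c ≡ par₀ c)
      cases c with c ∈ℕ? D | par₀ c ≟ u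
      ... | yes m | yes e with J.moved j m e
      ...   | inj₂ r = inj₁ ((m , e) , r)
      cases c | yes m | no ne with J.values j c
      ...   | inj₁ r = inj₂ ((λ (_ , e) → ne e) , r)
      ...   | inj₂ ((_ , e) , _) = ⊥-elim (ne e)
      cases c | no nm | _ with J.values j c
      ...   | inj₁ r = inj₂ ((λ (m , _) → nm m) , r)
      ...   | inj₂ ((m , _) , _) = ⊥-elim (nm m)
    step : ∀ g l τ → J (g ∷ l) τ → regs τ rG ≡ g → Exec W transferB τ 58 (J l)
    step g l τ j refl = exec-mono (exec-ifEq {P₁ = move rG rTg} {P₂ = skip} {e = parent ! reg rG} {f = reg rU} tt tt yes-case no-case) (closed≤ _ 58) (λ _ q → q)
      where
      open J j
      par = arrays τ parent
      pg : par g ≡ par₀ g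
      pg = later (here refl)
      yes-case : par g ≡ regs τ rU → Exec W (move rG rTg) τ 40 (J l)
      yes-case eq = exec-mono (exec-frame (exec-move W 1≤W M M≤W MM≤W rG rTg τ (D<M (sub (here refl))) counted)) ≤-refl post
        where
        post : ∀ τ' → _ → J l τ'
        post τ' (fr , pe , c') = record
          { ru = trans (reg≡ fr rU) ru ; rtg = trans (reg≡ fr rTg) rtg ; counted = c'
          ; values = vals ; moved = mvd ; later = λ {c} m → trans (other (λ { refl → unique-head uniq m })) (later (there m))
          ; uniq = unique-tail uniq ; sub = λ m → sub (there m) }
          where
          same : arrays τ' parent g ≡ tg
          same = trans (cong (λ f → f g) pe) (trans (update-eq par g refl) rtg)
          other : ∀ {c} → g ≢ c → arrays τ' parent c ≡ par c
          other {c} ne = trans (cong (λ f → f c) pe) (update-neq par g ne)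
          vals : ∀ c → arrays τ' parent c ≡ par₀ c ⊎ ((c ∈ D × par₀ c ≡ u) × arrays τ' parent c ≡ tg)
          vals c with g ≟ c
          ... | yes refl = inj₂ ((sub (here refl) , trans (sym pg) (trans eq ru)) , same)
          ... | no ne with values c
          ...   | inj₁ e = inj₁ (trans (other ne) e)
          ...   | inj₂ (a , e) = inj₂ (a , trans (other ne) e)
          mvd : ∀ {c} → c ∈ D → par₀ c ≡ u → c ∈ l ⊎ arrays τ' parent c ≡ tg
          mvd {c} m e with g ≟ c
          ... | yes refl = inj₂ same
          ... | no ne with moved m e
          ...   | inj₁ (here e') = ⊥-elim (ne (sym e'))
          ...   | inj₁ (there m') = inj₁ m'
          ...   | inj₂ e' = inj₂ (trans (other ne) e')
      no-case : par g ≢ regs τ rU → Exec W skip τ 1 (J l)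
      no-case ne = wp-sound skip τ record
        { ru = ru ; rtg = rtg ; counted = counted ; values = values ; moved = mvd ; later = λ m → later (there m) ; uniq = unique-tail uniq ; sub = λ m → sub (there m) }
        where
        mvd : ∀ {c} → c ∈ D → par₀ c ≡ u → c ∈ l ⊎ arrays τ parent c ≡ tg
        mvd {c} m e with moved m e
        ... | inj₁ (here refl) = ⊥-elim (ne (trans pg (trans e (sym ru))))
        ... | inj₁ (there m') = inj₁ m'
        ... | inj₂ e' = inj₂ e'

-- Only the full children of `u` can be listed in time, so they are the ones to move. If a join has
-- several other children, a new join takes the place of `u`, with `u` and the full children below
-- it; if a union has several full children, a new union below it collects them. When a join has a
-- single child that is not full, that child is the value of `rS`.
--
-- Then `rZ` is the part to be paired with `x`: by a union below a join, by a join below a union. If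
-- it is an inner node of this other type, `x` is hung below it; otherwise a new node takes both.
openP splitP attachP pairP reshapeP insertP : Program
openP = rTg := reg rNx ⨾ rNx := reg rNx ⊕ const 1 ⨾ type [ reg rTg ]:= type ! reg rU
splitP = ifNonzero type ! reg rU
  then (ifNonzero reg rK ⊖ const 1
    then ((openP ⨾ rQ := parent ! reg rU) ⨾ move rTg rQ ⨾ move rU rTg ⨾ rZ := reg rU ⨾ forQueue transferB)
    else (rZ := reg rS))
  else (ifNonzero reg rC ⊖ const 1
    then (openP ⨾ move rTg rU ⨾ rZ := reg rTg ⨾ forQueue transferB)
    else (rZ := reg rF))
attachP = ifNonzero reg rW then skip
  else ((rW := reg rNx ⨾ rNx := reg rNx ⊕ const 1 ⨾ type [ reg rW ]:= const 1 ⊖ type ! reg rU ⨾ rQ := parent ! reg rZ)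
    ⨾ move rW rQ ⨾ move rZ rW)
pairP = (rW := const 0 ⨾ ifNonzero count ! reg rZ then (ifEq (type ! reg rZ) (type ! reg rU) skip (rW := reg rZ)) else skip)
  ⨾ attachP ⨾ move rX rW
reshapeP = forQueue markB ⨾ forQueue selectB
  ⨾ (rC := done ! reg rU ⨾ rK := count ! reg rU ⊖ reg rC ⨾ rS := sumOf ! reg rU)
  ⨾ forQueue resetB ⨾ splitP ⨾ pairP
insertP = closeP ⨾ ifNonzero reg rTail then reshapeP else skip

occ-two∈ : ∀ par p {l d d'} → d ∈ l → d' ∈ l → d ≢ d' → par d ≡ p → par d' ≡ p → 2 ≤ occ par p l
occ-two∈ par p {l} {d} {d'} m m' ne e e' = ≤-trans
  (≤-reflexive (sym (cong₂ (λ a b → a + (b + 0)) (weight-yes one par e) (weight-yes one par e'))))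
  (total-mono one par p {d ∷ d' ∷ []} (unique-cons (λ { (here r) → ne r }) (unique-cons (λ ()) []))
    (λ { (here refl) _ → m ; (there (here refl)) _ → m' }))

another : ∀ par p {l} f → Unique l → 2 ≤ occ par p l → ∃[ c ] (c ∈ l × par c ≡ p × c ≢ f)
another par p {l} f u le with any? (λ c → (par c ≟ p) ×-dec ¬? (c ≟ f)) l
... | yes r = let (c , m , e , ne) = find r in c , m , e , ne
... | no none = ⊥-elim (<⇒≱ le (≤-trans (total-mono one par p {l' = f ∷ []} u sub) (occ≤length par p (f ∷ []))))
  where
  sub : ∀ {c} → c ∈ l → par c ≡ p → c ∈ f ∷ []
  sub {c} m e with c ≟ f
  ... | yes refl = here refl
  ... | no ne = ⊥-elim (none (lose m (e , ne)))

two-outside : ∀ par p M {D c} → Unique D → c ∉ D → par c ≡ p → suc (suc (occ par p D)) ≤ occ par p (ids M) →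
  ∃[ c' ] (c' ∉ D × par c' ≡ p × c ≢ c')
two-outside par p M {D} {c} u c∉ pc le with bounded-search (λ d → (par d ≟ p) ×-dec (¬? (d ∈ℕ? D) ×-dec ¬? (c ≟ d))) M
... | inj₁ (d , e , m , ne) = d , m , e , ne
... | inj₂ none = ⊥-elim (<⇒≱ le (≤-trans (total-mono one par p {l' = c ∷ D} (ids-unique M) sub) (+-monoˡ-≤ (occ par p D) (weight≤ one par p c))))
  where
  sub : ∀ {d} → d ∈ ids M → par d ≡ p → d ∈ c ∷ D
  sub {d} m e with d ∈ℕ? D | c ≟ d
  ... | yes r | _ = there r
  ... | no _ | yes refl = here refl
  ... | no r | no ne = ⊥-elim (none d (∈-ids⁻ M m) (e , r , ne))

record TreeView : Set where
  constructor tree-view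
  field
    par typ cnt sm : ℕ → ℕ
    nx : ℕ
    D : List ℕ

treeView : State → TreeView
treeView σ = tree-view (arrays σ parent) (arrays σ type) (arrays σ count) (arrays σ sumOf) (regs σ rNx) (slice (arrays σ queue) (regs σ rTail))

child-of : ∀ par p M → occ par p (ids M) ≢ 0 → ∃[ c ] par c ≡ p
child-of par p M ne with bounded-search (λ c → par c ≟ p) M
... | inj₁ r = r
... | inj₂ none = ⊥-elim (ne (n≤0⇒n≡0 (total-mono one par p {l' = []} (ids-unique M) (λ m e → ⊥-elim (none _ (∈-ids⁻ M m) e)))))

-- Only neighbours with a smaller number enter the queue; the edges to later ones are dealt with
-- when those are inserted.
readB loadP vertexP : Program
readB = rDeg := reg rDeg ⊖ const 1 ⨾ rA := input ! reg rPos ⊕ const 1 ⨾ rPos := reg rPos ⊕ const 1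
  ⨾ ifNonzero reg rX ⊖ reg rA then (queue [ reg rTail ]:= reg rA ⨾ rTail := reg rTail ⊕ const 1) else skip
loadP = (rX := reg rX ⊕ const 1 ⨾ rDeg := input ! reg rPos ⨾ rPos := reg rPos ⊕ const 1 ⨾ rTail := const 0)
  ⨾ whileNonzero reg rDeg loop readB
vertexP = loadP ⨾ insertP

Reads : ℕ → State → List ℕ → Set
Reads len σ l = (∀ i → arrays σ input (regs σ rPos + i) ≡ contents l i) × regs σ rPos + length l ≡ len

reads-head : ∀ {len σ a l} → Reads len σ (a ∷ l) → arrays σ input (regs σ rPos) ≡ a × regs σ rPos + 1 ≤ len
reads-head {σ = σ} {l = l} (r , b) = trans (cong (arrays σ input) (sym (+-identityʳ _))) (r 0)
  , ≤-trans (+-monoʳ-≤ (regs σ rPos) (s≤s z≤n)) (≤-reflexive b)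

reads-tail : ∀ {len σ τ a l} → arrays τ input ≡ arrays σ input → regs τ rPos ≡ regs σ rPos + 1 → Reads len σ (a ∷ l) → Reads len τ l
reads-tail {len} {σ} {τ} {a} {l} e e' (r , b) =
  (λ i → trans (cong₂ (λ f p → f (p + i)) e e') (trans (cong (arrays σ input) (+-assoc (regs σ rPos) 1 i)) (r (suc i)))) ,
  trans (cong (_+ length l) e') (trans (+-assoc (regs σ rPos) 1 (length l)) b)

-- Evaluating the cotree

rE : ℕ
rE = 23

-- Children are merged into their parent one at a time, so a node with many children is treated as
-- an iterated binary union or join. The value 0 of `hd` stands for a node into which nothing has
-- been merged. `chooseP` leaves in `rE` a vertex of the side that it drops, which is the one that
-- `extendP` may append.
copyP unionP chooseP extendP joinP mergeP mergeB : Program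
copyP = hd [ reg rP ]:= hd ! reg rA ⨾ tl [ reg rP ]:= tl ! reg rA ⨾ gam [ reg rP ]:= gam ! reg rA ⨾ iso [ reg rP ]:= iso ! reg rA
unionP = nxt [ tl ! reg rA ]:= hd ! reg rP ⨾ hd [ reg rP ]:= hd ! reg rA ⨾ gam [ reg rP ]:= gam ! reg rP ⊕ gam ! reg rA
  ⨾ ifNonzero iso ! reg rA then iso [ reg rP ]:= const 1 else skip
chooseP = ifNonzero (gam ! reg rA ⊕ iso ! reg rA) ⊖ (gam ! reg rP ⊕ iso ! reg rP) then (rE := hd ! reg rP ⨾ copyP) else (rE := hd ! reg rA)
extendP = ifNonzero iso ! reg rP
  then (nxt [ reg rE ]:= hd ! reg rP ⨾ hd [ reg rP ]:= reg rE ⨾ gam [ reg rP ]:= gam ! reg rP ⊕ const 1 ⨾ iso [ reg rP ]:= const 0)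
  else skip
joinP = chooseP ⨾ extendP
mergeP = ifNonzero hd ! reg rP then (ifNonzero type ! reg rP then joinP else unionP) else copyP
mergeB = (rA := queue ! reg rI ⨾ rI := reg rI ⊕ const 1 ⨾ rP := parent ! reg rA) ⨾ mergeP

collectP : Program
collectP = rI := const 0 ⨾ whileNonzero reg rTail ⊖ reg rI loop mergeB

∈-slice⁻ : ∀ f {c} k → c ∈ slice f k → ∃[ j ] (j < k × f j ≡ c)
∈-slice⁻ f (suc k) (here e) = k , ≤-refl , sym e
∈-slice⁻ f (suc k) (there m) with ∈-slice⁻ f k m
... | j , lt , e = j , m≤n⇒m≤1+n lt , e

-- The program

-- All arrays start at zero, so every node number below the bound is a child of node 0 at first; the
-- loop of `initP` fills in the matching `count` and `sumOf` of the root.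
initP seedB seedP outB outputP vertices finalP program : Program
initP = (rN := input ! const 0 ⨾ rPos := const 1 ⨾ rNx := reg rN ⊕ const 1 ⨾ rA := (reg rN ⊕ reg rN) ⊕ (reg rN ⊕ const 3))
  ⨾ whileNonzero reg rA ⊖ reg rI loop
      (count [ const 0 ]:= count ! const 0 ⊕ const 1 ⨾ sumOf [ const 0 ]:= sumOf ! const 0 ⊕ reg rI ⨾ rI := reg rI ⊕ const 1)
vertices = whileNonzero reg rN ⊖ reg rX loop vertexP
seedB = rA := reg rTail ⊕ const 1 ⨾ queue [ reg rTail ]:= reg rA ⨾ rTail := reg rA
  ⨾ gam [ reg rA ]:= const 1 ⨾ iso [ reg rA ]:= const 1 ⨾ hd [ reg rA ]:= reg rA ⨾ tl [ reg rA ]:= reg rA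
seedP = rTail := const 0 ⨾ whileNonzero reg rN ⊖ reg rTail loop seedB
outB = output [ reg rK ]:= reg rA ⊖ const 1 ⨾ rA := nxt ! reg rA ⨾ rK := reg rK ⊖ const 1
outputP = (output [ const 0 ]:= gam ! const 0 ⨾ rK := gam ! const 0 ⨾ rA := hd ! const 0) ⨾ whileNonzero reg rK loop outB
finalP = seedP ⨾ closeP ⨾ collectP ⨾ outputP
program = initP ⨾ vertices ⨾ finalP

data From {n : ℕ} : ℕ → List (Fin n) → Set where
  []  : From n []
  _∷_ : ∀ {k v vs} → toℕ v ≡ k → From (suc k) vs → From k (v ∷ vs)

from-tabulate : ∀ {n} j {k} (f : Fin j → Fin n) → (∀ i → toℕ (f i) ≡ k + toℕ i) → k + j ≡ n → From k (tabulate f)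
from-tabulate {n} zero {k} f h e = subst (λ m → From m []) (sym (trans (sym (+-identityʳ k)) e)) []
from-tabulate (suc j) {k} f h e = trans (h Fin.zero) (+-identityʳ k) ∷
  from-tabulate j (λ i → f (Fin.suc i)) (λ i → trans (h (Fin.suc i)) (+-suc k (toℕ i))) (trans (sym (+-suc k j)) e)

from-allFin : ∀ n → From 0 (allFin n)
from-allFin n = from-tabulate n (λ i → i) (λ i → refl) refl

data At (f : ℕ → ℕ) : ℕ → List ℕ → Set where
  []  : ∀ {k} → At f k []
  _∷_ : ∀ {k y ys} → f k ≡ y → At f (suc k) ys → At f k (y ∷ ys)

at-lookup : ∀ {f k ys} → At f k ys → ∀ i → f (k + toℕ i) ≡ lookup ys i
at-lookup {f} {k} (e ∷ a) Fin.zero = trans (cong f (+-identityʳ k)) e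
at-lookup {f} {k} (e ∷ a) (Fin.suc i) = trans (cong f (+-suc k (toℕ i))) (at-lookup a i)

at-update : ∀ {f j c k ys} → j < k → At f k ys → At (f [ j ↦ c ]) k ys
at-update lt [] = []
at-update {f} {j} lt (e ∷ a) = trans (update-neq f j (<⇒≢ lt)) e ∷ at-update (m≤n⇒m≤1+n lt) a

slice-suc-≤ : ∀ {y} k → y ∈ slice suc k → y ≢ 0 × y ≤ k
slice-suc-≤ (suc k) (here refl) = (λ ()) , ≤-refl
slice-suc-≤ (suc k) (there m) = proj₁ (slice-suc-≤ k m) , m≤n⇒m≤1+n (proj₂ (slice-suc-≤ k m))

slice-suc-∈ : ∀ {i} k → i < k → suc i ∈ slice suc k
slice-suc-∈ {i} (suc k) lt with i ≟ k
... | yes refl = here refl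
... | no ne = there (slice-suc-∈ k (≤∧≢⇒< (≤-pred lt) ne))

slice-suc-unique : ∀ k → Unique (slice suc k)
slice-suc-unique zero = []
slice-suc-unique (suc k) = unique-cons (λ m → 1+n≰n (proj₂ (slice-suc-≤ k m))) (slice-suc-unique k)

-- Input size and word size

unique-⊆-length : {A : Set} {xs ys : List A} → Unique xs → (∀ {x} → x ∈ xs → x ∈ ys) → length xs ≤ length ys
unique-⊆-length {xs = []} u sub = z≤n
unique-⊆-length {A} {x ∷ xs} u sub with ∈-∃++ (sub (here refl))
... | as , bs , refl = ≤-trans (s≤s (unique-⊆-length (unique-tail u) sub')) (≤-reflexive (trans (cong suc (length-++ as)) (trans (sym (+-suc (length as) (length bs))) (sym (length-++ as)))))
  where
  sub' : ∀ {y} → y ∈ xs → y ∈ as ++ bs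
  sub' m with ∈-++⁻ as (sub (there m))
  ... | inj₁ q = ∈-++⁺ˡ q
  ... | inj₂ (here refl) = ⊥-elim (unique-head u m)
  ... | inj₂ (there q) = ∈-++⁺ʳ as q

linear-≤ : ∀ a b c n m → a + b * n + c * m ≤ (a + b + c) * (1 + (n + m))
linear-≤ a b c n m = ≤-trans (m≤m+n _ (a * (n + m) + b * (1 + m) + c * (1 + n))) (≤-reflexive (lem a b c n m))
  where
  lem : ∀ a b c n m → a + b * n + c * m + (a * (n + m) + b * (1 + m) + c * (1 + n)) ≡ (a + b + c) * (1 + (n + m))
  lem = solve-∀

collect-terms : ∀ a b c d e f g n m → (a + b * ((n + n) + (n + 3))) + ((c + d * n + e * (m + m)) + (f + g * n)) ≡
  (a + b * 3 + c + f) + (b * 3 + d + g) * n + (e * 2) * m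
collect-terms = solve-∀

-- Of the six factors `2 + N`, four are bounded below by 2 and give the constant 16; the other two
-- make room for the square of the number of nodes, where a factor 9 is needed.
word-large : ∀ N → 16 * ((2 + N) * (2 + N)) ≤ wordBound 5 N
word-large N = ≤-trans (*-mono-≤ (^-monoˡ-≤ 4 {2} {2 + N} (s≤s (s≤s z≤n))) (≤-reflexive (cong ((2 + N) *_) (sym (*-identityʳ (2 + N))))))
  (≤-reflexive (sym (^-distribˡ-+-* (2 + N) 4 2)))

module Bounds (n m : ℕ) where

  B : ℕ
  B = 2 + (n + m)

  below-word : ∀ {k} → k ≤ 16 * (B * B) → k ≤ wordBound 5 (n + m)
  below-word le = ≤-trans le (word-large (n + m))

  2B≤ : B + B ≤ 16 * (B * B)
  2B≤ = ≤-trans (+-mono-≤ (m≤m*n B B) (m≤m*n B B)) (≤-trans (≤-reflexive (lem (B * B))) (*-monoˡ-≤ (B * B) (closed≤ 2 16)))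
    where
    lem : ∀ b → b + b ≡ 2 * b
    lem = solve-∀

  1≤word : 1 ≤ wordBound 5 (n + m)
  1≤word = below-word (≤-trans (s≤s z≤n) 2B≤)

  n<word : n < wordBound 5 (n + m)
  n<word = below-word (≤-trans (≤-trans (s≤s (≤-trans (m≤m+n n m) (n≤1+n (n + m)))) (m≤m+n B B)) 2B≤)

  input≤word : ∀ {d} → d ≤ m + m → 1 + (n + d) ≤ wordBound 5 (n + m)
  input≤word le = below-word (≤-trans (≤-trans (s≤s (+-monoʳ-≤ n le)) (≤-trans (m≤m+n _ (3 + n)) (≤-reflexive (lem n m)))) 2B≤)
    where
    lem : ∀ n m → suc (n + (m + m)) + (3 + n) ≡ (2 + (n + m)) + (2 + (n + m))
    lem = solve-∀

  M : ℕ
  M = (n + n) + (n + 3)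

  MM≤word : M * M ≤ wordBound 5 (n + m)
  MM≤word = below-word (≤-trans (*-mono-≤ M≤3B M≤3B) (≤-trans (≤-reflexive (lem B)) (*-monoˡ-≤ (B * B) (closed≤ 9 16))))
    where
    lem : ∀ b → (3 * b) * (3 * b) ≡ 9 * (b * b)
    lem = solve-∀
    lem' : ∀ n m → (n + n) + (n + 3) + (3 + 3 * m) ≡ 3 * (2 + (n + m))
    lem' = solve-∀
    M≤3B : M ≤ 3 * B
    M≤3B = ≤-trans (m≤m+n M (3 + 3 * m)) (≤-reflexive (lem' n m))

  M≤word : M ≤ wordBound 5 (n + m)
  M≤word = ≤-trans (≤-trans (≤-reflexive (sym (*-identityʳ M))) (*-monoʳ-≤ M (≤-trans (s≤s z≤n) (≤-reflexive (lem n))))) MM≤word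
    where
    lem : ∀ n → suc ((n + n) + (n + 2)) ≡ (n + n) + (n + 3)
    lem = solve-∀

module Correctness {n : ℕ} (G : Graph n) where
  open Graph G

  -- Inserting a vertex creates at most two inner nodes.
  M : ℕ
  M = (n + n) + (n + 3)

  -- Double neighbourhood sequences of unions and joins

  open DecMem (Fin._≟_ {n}) using () renaming (_∈?_ to _∈L?_)

  dom : Fin n → List (Fin n) → ℕ
  dom = timesDominated G

  dominates⇒ : ∀ {u v} → u ∈ₛ N[ v ] → u ≡ v ⊎ v ~ u
  dominates⇒ {u} {v} p with x∈p∪q⁻ _ _ p
  ... | inj₁ q = inj₁ (x∈⁅y⁆⇒x≡y _ q)
  ... | inj₂ q with v ~? u | trans (sym (lookup∘tabulate (λ u → does (v ~? u)) u)) ([]=⇒lookup q)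
  ... | yes r | _ = inj₂ r

  dominates-self : ∀ v → v ∈ₛ N[ v ]
  dominates-self v = x∈p∪q⁺ (inj₁ (x∈⁅x⁆ v))

  dominates-adj : ∀ {u v} → v ~ u → u ∈ₛ N[ v ]
  dominates-adj {u} {v} r = x∈p∪q⁺ {p = Data.Fin.Subset.⁅ v ⁆} (inj₂ (lookup⇒[]= u _
    (trans (lookup∘tabulate (λ u → does (v ~? u)) u) (dec-true (v ~? u) r))))

  dom-yes : ∀ {u v} S → u ∈ₛ N[ v ] → dom u (v ∷ S) ≡ suc (dom u S)
  dom-yes {u} S p = cong length (filter-accept (λ v → u ∈? N[ v ]) p)

  dom-no : ∀ {u v} S → ¬ (u ∈ₛ N[ v ]) → dom u (v ∷ S) ≡ dom u S
  dom-no {u} S p = cong length (filter-reject (λ v → u ∈? N[ v ]) p)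

  dom-∷-≥ : ∀ u v S → dom u S ≤ dom u (v ∷ S)
  dom-∷-≥ u v S with u ∈? N[ v ]
  ... | yes p = n≤1+n _
  ... | no p = ≤-refl

  dom≤length : ∀ u S → dom u S ≤ length S
  dom≤length u [] = z≤n
  dom≤length u (v ∷ S) with u ∈? N[ v ]
  ... | yes p = s≤s (dom≤length u S)
  ... | no p = m≤n⇒m≤1+n (dom≤length u S)

  dom-one : ∀ {u a} S → a ∈ S → u ∈ₛ N[ a ] → 1 ≤ dom u S
  dom-one (a ∷ S) (here refl) d = ≤-trans (s≤s z≤n) (≤-reflexive (sym (dom-yes S d)))
  dom-one (b ∷ S) (there m) d = ≤-trans (dom-one S m d) (dom-∷-≥ _ b S)

  dom-two : ∀ {u a b} S → a ∈ S → b ∈ S → a ≢ b → u ∈ₛ N[ a ] → u ∈ₛ N[ b ] → 2 ≤ dom u S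
  dom-two S (here refl) (here refl) ne d e = ⊥-elim (ne refl)
  dom-two (a ∷ S) (here refl) (there m) ne d e = ≤-trans (s≤s (dom-one S m e)) (≤-reflexive (sym (dom-yes S d)))
  dom-two (a ∷ S) (there m) (here refl) ne d e = ≤-trans (s≤s (dom-one S m d)) (≤-reflexive (sym (dom-yes S e)))
  dom-two (a ∷ S) (there m) (there m') ne d e = ≤-trans (dom-two S m m' ne d e) (dom-∷-≥ _ a S)

  dom-none : ∀ {u} S → (∀ {a} → a ∈ S → ¬ (u ∈ₛ N[ a ])) → dom u S ≡ 0
  dom-none [] f = refl
  dom-none (a ∷ S) f = trans (dom-no S (f (here refl))) (dom-none S (λ m → f (there m)))

  dom-++ : ∀ u S S' → dom u (S ++ S') ≡ dom u S + dom u S'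
  dom-++ u [] S' = refl
  dom-++ u (v ∷ S) S' with u ∈? N[ v ]
  ... | yes p = cong suc (dom-++ u S S')
  ... | no p = dom-++ u S S'

  -- Double neighbourhood sequences of the subgraph induced by X, last vertex first.
  data Legal (X : Fin n → Set) : List (Fin n) → Set where
    []  : Legal X []
    add : ∀ {v S u} → X v → v ∉ S → X u → u ∈ₛ N[ v ] → dom u S ≤ 1 → Legal X S → Legal X (v ∷ S)

  legal-⊆ : ∀ {X S} → Legal X S → ∀ {v} → v ∈ S → X v
  legal-⊆ (add x _ _ _ _ l) (here refl) = x
  legal-⊆ (add x _ _ _ _ l) (there m) = legal-⊆ l m

  legal-mono : ∀ {X Z S} → (∀ {v} → X v → Z v) → Legal X S → Legal Z S
  legal-mono f [] = []
  legal-mono f (add x ∉S xu d le l) = add (f x) ∉S (f xu) d le (legal-mono f l)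

  Max : (Fin n → Set) → ℕ → Set
  Max X g = ∀ S → Legal X S → length S ≤ g

  -- If `u` and its neighbour `w` both occurred in `S`, then `u` would be dominated twice. So one of
  -- them is new, and `u` is its footprint.
  extend : ∀ {X S u w} → Legal X S → X u → dom u S ≤ 1 → X w → u ~ w → ∃[ v ] Legal X (v ∷ S)
  extend {X} {S} {u} {w} l xu le xw a with u ∈L? S | w ∈L? S
  ... | no q | _ = u , add xu q xu (dominates-self u) le l
  ... | yes p | no q = w , add xw q xu (dominates-adj (~-sym a)) le l
  ... | yes p | yes q = ⊥-elim (<⇒≱ (dom-two S p q (λ { refl → ~-irrefl _ a }) (dominates-self u) (dominates-adj (~-sym a))) le)

  Isolated : (Fin n → Set) → Fin n → Set
  Isolated X w = X w × (∀ v → X v → ¬ (w ~ v))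

  -- The second alternative is the positive form of having no isolated vertex: it provides the
  -- neighbour that `extend` asks for.
  IsoFlag : (Fin n → Set) → ℕ → Set
  IsoFlag X i = (i ≡ 1 × (∃[ w ] Isolated X w)) ⊎ (i ≡ 0 × (∀ u → X u → ∃[ w ] (X w × u ~ w)))

  -- With `g + i` as the bound one may always count a further step as long as some vertex is
  -- dominated at most once: without isolated vertices the step really exists by `extend`, and
  -- otherwise the flag pays for it.
  extend-δ : ∀ {X g i S u} → Max X g → IsoFlag X i → Legal X S → X u → dom u S ≤ 1 → suc (length S) ≤ g + i
  extend-δ {g = g} mx (inj₁ (refl , _)) l xu le = ≤-trans (s≤s (mx _ l)) (≤-reflexive (+-comm 1 g))
  extend-δ {g = g} mx (inj₂ (refl , nb)) l xu le with nb _ xu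
  ... | w , xw , a with extend l xu le xw a
  ... | v , l' = ≤-trans (mx _ l') (≤-reflexive (sym (+-identityʳ g)))

  -- A vertex that is not dominated at all can itself be appended as its own footprint. It is then
  -- dominated once, and `extend-δ` counts one step more.
  extend-δ₂ : ∀ {X g i S u} → Max X g → IsoFlag X i → Legal X S → X u → dom u S ≡ 0 → suc (suc (length S)) ≤ g + i
  extend-δ₂ {S = S} {u} mx io l xu z = extend-δ mx io
    (add xu (λ m → 1+n≰n (≤-trans (dom-one S m (dominates-self u)) (≤-reflexive z))) xu (dominates-self u) (≤-trans (≤-reflexive z) z≤n) l)
    xu (≤-reflexive (trans (dom-yes S (dominates-self u)) (cong suc z)))

  Nonadjacent Joined : (X Y : Fin n → Set) → Set
  Nonadjacent X Y = ∀ {x y} → X x → Y y → x ≢ y × ¬ (x ~ y)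
  Joined X Y = ∀ {x y} → X x → Y y → x ~ y

  nonadjacent-sym : ∀ {X Y} → Nonadjacent X Y → Nonadjacent Y X
  nonadjacent-sym f y x with f x y
  ... | p , q = (λ e → p (sym e)) , (λ a → q (~-sym a))

  not-dominated : ∀ {X Y u v} → Nonadjacent X Y → X v → Y u → ¬ (u ∈ₛ N[ v ])
  not-dominated f x y d with dominates⇒ d
  ... | inj₁ refl = proj₁ (f x y) refl
  ... | inj₂ a = proj₂ (f x y) a

  module _ {X Y Z : Fin n → Set} (Z⇒ : ∀ {v} → Z v → X v ⊎ Y v) where

    -- Vertices of one side dominate nothing on the other, so deleting a side changes no domination
    -- count on the side that stays, and every footprint stays with its vertex.
    restrict-union : Nonadjacent X Y → ∀ {S} → Legal Z S →
      ∃[ S₁ ] ∃[ S₂ ] (Legal X S₁ × Legal Y S₂ × length S ≡ length S₁ + length S₂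
        × (∀ {v} → v ∈ S₁ → v ∈ S) × (∀ {v} → v ∈ S₂ → v ∈ S)
        × (∀ {u} → X u → dom u S ≡ dom u S₁) × (∀ {u} → Y u → dom u S ≡ dom u S₂))
    restrict-union na [] = [] , [] , [] , [] , refl , (λ ()) , (λ ()) , (λ _ → refl) , (λ _ → refl)
    restrict-union na (add {v} {S} {u} z ∉S zu d le l) with restrict-union na l
    ... | S₁ , S₂ , l₁ , l₂ , len , s₁ , s₂ , d₁ , d₂ with Z⇒ z
    ... | inj₁ x = v ∷ S₁ , S₂ , add x (λ m → ∉S (s₁ m)) xu d (subst (_≤ 1) (d₁ xu) le) l₁ , l₂ , cong suc len
        , (λ { (here e) → here e ; (there m) → there (s₁ m) }) , (λ m → there (s₂ m))
        , dX , (λ y → trans (dom-no S (not-dominated na x y)) (d₂ y))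
      where
      xu : X u
      xu with Z⇒ zu
      ... | inj₁ q = q
      ... | inj₂ y = ⊥-elim (not-dominated na x y d)
      dX : ∀ {u} → X u → dom u (v ∷ S) ≡ dom u (v ∷ S₁)
      dX {u} q with u ∈? N[ v ]
      ... | yes _ = cong suc (d₁ q)
      ... | no _ = d₁ q
    ... | inj₂ x = S₁ , v ∷ S₂ , l₁ , add x (λ m → ∉S (s₂ m)) xu d (subst (_≤ 1) (d₂ xu) le) l₂
        , trans (cong suc len) (sym (+-suc _ _))
        , (λ m → there (s₁ m)) , (λ { (here e) → here e ; (there m) → there (s₂ m) })
        , (λ y → trans (dom-no S (not-dominated (nonadjacent-sym na) x y)) (d₁ y)) , dX
      where
      xu : Y u
      xu with Z⇒ zu
      ... | inj₂ q = q
      ... | inj₁ y = ⊥-elim (not-dominated (nonadjacent-sym na) x y d)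
      dX : ∀ {u} → Y u → dom u (v ∷ S) ≡ dom u (v ∷ S₂)
      dX {u} q with u ∈? N[ v ]
      ... | yes _ = cong suc (d₂ q)
      ... | no _ = d₂ q

    max-union : ∀ {g h} → Nonadjacent X Y → Max X g → Max Y h → Max Z (g + h)
    max-union na mx my S l with restrict-union na l
    ... | S₁ , S₂ , l₁ , l₂ , len , _ = ≤-trans (≤-reflexive len) (+-mono-≤ (mx _ l₁) (my _ l₂))

    -- A vertex of the other side dominates all of X, so it is a footprint only
    -- for the first two vertices, which are legal in X anyway.
    legal-restrict : ∀ {v u S S₁ S₂} → Legal X S₁ → X v → v ∉ S₁ → Z u → u ∈ₛ N[ v ] → dom u S ≤ 1 →
      (∀ {u} → X u → dom u S ≡ dom u S₁ + length S₂) → (∀ {u} → Y u → dom u S ≡ length S₁ + dom u S₂) →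
      Legal X (v ∷ S₁)
    legal-restrict {v} {u} {S} {S₁} l₁ x ∉S₁ zu d le dX dY with length S₁ ≤? 1 | Z⇒ zu
    ... | yes p | _ = add x ∉S₁ x (dominates-self v) (≤-trans (dom≤length v S₁) p) l₁
    ... | no p | inj₁ xu = add x ∉S₁ xu d (≤-trans (≤-trans (m≤m+n _ _) (≤-reflexive (sym (dX xu)))) le) l₁
    ... | no p | inj₂ yu = ⊥-elim (p (≤-trans (≤-trans (m≤m+n _ _) (≤-reflexive (sym (dY yu)))) le))

  -- A vertex of one side adds one to the count of every vertex of the other side, hence the terms
  -- with `length`.
  restrict-join : ∀ {X Y Z} → (∀ {v} → Z v → X v ⊎ Y v) → Joined X Y → ∀ {S} → Legal Z S →
      ∃[ S₁ ] ∃[ S₂ ] (Legal X S₁ × Legal Y S₂ × length S ≡ length S₁ + length S₂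
        × (∀ {v} → v ∈ S₁ → v ∈ S) × (∀ {v} → v ∈ S₂ → v ∈ S)
        × (∀ {u} → X u → dom u S ≡ dom u S₁ + length S₂) × (∀ {u} → Y u → dom u S ≡ length S₁ + dom u S₂))
  restrict-join Z⇒ jn [] = [] , [] , [] , [] , refl , (λ ()) , (λ ()) , (λ _ → refl) , (λ _ → refl)
  restrict-join {X} {Y} Z⇒ jn (add {v} {S} {u} z ∉S zu d le l) with restrict-join Z⇒ jn l
  ... | S₁ , S₂ , l₁ , l₂ , len , s₁ , s₂ , dX , dY with Z⇒ z
  ... | inj₁ x = v ∷ S₁ , S₂ , legal-restrict Z⇒ {S = S} {S₂ = S₂} l₁ x (λ m → ∉S (s₁ m)) zu d le dX dY , l₂ , cong suc len
      , (λ { (here e) → here e ; (there m) → there (s₁ m) }) , (λ m → there (s₂ m))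
      , dX' , (λ y → trans (dom-yes S (dominates-adj (jn x y))) (cong suc (dY y)))
    where
    dX' : ∀ {u} → X u → dom u (v ∷ S) ≡ dom u (v ∷ S₁) + length S₂
    dX' {u} q with u ∈? N[ v ]
    ... | yes _ = cong suc (dX q)
    ... | no _ = dX q
  ... | inj₂ x = S₁ , v ∷ S₂ , l₁ , legal-restrict (λ z → ⊎-swap (Z⇒ z)) {S = S} {S₂ = S₁} l₂ x (λ m → ∉S (s₂ m)) zu d le
          (λ y → trans (dY y) (+-comm (length S₁) _)) (λ y → trans (dX y) (+-comm _ (length S₂)))
      , trans (cong suc len) (sym (+-suc _ _))
      , (λ m → there (s₁ m)) , (λ { (here e) → here e ; (there m) → there (s₂ m) })
      , (λ y → trans (dom-yes S (dominates-adj (~-sym (jn y x)))) (trans (cong suc (dX y)) (sym (+-suc _ _)))) , dX'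
    where
    dX' : ∀ {u} → Y u → dom u (v ∷ S) ≡ length S₁ + dom u (v ∷ S₂)
    dX' {u} q with u ∈? N[ v ]
    ... | yes _ = trans (cong suc (dY q)) (sym (+-suc _ _))
    ... | no _ = dY q

  -- Here `s₂` vertices come from the other side, and each of them dominates `u`. If there is none,
  -- `extend-δ` applies; if there is one, `u` is undominated within `X` and the second step of
  -- `extend-δ₂` makes up for it; two would leave no footprint at `u`.
  max-join-half : ∀ {X g i S₁} s₂ {u} → Max X g → IsoFlag X i → Legal X S₁ → X u →
    dom u S₁ + s₂ ≤ 1 → suc (length S₁ + s₂) ≤ g + i
  max-join-half {g = g} {i} {S₁} zero {u} mx io l xu le =
    subst (λ k → suc k ≤ g + i) (sym (+-identityʳ (length S₁))) (extend-δ mx io l xu (subst (_≤ 1) (+-identityʳ (dom u S₁)) le))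
  max-join-half {g = g} {i} {S₁} (suc zero) {u} mx io l xu le =
    subst (λ k → suc k ≤ g + i) (+-comm 1 (length S₁))
      (extend-δ₂ mx io l xu (n≤0⇒n≡0 (≤-pred (subst (_≤ 1) (+-comm (dom u S₁) 1) le))))
  max-join-half {S₁ = S₁} (suc (suc k)) {u} mx io l xu le =
    ⊥-elim (<⇒≱ {1} (≤-trans (s≤s (s≤s z≤n)) (m≤n+m (suc (suc k)) (dom u S₁))) le)

  -- Only the footprint of the last vertex matters: if it lies in X, then at most
  -- one vertex of Y was used before.
  max-join : ∀ {X Y Z g i h j} → (∀ {v} → Z v → X v ⊎ Y v) → Joined X Y →
    Max X g → IsoFlag X i → Max Y h → IsoFlag Y j → ∀ {k} → g + i ≤ k → h + j ≤ k → Max Z k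
  max-join Z⇒ jn mx ix my iy p q [] l = z≤n
  max-join Z⇒ jn mx ix my iy p q (v ∷ S) (add z ∉S zu d le l) with restrict-join Z⇒ jn l
  ... | S₁ , S₂ , l₁ , l₂ , len , s₁ , s₂ , dX , dY with Z⇒ zu
  ... | inj₁ xu = ≤-trans (≤-reflexive (cong suc len)) (≤-trans (max-join-half (length S₂) mx ix l₁ xu (subst (_≤ 1) (dX xu) le)) p)
  ... | inj₂ yu = ≤-trans (≤-reflexive (cong suc (trans len (+-comm (length S₁) _))))
      (≤-trans (max-join-half (length S₁) my iy l₂ yu (subst (_≤ 1) (trans (dY yu) (+-comm (length S₁) _)) le)) q)

  legal-union : ∀ {X Y Z L₁ L₂} → (∀ {v} → X v → Z v) → (∀ {v} → Y v → Z v) → Nonadjacent X Y →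
    Legal X L₁ → Legal Y L₂ → Legal Z (L₁ ++ L₂)
  legal-union f g na [] l₂ = legal-mono g l₂
  legal-union {X} {Y} {L₂ = L₂} f g na (add {v} {S} {u} x ∉S xu d le l₁) l₂ =
    add (f x) (λ m → [ ∉S , (λ m' → proj₁ (na x (legal-⊆ l₂ m')) refl) ]′ (∈-++⁻ S m)) (f xu) d
      (subst (_≤ 1) (sym (trans (dom-++ u S L₂) (trans (cong (dom u S +_)
        (dom-none L₂ (λ m → not-dominated (nonadjacent-sym na) (legal-⊆ l₂ m) xu))) (+-identityʳ _)))) le)
      (legal-union f g na l₁ l₂)

  -- Within `X` only `w` dominates `w`, and a legal sequence contains it at most once.
  dom-isolated : ∀ {X w S} → Isolated X w → Legal X S → dom w S ≤ 1
  dom-isolated iw [] = z≤n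
  dom-isolated {w = w} iw (add {v} {S} x ∉S xu d le l) with w ∈? N[ v ]
  ... | no p = dom-isolated iw l
  ... | yes p with dominates⇒ p
  ... | inj₂ a = ⊥-elim (proj₂ iw v x (~-sym a))
  ... | inj₁ refl = s≤s (≤-reflexive (dom-none S (λ {a} m q → case (dominates⇒ q) m)))
    where
    case : ∀ {a} → w ≡ a ⊎ a ~ w → a ∈ S → ⊥
    case (inj₁ refl) m = ∉S m
    case (inj₂ r) m = proj₂ iw _ (legal-⊆ l m) (~-sym r)

  legal-join : ∀ {X Y Z L w y} → (∀ {v} → X v → Z v) → (∀ {v} → Y v → Z v) → Joined X Y →
    Legal X L → Isolated X w → Y y → Legal Z (y ∷ L)
  legal-join f g jn l iw yy = add (g yy) (λ m → ~-irrefl _ (jn (legal-⊆ l m) yy)) (f (proj₁ iw))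
    (dominates-adj (~-sym (jn (proj₁ iw) yy))) (dom-isolated iw l) (legal-mono f l)

  iso-join : ∀ {X Y Z} → (∀ {v} → Z v → X v ⊎ Y v) → (∀ {v} → X v → Z v) → (∀ {v} → Y v → Z v) → Joined X Y →
    ∃[ x ] X x → ∃[ y ] Y y → IsoFlag Z 0
  iso-join {X} {Y} {Z} Z⇒ f g jn (x , xx) (y , yy) = inj₂ (refl , h)
    where
    h : ∀ u → Z u → ∃[ w ] (Z w × u ~ w)
    h u zu with Z⇒ zu
    ... | inj₁ xu = y , g yy , jn xu yy
    ... | inj₂ yu = x , f xx , ~-sym (jn xx yu)

  iso-union : ∀ {X Y Z i j k} → (∀ {v} → Z v → X v ⊎ Y v) → (∀ {v} → X v → Z v) → (∀ {v} → Y v → Z v) → Nonadjacent X Y →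
    IsoFlag X i → IsoFlag Y j → (i ≢ 0 → k ≡ 1) → (i ≡ 0 → k ≡ j) → IsoFlag Z k
  iso-union {X} {Y} {Z} Z⇒ f g na (inj₁ (refl , w , xw , iw)) jy k₁ k₂ = inj₁ (k₁ (λ ()) , w , f xw , h)
    where
    h : ∀ v → Z v → ¬ (w ~ v)
    h v zv with Z⇒ zv
    ... | inj₁ xv = iw v xv
    ... | inj₂ yv = proj₂ (na xw yv)
  iso-union {X} {Y} {Z} Z⇒ f g na (inj₂ (refl , _)) (inj₁ (refl , w , yw , iw)) k₁ k₂ = inj₁ (k₂ refl , w , g yw , h)
    where
    h : ∀ v → Z v → ¬ (w ~ v)
    h v zv with Z⇒ zv
    ... | inj₂ yv = iw v yv
    ... | inj₁ xv = proj₂ (nonadjacent-sym na yw xv)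
  iso-union {X} {Y} {Z} Z⇒ f g na (inj₂ (refl , p)) (inj₂ (refl , q)) k₁ k₂ = inj₂ (k₂ refl , h)
    where
    h : ∀ u → Z u → ∃[ w ] (Z w × u ~ w)
    h u zu with Z⇒ zu
    ... | inj₁ xu = let (w , xw , a) = p u xu in w , f xw , a
    ... | inj₂ yu = let (w , yw , a) = q u yu in w , g yw , a

  legal-unique : ∀ {X L} → Legal X L → Unique L
  legal-unique [] = []
  legal-unique (add x ∉S xu d le l) = ¬Any⇒All¬ _ ∉S ∷ legal-unique l

  legal-suffix : ∀ {X} A {B} → Legal X (A ++ B) → Legal X B
  legal-suffix [] l = l
  legal-suffix (a ∷ A) (add _ _ _ _ _ l) = legal-suffix A l

  Everything : Fin n → Set
  Everything _ = ⊤

  dom-reverse : ∀ u A → dom u (reverse A) ≡ dom u A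
  dom-reverse u [] = refl
  dom-reverse u (v ∷ A) = begin
    dom u (reverse (v ∷ A))           ≡⟨ cong (dom u) (unfold-reverse v A) ⟩
    dom u (reverse A ++ v ∷ [])       ≡⟨ dom-++ u (reverse A) (v ∷ []) ⟩
    dom u (reverse A) + dom u (v ∷ [])≡⟨ +-comm (dom u (reverse A)) _ ⟩
    dom u (v ∷ []) + dom u (reverse A)≡⟨ cong (dom u (v ∷ []) +_) (dom-reverse u A) ⟩
    dom u (v ∷ []) + dom u A          ≡⟨ sym (dom-++ u (v ∷ []) A) ⟩
    dom u (v ∷ A)                     ∎
    where open ≡-Reasoning

  legal-take : ∀ {X} S k → Legal X (reverse S) → Legal X (reverse (take k S))
  legal-take {X} S k l = legal-suffix (reverse (drop k S)) (subst (Legal X)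
    (trans (cong reverse (sym (take++drop≡id k S))) (reverse-++ (take k S) (drop k S))) l)

  reverse-take-suc : (S : List (Fin n)) (i : Fin (length S)) → reverse (take (suc (toℕ i)) S) ≡ lookup S i ∷ reverse (take (toℕ i) S)
  reverse-take-suc S i = trans (cong reverse (take-suc S i)) (reverse-++ (take (toℕ i) S) (lookup S i ∷ []))

  unique-reverse : {L : List (Fin n)} → Unique L → Unique (reverse L)
  unique-reverse {L} u = Unique-resp-↭ (setoid (Fin n)) (↭⇒↭ₛ (↭-sym (↭-reverse L))) u

  legal⇒dns : ∀ S → Legal Everything (reverse S) → IsDNS G S
  legal⇒dns S l .IsDNS.distinct = subst Unique (reverse-involutive S) (unique-reverse (legal-unique l))
  legal⇒dns S l .IsDNS.footprint i with subst (Legal Everything) (reverse-take-suc S i) (legal-take S (suc (toℕ i)) l)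
  ... | add {u = u} _ _ _ d le _ = u , d , subst (_≤ 1) (dom-reverse u (take (toℕ i) S)) le

  dns⇒legal : ∀ S → IsDNS G S → Legal Everything (reverse S)
  dns⇒legal S ds = subst (λ A → Legal Everything (reverse A)) (take-all (length S) S ≤-refl) (go (length S) ≤-refl)
    where
    go : ∀ k → k ≤ length S → Legal Everything (reverse (take k S))
    go zero le = []
    go (suc k) le = subst (λ k → Legal Everything (reverse (take (suc k) S))) (Fin.toℕ-fromℕ< le)
      (subst (Legal Everything) (sym (reverse-take-suc S i))
        (add _ fresh _ (proj₁ (proj₂ fp)) (subst (_≤ 1) (sym (dom-reverse _ (take (toℕ i) S))) (proj₂ (proj₂ fp)))
          (subst (λ k → Legal Everything (reverse (take k S))) (sym (Fin.toℕ-fromℕ< le)) (go k (<⇒≤ le)))))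
      where
      i = fromℕ< le
      fp = IsDNS.footprint ds i
      fresh : lookup S i ∉ reverse (take (toℕ i) S)
      fresh m with subst Unique (reverse-take-suc S i) (unique-reverse (Uniqueₚ.take⁺ (suc (toℕ i)) (IsDNS.distinct ds)))
      ... | a ∷ _ = All¬⇒¬Any a m

  ∈-vertexSet : ∀ {v} S → v ∈ S → v ∈ₛ vertexSet G S
  ∈-vertexSet (v ∷ S) (here refl) = x∈p∪q⁺ (inj₁ (x∈⁅x⁆ v))
  ∈-vertexSet (v ∷ S) (there m) = x∈p∪q⁺ {p = ⁅ v ⁆} (inj₂ (∈-vertexSet S m))

  length≤∣∣ : ∀ {xs : List (Fin n)} {p : Subset n} → Unique xs → (∀ {x} → x ∈ xs → x ∈ₛ p) → length xs ≤ ∣ p ∣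
  length≤∣∣ {[]} u f = z≤n
  length≤∣∣ {x ∷ xs} {p} (a ∷ u) f = ≤-trans
    (s≤s (length≤∣∣ {p = p - x} u (λ {y} m → x∈p∧x≢y⇒x∈p-y (f (there m)) (λ { refl → All¬⇒¬Any a m }))))
    (x∈p⇒∣p-x∣<∣p∣ (f (here refl)))

  dominates-sym : ∀ {u v} → u ∈ₛ N[ v ] → v ∈ₛ N[ u ]
  dominates-sym d with dominates⇒ d
  ... | inj₁ refl = d
  ... | inj₂ a = dominates-adj (~-sym a)

  -- Double domination comes from maximality: if `w` were dominated at most once, then `extend`
  -- could append `w` or a neighbour of it, which exists as there are no isolated vertices.
  max-legal⇒gdds : NoIsolatedVertices G → ∀ S → Legal Everything (reverse S) → Max Everything (length S) → IsGDDS G S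
  max-legal⇒gdds ni S l mx = (ds , dd) , λ T (dt , _) → subst (_≤ length S) (length-reverse T) (mx _ (dns⇒legal T dt))
    where
    ds = legal⇒dns S l
    twice : ∀ w → 2 ≤ dom w S
    twice w with 2 ≤? dom w S
    ... | yes p = p
    ... | no p with extend l _ (subst (_≤ 1) (sym (dom-reverse w S)) (≤-pred (≰⇒> p))) _ (proj₂ (ni w))
    ... | v , l' = ⊥-elim (<⇒≱ (s≤s (≤-reflexive (sym (length-reverse S)))) (mx _ l'))
    dd : IsDoubleDominating G (vertexSet G S)
    dd w = ≤-trans (twice w) (length≤∣∣ (Uniqueₚ.filter⁺ (λ v → w ∈? N[ v ]) (IsDNS.distinct ds))
      (λ {v} m → let (m' , d) = ∈-filter⁻ (λ v → w ∈? N[ v ]) {xs = S} m in x∈p∩q⁺ (dominates-sym d , ∈-vertexSet S m')))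

  -- Cotrees as parent arrays

  leaf : Fin n → ℕ
  leaf v = suc (toℕ v)

  leaf≤ : ∀ v → leaf v ≤ n
  leaf≤ v = Fin.toℕ<n v

  leaf-injective : ∀ {v w} → leaf v ≡ leaf w → v ≡ w
  leaf-injective e = Fin.toℕ-injective (suc-injective e)

  leaf-of : ∀ {c} → c ≢ 0 → c ≤ n → ∃[ v ] c ≡ leaf v
  leaf-of {zero} ne _ = ⊥-elim (ne refl)
  leaf-of {suc c} _ le = fromℕ< le , cong suc (sym (Fin.toℕ-fromℕ< le))

  no-P₄ : IsCograph G → ∀ {a b c d} → a ~ b → b ~ c → c ~ d → ¬ (a ~ c) → ¬ (a ~ d) → ¬ (b ~ d) → ⊥
  no-P₄ cog {a} {b} {c} {d} ab bc cd ac ad bd = cog (f , inj , iff)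
    where
    f : Fin 4 → Fin n
    f zero = a
    f (suc zero) = b
    f (suc (suc zero)) = c
    f (suc (suc (suc zero))) = d
    inj : ∀ {i j} → f i ≡ f j → i ≡ j
    inj {zero} {zero} e = refl
    inj {zero} {suc zero} e = ⊥-elim (~-irrefl a (subst (a ~_) (sym e) ab))
    inj {zero} {suc (suc zero)} e = ⊥-elim (ad (subst (_~ d) (sym e) cd))
    inj {zero} {suc (suc (suc zero))} e = ⊥-elim (ac (subst (_~ c) (sym e) (~-sym cd)))
    inj {suc zero} {suc zero} e = refl
    inj {suc zero} {zero} e = ⊥-elim (~-irrefl a (subst (a ~_) e ab))
    inj {suc zero} {suc (suc zero)} e = ⊥-elim (bd (subst (_~ d) (sym e) cd))
    inj {suc zero} {suc (suc (suc zero))} e = ⊥-elim (ad (subst (a ~_) e ab))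
    inj {suc (suc zero)} {zero} e = ⊥-elim (ad (subst (_~ d) e cd))
    inj {suc (suc zero)} {suc zero} e = ⊥-elim (bd (subst (_~ d) e cd))
    inj {suc (suc zero)} {suc (suc zero)} e = refl
    inj {suc (suc zero)} {suc (suc (suc zero))} e = ⊥-elim (bd (subst (b ~_) e bc))
    inj {suc (suc (suc zero))} {zero} e = ⊥-elim (ac (subst (_~ c) e (~-sym cd)))
    inj {suc (suc (suc zero))} {suc zero} e = ⊥-elim (ad (subst (a ~_) (sym e) ab))
    inj {suc (suc (suc zero))} {suc (suc zero)} e = ⊥-elim (bd (subst (b ~_) (sym e) bc))
    inj {suc (suc (suc zero))} {suc (suc (suc zero))} e = refl
    iff : ∀ i j → _
    iff zero zero = mk⇔ (λ { (inj₁ ()) ; (inj₂ ()) }) (⊥-elim ∘ ~-irrefl a)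
    iff zero (suc zero) = mk⇔ (λ _ → ab) (λ _ → inj₁ refl)
    iff zero (suc (suc zero)) = mk⇔ (λ { (inj₁ ()) ; (inj₂ ()) }) (⊥-elim ∘ ac)
    iff zero (suc (suc (suc zero))) = mk⇔ (λ { (inj₁ ()) ; (inj₂ ()) }) (⊥-elim ∘ ad)
    iff (suc zero) zero = mk⇔ (λ _ → ~-sym ab) (λ _ → inj₂ refl)
    iff (suc zero) (suc zero) = mk⇔ (λ { (inj₁ ()) ; (inj₂ ()) }) (⊥-elim ∘ ~-irrefl b)
    iff (suc zero) (suc (suc zero)) = mk⇔ (λ _ → bc) (λ _ → inj₁ refl)
    iff (suc zero) (suc (suc (suc zero))) = mk⇔ (λ { (inj₁ ()) ; (inj₂ ()) }) (⊥-elim ∘ bd)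
    iff (suc (suc zero)) zero = mk⇔ (λ { (inj₁ ()) ; (inj₂ ()) }) (⊥-elim ∘ ac ∘ ~-sym)
    iff (suc (suc zero)) (suc zero) = mk⇔ (λ _ → ~-sym bc) (λ _ → inj₂ refl)
    iff (suc (suc zero)) (suc (suc zero)) = mk⇔ (λ { (inj₁ ()) ; (inj₂ ()) }) (⊥-elim ∘ ~-irrefl c)
    iff (suc (suc zero)) (suc (suc (suc zero))) = mk⇔ (λ _ → cd) (λ _ → inj₁ refl)
    iff (suc (suc (suc zero))) zero = mk⇔ (λ { (inj₁ ()) ; (inj₂ ()) }) (⊥-elim ∘ ad ∘ ~-sym)
    iff (suc (suc (suc zero))) (suc zero) = mk⇔ (λ { (inj₁ ()) ; (inj₂ ()) }) (⊥-elim ∘ bd ∘ ~-sym)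
    iff (suc (suc (suc zero))) (suc (suc zero)) = mk⇔ (λ _ → ~-sym cd) (λ _ → inj₂ refl)
    iff (suc (suc (suc zero))) (suc (suc (suc zero))) = mk⇔ (λ { (inj₁ ()) ; (inj₂ ()) }) (⊥-elim ∘ ~-irrefl d)

  infix 4 _⊢_⊑_
  -- Paths towards the root. Node 0 is its own parent, and the side condition keeps a path from
  -- going round there.
  data _⊢_⊑_ (par : ℕ → ℕ) : ℕ → ℕ → Set where
    stay : ∀ {a} → par ⊢ a ⊑ a
    step : ∀ {c a} → c ≢ 0 → par ⊢ par c ⊑ a → par ⊢ c ⊑ a

  module _ {par : ℕ → ℕ} where

    ⊑-trans : ∀ {a b c} → par ⊢ a ⊑ b → par ⊢ b ⊑ c → par ⊢ a ⊑ c
    ⊑-trans stay q = q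
    ⊑-trans (step ne p) q = step ne (⊑-trans p q)

    ⊑-last : ∀ {a c} → par ⊢ a ⊑ c → a ≢ c → ∃[ d ] (par d ≡ c × d ≢ 0 × par ⊢ a ⊑ d)
    ⊑-last stay ne = ⊥-elim (ne refl)
    ⊑-last {c = c} (step {a} nz p) ne with par a ≟ c
    ... | yes e = a , e , nz , stay
    ... | no ne' with ⊑-last p ne'
    ... | d , e , nd , q = d , e , nd , step nz q

    ⊑-total : ∀ {v a b} → par ⊢ v ⊑ a → par ⊢ v ⊑ b → par ⊢ a ⊑ b ⊎ par ⊢ b ⊑ a
    ⊑-total stay q = inj₁ q
    ⊑-total p@(step _ _) stay = inj₂ p
    ⊑-total (step _ p) (step _ q) = ⊑-total p q

    ⊑-zero : ∀ {a} → par ⊢ 0 ⊑ a → a ≡ 0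
    ⊑-zero stay = refl
    ⊑-zero (step ne _) = ⊥-elim (ne refl)

    ⊑-step⁻ : ∀ {c a} → par ⊢ c ⊑ a → c ≢ a → par ⊢ par c ⊑ a
    ⊑-step⁻ stay ne = ⊥-elim (ne refl)
    ⊑-step⁻ (step _ p) _ = p

  Agrees : ℕ → (Fin n → Set) → Fin n → Set
  Agrees t N v = (t ≡ 1 → N v) × (N v → t ≡ 1)

  -- The nodes, ordered by par, form a cotree of the graph with edge relation E,
  -- where joins are the nodes of type 1; the rank is increasing towards the root 0.
  record Core (par typ : ℕ → ℕ) (E : Fin n → Fin n → Set) : Set where
    field
      rank   : ℕ → ℕ
      rank<  : ∀ {c} → c ≢ 0 → rank c < rank (par c)
      par0   : par 0 ≡ 0
      childless : ∀ v c → par c ≢ leaf v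
      adj    : ∀ {d d'} → d ≢ 0 → d' ≢ 0 → d ≢ d' → par d ≡ par d' →
               ∀ {v v'} → par ⊢ leaf v ⊑ d → par ⊢ leaf v' ⊑ d' → Agrees (typ (par d)) (E v) v'

    rank-≤ : ∀ {a b} → par ⊢ a ⊑ b → rank a ≤ rank b
    rank-≤ stay = ≤-refl
    rank-≤ (step nz p) = ≤-trans (<⇒≤ (rank< nz)) (rank-≤ p)

    parent-above : ∀ {d d'} → d ≢ 0 → par d ≡ par d' → ¬ (par ⊢ par d' ⊑ d)
    parent-above nz e p = <⇒≱ (rank< nz) (≤-trans (≤-reflexive (cong rank e)) (rank-≤ p))

    sibling-⊑ : ∀ {d d'} → d' ≢ 0 → par d ≡ par d' → par ⊢ d ⊑ d' → d ≡ d'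
    sibling-⊑ nz e stay = refl
    sibling-⊑ {d} {d'} nz e (step nd p) = ⊥-elim (parent-above nz refl (subst (λ t → par ⊢ t ⊑ d') e p))

    sibling-unique : ∀ {v d d'} → d ≢ 0 → d' ≢ 0 → par d ≡ par d' → par ⊢ v ⊑ d → par ⊢ v ⊑ d' → d ≡ d'
    sibling-unique nd nd' e p q with ⊑-total p q
    ... | inj₁ r = sibling-⊑ nd' e r
    ... | inj₂ r = sym (sibling-⊑ nd (sym e) r)

    leaf-below : ∀ {v c} → par ⊢ leaf v ⊑ c → c ≡ leaf v ⊎ (∃[ d ] (par d ≡ c × d ≢ 0 × par ⊢ leaf v ⊑ d))
    leaf-below {v} {c} p with leaf v ≟ c
    ... | yes e = inj₁ (sym e)
    ... | no ne = inj₂ (⊑-last p ne)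

    leaf-below-parent : ∀ {v c e} → par e ≡ c → par ⊢ leaf v ⊑ c → ∃[ d ] (par d ≡ c × d ≢ 0 × par ⊢ leaf v ⊑ d)
    leaf-below-parent {v} pe p with leaf-below p
    ... | inj₂ r = r
    ... | inj₁ refl = ⊥-elim (childless v _ pe)

  -- A leaf hanging off the path from u to the root is in N just when it does so at a join.
  AgreesAbove : (par typ : ℕ → ℕ) → (Fin n → Set) → ℕ → Set
  AgreesAbove par typ N u = ∀ {c c'} → c ≢ 0 → c' ≢ 0 → c ≢ c' → par c ≡ par c' → par ⊢ u ⊑ c' →
    ∀ {v} → par ⊢ leaf v ⊑ c → Agrees (typ (par c)) N v

  -- Elementary moves in a cotree

  record Step (par par' : ℕ → ℕ) (A : ℕ → Set) (tg : ℕ) : Set where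
    field
      cases : ∀ c → (A c × par' c ≡ tg) ⊎ (¬ A c × par' c ≡ par c)

    moved : ∀ {c} → A c → par' c ≡ tg
    moved {c} a with cases c
    ... | inj₁ (_ , e) = e
    ... | inj₂ (na , _) = ⊥-elim (na a)

    kept : ∀ {c} → ¬ A c → par' c ≡ par c
    kept {c} na with cases c
    ... | inj₁ (a , _) = ⊥-elim (na a)
    ... | inj₂ (_ , e) = e

  -- A sibling of the same type as the parent, or a fresh one taking a single child, may absorb children
  -- of the parent: the type at the lowest common ancestor of two leaves does not change.
  module Down {par par' typ : ℕ → ℕ} {E : Fin n → Fin n → Set} {A : ℕ → Set} {q tg : ℕ}
    (C : Core par typ E) (S : Step par par' A tg)
    (A-child : ∀ {c} → A c → par c ≡ q × c ≢ 0)
    (tg≢0 : tg ≢ 0) (par-tg : par tg ≡ q) (tg∉A : ¬ A tg) (tg-inner : ∀ v → tg ≢ leaf v) where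
    open Core C
    open Step S

    par'-tg : par' tg ≡ q
    par'-tg = trans (kept tg∉A) par-tg

    q≢tg : q ≢ tg
    q≢tg e = <⇒≢ (rank< tg≢0) (cong rank (trans (sym e) (sym par-tg)))

    -- The only node that gains descendants is `tg`, and it gains what lies below moved nodes. For
    -- every other ancestor the new path is the old one with a detour through `tg`.
    ⊑-old : ∀ {c a} → par' ⊢ c ⊑ a → par ⊢ c ⊑ a ⊎ (a ≡ tg × ∃[ g ] (A g × par ⊢ c ⊑ g))
    ⊑-old stay = inj₁ stay
    ⊑-old {c} (step nz p) with cases c
    ⊑-old {c} (step nz p) | inj₂ (_ , e) rewrite e with ⊑-old p
    ... | inj₁ r = inj₁ (step nz r)
    ... | inj₂ (refl , g , ag , r) = inj₂ (refl , g , ag , step nz r)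
    ⊑-old {c} {a} (step nz p) | inj₁ (ac , e) rewrite e with ⊑-old p
    ... | inj₂ (refl , g , ag , r) = inj₂ (refl , c , ac , stay)
    ... | inj₁ r with tg ≟ a
    ... | yes refl = inj₂ (refl , c , ac , stay)
    ... | no ne = inj₁ (step nz (subst (λ t → par ⊢ t ⊑ a) (trans par-tg (sym (proj₁ (A-child ac)))) (⊑-step⁻ r ne)))

    ⊑-old-≢ : ∀ {c a} → a ≢ tg → par' ⊢ c ⊑ a → par ⊢ c ⊑ a
    ⊑-old-≢ ne p with ⊑-old p
    ... | inj₁ r = r
    ... | inj₂ (e , _) = ⊥-elim (ne e)

    ⊑-new : ∀ {c a} → par ⊢ c ⊑ a → par' ⊢ c ⊑ a
    ⊑-new stay = stay
    ⊑-new {c} {a} (step nz p) with cases c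
    ... | inj₂ (_ , e) = step nz (subst (λ t → par' ⊢ t ⊑ a) (sym e) (⊑-new p))
    ... | inj₁ (ac , e) = step nz (subst (λ t → par' ⊢ t ⊑ a) (sym e) (step tg≢0
          (subst (λ t → par' ⊢ t ⊑ a) (trans (proj₁ (A-child ac)) (sym par'-tg)) (⊑-new p))))

    -- Leaves that now meet at `tg` met at `q` or at `tg` before, which is harmless if both have the
    -- same type; in the other case `tg` has a single child and nothing meets there.
    Compatible : Set
    Compatible = typ tg ≡ typ q ⊎ ((∀ c → par c ≢ tg) × (∀ {c c'} → A c → A c' → c ≡ c'))

    -- Doubling the ranks makes room for `tg` immediately below `q` and above twice the rank of any
    -- child that may be moved to it.
    rank' : ℕ → ℕ
    rank' a with a ≟ tg
    ... | yes _ = rank q + rank q ∸ 1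
    ... | no _ = rank a + rank a

    double< : ∀ {a b} → a < b → a + a < b + b ∸ 1
    double< {a} {suc b} (s≤s le) = ≤-trans (s≤s (+-mono-≤ le le)) (≤-reflexive (sym (+-suc b b)))

    rank<' : ∀ {c} → c ≢ 0 → rank' c < rank' (par' c)
    rank<' {c} nz with cases c
    rank<' {c} nz | inj₁ (ac , e) rewrite e with c ≟ tg | tg ≟ tg
    ... | yes refl | _ = ⊥-elim (tg∉A ac)
    ... | no _ | no x = ⊥-elim (x refl)
    ... | no _ | yes _ = double< (≤-trans (rank< nz) (≤-reflexive (cong rank (proj₁ (A-child ac)))))
    rank<' {c} nz | inj₂ (na , e) rewrite e with c ≟ tg | par c ≟ tg
    ... | yes refl | yes e' = ⊥-elim (q≢tg (trans (sym par-tg) e'))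
    ... | yes refl | no _ rewrite par-tg = ≤-reflexive (m+[n∸m]≡n {1} {rank q + rank q}
            (≤-trans (≤-trans (s≤s z≤n) (≤-trans (rank< tg≢0) (≤-reflexive (cong rank par-tg)))) (m≤m+n _ _)))
    ... | no _ | yes e' = double< (<-trans (≤-trans (rank< nz) (≤-reflexive (cong rank e'))) (≤-trans (rank< tg≢0) (≤-reflexive (cong rank par-tg))))
    ... | no _ | no _ = +-mono-<-≤ (rank< nz) (<⇒≤ (rank< nz))

    child-of-tg : Compatible → ∀ {d v v'} g → A g → d ≢ 0 → ¬ A d → par d ≡ tg → par ⊢ leaf v ⊑ g → par ⊢ leaf v' ⊑ d →
      Agrees (typ tg) (E v) v' × Agrees (typ tg) (E v') v
    child-of-tg same {v = v} {v'} g ag nd nad pd p p' with same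
    ... | inj₂ (none , _) = ⊥-elim (none _ pd)
    ... | inj₁ ty = subst (λ t → Agrees t (E v) v') (trans (cong typ (proj₁ (A-child ag))) (sym ty)) (adj (proj₂ (A-child ag)) tg≢0 ne pe p down)
                  , subst (λ t → Agrees t (E v') v) (trans (cong typ par-tg) (sym ty)) (adj tg≢0 (proj₂ (A-child ag)) (ne ∘ sym) (sym pe) down p)
      where
      ne = λ { refl → tg∉A ag }
      pe = trans (proj₁ (A-child ag)) (sym par-tg)
      down = ⊑-trans p' (step nd (subst (λ t → par ⊢ t ⊑ tg) (sym pd) stay))

    adj' : Compatible → ∀ {d d'} → d ≢ 0 → d' ≢ 0 → d ≢ d' → par' d ≡ par' d' →
             ∀ {v v'} → par' ⊢ leaf v ⊑ d → par' ⊢ leaf v' ⊑ d' → Agrees (typ (par' d)) (E v) v'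
    adj' same {d} {d'} nd nd' ne e {v} {v'} p p' with cases d | cases d'
    ... | inj₁ (ad , ed) | inj₁ (ad' , ed') with same
    ...   | inj₂ (_ , uniq) = ⊥-elim (ne (uniq ad ad'))
    ...   | inj₁ ty = subst (λ t → Agrees t (E v) v') (trans (cong typ (proj₁ (A-child ad))) (trans (sym ty) (cong typ (sym ed))))
              (adj nd nd' ne (trans (proj₁ (A-child ad)) (sym (proj₁ (A-child ad')))) (⊑-old-≢ (λ { refl → tg∉A ad }) p) (⊑-old-≢ (λ { refl → tg∉A ad' }) p'))
    adj' same {d} {d'} nd nd' ne e {v} {v'} p p' | inj₁ (ad , ed) | inj₂ (nad' , ed') =
      subst (λ t → Agrees t (E v) v') (cong typ (sym ed))
        (proj₁ (child-of-tg same d ad nd' nad' pd' (⊑-old-≢ (λ { refl → tg∉A ad }) p) (⊑-old-≢ (λ { refl → q≢tg (trans (sym par-tg) pd') }) p')))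
      where pd' = trans (sym ed') (trans (sym e) ed)
    adj' same {d} {d'} nd nd' ne e {v} {v'} p p' | inj₂ (nad , ed) | inj₁ (ad' , ed') =
      subst (λ t → Agrees t (E v) v') (cong typ (sym (trans e ed')))
        (proj₂ (child-of-tg same d' ad' nd nad pd (⊑-old-≢ (λ { refl → tg∉A ad' }) p') (⊑-old-≢ (λ { refl → q≢tg (trans (sym par-tg) pd) }) p)))
      where pd = trans (sym ed) (trans e ed')
    adj' same {d} {d'} nd nd' ne e {v} {v'} p p' | inj₂ (nad , ed) | inj₂ (nad' , ed') with ⊑-old p | ⊑-old p'
    ... | inj₁ r | inj₁ r' = subst (λ t → Agrees t (E v) v') (cong typ (sym ed)) (adj nd nd' ne (trans (sym ed) (trans e ed')) r r')
    ... | inj₁ r | inj₂ (refl , g , ag , r') = subst (λ t → Agrees t (E v) v') (cong typ (sym ed))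
            (adj nd (proj₂ (A-child ag)) (λ { refl → nad ag }) (trans (sym ed) (trans e (trans ed' (trans par-tg (sym (proj₁ (A-child ag))))))) r r')
    ... | inj₂ (refl , g , ag , r) | inj₁ r' = subst (λ t → Agrees t (E v) v') (cong typ (trans (proj₁ (A-child ag)) (sym par'-tg)))
            (adj (proj₂ (A-child ag)) nd' (λ { refl → nad' ag }) (trans (proj₁ (A-child ag)) (trans (sym par'-tg) (trans e ed'))) r r')
    ... | inj₂ (refl , _) | inj₂ (e' , _) = ⊥-elim (ne (sym e'))

    core : Compatible → Core par' typ E
    core same .Core.rank = rank'
    core same .Core.rank< = rank<'
    core same .Core.par0 = trans (kept (λ a → proj₂ (A-child a) refl)) par0
    core same .Core.childless v c e with cases c
    ... | inj₁ (_ , e') = tg-inner v (trans (sym e') e)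
    ... | inj₂ (_ , e') = childless v c (trans (sym e') e)
    core same .Core.adj = adj' same

    above-parent : ∀ {N} → AgreesAbove par typ N q → AgreesAbove par' typ N q
    above-parent {N} ag {c} {c'} nc nc' ne e p {v} pv with cases c | cases c'
    ... | inj₂ (nac , ec) | inj₂ (nac' , ec') = subst (λ t → Agrees (typ t) N v) (sym ec)
          (ag nc nc' ne (trans (sym ec) (trans e ec')) q⊑c' (⊑-old-≢ c≢tg pv))
      where
      q⊑c' : par ⊢ q ⊑ c'
      q⊑c' with ⊑-old p
      ... | inj₁ r = r
      ... | inj₂ (refl , g , agg , r) = ⊥-elim (parent-above (proj₂ (A-child agg)) refl (subst (λ t → par ⊢ t ⊑ g) (sym (proj₁ (A-child agg))) r))
      c≢tg : c ≢ tg
      c≢tg refl = parent-above nc' (trans (sym ec') (trans (sym e) ec)) (subst (λ t → par ⊢ t ⊑ c') (sym par-tg) q⊑c')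
    ... | inj₁ (ac , ec) | inj₁ (ac' , ec') = ⊥-elim (parent-above nc' refl (subst (λ t → par ⊢ t ⊑ c') (sym (proj₁ (A-child ac'))) (⊑-old-≢ (λ { refl → tg∉A ac' }) p)))
    ... | inj₂ (nac , ec) | inj₁ (ac' , ec') = ⊥-elim (parent-above nc' refl (subst (λ t → par ⊢ t ⊑ c') (sym (proj₁ (A-child ac'))) (⊑-old-≢ (λ { refl → tg∉A ac' }) p)))
    ... | inj₁ (ac , ec) | inj₂ (nac' , ec') = ⊥-elim (<⇒≱ (<-trans (rank< nc') (≤-trans (s≤s (≤-reflexive (cong rank pc'))) (≤-trans (rank< tg≢0) (≤-reflexive (cong rank par-tg))))) (rank-≤ q⊑c'))
      where
      pc' : par c' ≡ tg
      pc' = trans (sym ec') (trans (sym e) ec)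
      q⊑c' : par ⊢ q ⊑ c'
      q⊑c' = ⊑-old-≢ (λ { refl → q≢tg (trans (sym par-tg) pc') }) p

    above-tg : ∀ {N} → AgreesAbove par typ N q →
      (∀ {c} → c ≢ 0 → par c ≡ q → ¬ A c → c ≢ tg → ∀ {v} → par ⊢ leaf v ⊑ c → Agrees (typ q) N v) →
      AgreesAbove par' typ N tg
    above-tg {N} ag sib {c} {c'} nc nc' ne e p {v} pv with tg ≟ c'
    ... | no tg≢c' = above-parent {N} ag nc nc' ne e (subst (λ t → par' ⊢ t ⊑ c') par'-tg (⊑-step⁻ p tg≢c')) pv
    ... | yes refl with cases c
    ... | inj₁ (ac , ec) = ⊥-elim (q≢tg (trans (sym par'-tg) (trans (sym e) ec)))
    ... | inj₂ (nac , ec) = subst (λ t → Agrees (typ t) N v) (sym (trans e par'-tg))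
            (sib nc (trans (sym ec) (trans e par'-tg)) nac ne (⊑-old-≢ ne pv))

    above-only-child : ∀ {N u} → (∀ c → par c ≢ tg) → (∀ {c} → A c → c ≡ u) → A u →
      AgreesAbove par' typ N tg → AgreesAbove par' typ N u
    above-only-child {u = u} none only au ag {c} {c'} nc nc' ne e p pv with u ≟ c'
    ... | no u≢c' = ag nc nc' ne e (subst (λ t → par' ⊢ t ⊑ c') (moved au) (⊑-step⁻ p u≢c')) pv
    ... | yes refl with cases c
    ... | inj₁ (ac , _) = ⊥-elim (ne (only ac))
    ... | inj₂ (_ , ec) = ⊥-elim (none c (trans (sym ec) (trans e (moved au))))

  -- The opposite direction: children of `p` become siblings of `p`. Both parents have the same
  -- type, so no adjacency changes, and since ancestors are only lost, the old ranks remain valid.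
  module Up {par par' typ : ℕ → ℕ} {E : Fin n → Fin n → Set} {A : ℕ → Set} {p q : ℕ}
    (C : Core par typ E) (S : Step par par' A q)
    (A-child : ∀ {c} → A c → par c ≡ p × c ≢ 0)
    (p≢0 : p ≢ 0) (par-p : par p ≡ q) (same : typ p ≡ typ q)
    (q-inner : ∀ v → q ≢ leaf v) where
    open Core C
    open Step S

    p∉A : ¬ A p
    p∉A a = <⇒≢ (rank< p≢0) (cong rank (sym (proj₁ (A-child a))))

    par'-p : par' p ≡ q
    par'-p = trans (kept p∉A) par-p

    ⊑-old : ∀ {c a} → par' ⊢ c ⊑ a → par ⊢ c ⊑ a
    ⊑-old stay = stay
    ⊑-old {c} {a} (step nz r) with cases c
    ... | inj₁ (ac , e) rewrite e = step nz (subst (λ t → par ⊢ t ⊑ a) (sym (proj₁ (A-child ac)))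
            (step p≢0 (subst (λ t → par ⊢ t ⊑ a) (sym par-p) (⊑-old r))))
    ... | inj₂ (_ , e) rewrite e = step nz (⊑-old r)

    core : Core par' typ E
    core .Core.rank = rank
    core .Core.rank< {c} nz with cases c
    ... | inj₂ (_ , e) rewrite e = rank< nz
    ... | inj₁ (ac , e) rewrite e = <-trans (≤-trans (rank< nz) (≤-reflexive (cong rank (proj₁ (A-child ac)))))
            (≤-trans (rank< p≢0) (≤-reflexive (cong rank par-p)))
    core .Core.par0 = trans (kept (λ a → proj₂ (A-child a) refl)) par0
    core .Core.childless v c e with cases c
    ... | inj₁ (_ , e') = q-inner v (trans (sym e') e)
    ... | inj₂ (_ , e') = childless v c (trans (sym e') e)
    core .Core.adj {d} {d'} nd nd' ne e {v} {v'} r r' with cases d | cases d'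
    ... | inj₂ (_ , ed) | inj₂ (_ , ed') = subst (λ t → Agrees t (E v) v') (cong typ (sym ed))
            (adj nd nd' ne (trans (sym ed) (trans e ed')) (⊑-old r) (⊑-old r'))
    ... | inj₁ (ad , ed) | inj₁ (ad' , ed') = subst (λ t → Agrees t (E v) v') (trans (cong typ (proj₁ (A-child ad))) (trans same (cong typ (sym ed))))
            (adj nd nd' ne (trans (proj₁ (A-child ad)) (sym (proj₁ (A-child ad')))) (⊑-old r) (⊑-old r'))
    ... | inj₁ (ad , ed) | inj₂ (nad' , ed') with d' ≟ p
    ...   | no d'≢p = subst (λ t → Agrees t (E v) v') (cong typ (trans par-p (sym ed)))
              (adj p≢0 nd' (d'≢p ∘ sym) (trans par-p (trans (sym ed) (trans e ed')))
                (⊑-trans (⊑-old r) (step nd (subst (λ t → par ⊢ t ⊑ p) (sym (proj₁ (A-child ad))) stay))) (⊑-old r'))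
    -- For `d' = p` the two leaves used to meet at `p`. The old argument applies to `d` and the
    -- child `w` of `p` above `v'`, which is one that stayed.
    ...   | yes refl with ⊑-last r' (λ e → childless v' d (trans (proj₁ (A-child ad)) (sym e)))
    ...     | w , pw , nw , rw with cases w
    ...       | inj₁ (aw , ew) = ⊥-elim (<⇒≢ (rank< p≢0) (cong rank (trans (sym pw) (trans ew (sym par-p)))))
    ...       | inj₂ (naw , ew) = subst (λ t → Agrees t (E v) v') (trans (cong typ (proj₁ (A-child ad))) (trans same (cong typ (sym ed))))
                  (adj nd nw (λ { refl → naw ad }) (trans (proj₁ (A-child ad)) (trans (sym pw) ew)) (⊑-old r) (⊑-old rw))
    core .Core.adj {d} {d'} nd nd' ne e {v} {v'} r r' | inj₂ (nad , ed) | inj₁ (ad' , ed') with d ≟ p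
    ...   | no d≢p = subst (λ t → Agrees t (E v) v') (cong typ (sym ed))
              (adj nd p≢0 d≢p (trans (sym ed) (trans e (trans ed' (sym par-p)))) (⊑-old r)
                (⊑-trans (⊑-old r') (step nd' (subst (λ t → par ⊢ t ⊑ p) (sym (proj₁ (A-child ad'))) stay))))
    ...   | yes refl with ⊑-last r (λ e → childless v d' (trans (proj₁ (A-child ad')) (sym e)))
    ...     | w , pw , nw , rw with cases w
    ...       | inj₁ (aw , ew) = ⊥-elim (<⇒≢ (rank< p≢0) (cong rank (trans (sym pw) (trans ew (sym par-p)))))
    ...       | inj₂ (naw , ew) = subst (λ t → Agrees t (E v) v') (trans (cong typ (trans (sym ew) pw)) (trans same (cong typ (sym par'-p))))
                  (adj nw nd' (λ { refl → naw ad' }) (trans (sym ew) (trans pw (sym (proj₁ (A-child ad'))))) (⊑-old rw) (⊑-old r'))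

    above : ∀ {N} → AgreesAbove par typ N p → (∀ {c} → A c → ∀ {v} → par ⊢ leaf v ⊑ c → Agrees (typ q) N v) →
      AgreesAbove par' typ N p
    above {N} ag full {c} {c'} nc nc' ne e r {v} rv with cases c
    ... | inj₁ (ac , ec) = subst (λ t → Agrees (typ t) N v) (sym ec) (full ac (⊑-old rv))
    ... | inj₂ (nac , ec) with cases c'
    ... | inj₁ (ac' , ec') = ⊥-elim (parent-above nc' refl (subst (λ t → par ⊢ t ⊑ c') (sym (proj₁ (A-child ac'))) (⊑-old r)))
    ... | inj₂ (nac' , ec') = subst (λ t → Agrees (typ t) N v) (sym ec) (ag nc nc' ne (trans (sym ec) (trans e ec')) (⊑-old r) (⊑-old rv))

  -- A node without children moves below `q`: either a new inner node, below which there is no leaf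
  -- yet, or the leaf `x`. Being childless it may get rank 0; the child that `q` has already shows
  -- that the rank of `q` is positive.
  module Hang {par par' typ : ℕ → ℕ} {E : Fin n → Fin n → Set} {w q : ℕ}
    (C : Core par typ E) (S : Step par par' (_≡ w) q)
    (w≢0 : w ≢ 0) (bare : ∀ c → par c ≢ w) (q≢w : q ≢ w)
    (sib : ∃[ z ] (z ≢ 0 × par z ≡ q)) where
    open Core C
    open Step S

    bare' : ∀ c → par' c ≢ w
    bare' c e with cases c
    ... | inj₁ (_ , e') = q≢w (trans (sym e') e)
    ... | inj₂ (_ , e') = bare c (trans (sym e') e)

    above-w' : ∀ {c} → par' ⊢ c ⊑ w → c ≡ w
    above-w' {c} r with c ≟ w
    ... | yes e = e
    ... | no ne = ⊥-elim (bare' _ (proj₁ (proj₂ (⊑-last r ne))))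

    ⊑-old : ∀ {c a} → c ≢ w → par' ⊢ c ⊑ a → par ⊢ c ⊑ a
    ⊑-old ne stay = stay
    ⊑-old {c} {a} ne (step nz r) rewrite kept ne = step nz (⊑-old (bare c) r)

    ⊑-new : ∀ {c a} → c ≢ w → par ⊢ c ⊑ a → par' ⊢ c ⊑ a
    ⊑-new ne stay = stay
    ⊑-new {c} {a} ne (step nz r) = step nz (subst (λ t → par' ⊢ t ⊑ a) (sym (kept ne)) (⊑-new (bare c) r))

    rank' : ℕ → ℕ
    rank' a with a ≟ w
    ... | yes _ = 0
    ... | no _ = rank a

    rank<' : ∀ {c} → c ≢ 0 → rank' c < rank' (par' c)
    rank<' {c} nz with c ≟ w
    rank<' {c} nz | yes refl with par' c ≟ c
    ... | yes e = ⊥-elim (bare' c e)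
    ... | no _ rewrite moved {c} refl = ≤-trans (s≤s z≤n) (≤-trans (rank< (proj₁ (proj₂ sib))) (≤-reflexive (cong rank (proj₂ (proj₂ sib)))))
    rank<' {c} nz | no ne with par' c ≟ w
    ... | yes e = ⊥-elim (bare' c e)
    ... | no _ rewrite kept ne = rank< nz

    par0' : par' 0 ≡ 0
    par0' = trans (kept (w≢0 ∘ sym)) par0

    childless' : (∀ v → q ≢ leaf v) → ∀ v c → par' c ≢ leaf v
    childless' qi v c e with cases c
    ... | inj₁ (_ , e') = qi v (trans (sym e') e)
    ... | inj₂ (_ , e') = childless v c (trans (sym e') e)

    module Inner (inner : ∀ v → w ≢ leaf v) (q-inner : ∀ v → q ≢ leaf v) where

      core : Core par' typ E
      core .Core.rank = rank'
      core .Core.rank< = rank<'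
      core .Core.par0 = par0'
      core .Core.childless = childless' q-inner
      core .Core.adj {d} {d'} nd nd' ne e {v} {v'} r r' with cases d | cases d'
      ... | inj₁ (refl , _) | _ = ⊥-elim (inner v (sym (above-w' r)))
      ... | inj₂ _ | inj₁ (refl , _) = ⊥-elim (inner v' (sym (above-w' r')))
      ... | inj₂ (_ , ed) | inj₂ (_ , ed') = subst (λ t → Agrees t (E v) v') (cong typ (sym ed))
              (adj nd nd' ne (trans (sym ed) (trans e ed')) (⊑-old (inner v ∘ sym) r) (⊑-old (inner v' ∘ sym) r'))

      above : ∀ {N z} → z ≢ w → AgreesAbove par typ N z → AgreesAbove par' typ N z
      above {N} {z} z≢w ag {c} {c'} nc nc' ne e r {v} rv with cases c | cases c'
      ... | inj₁ (refl , _) | _ = ⊥-elim (inner v (sym (above-w' rv)))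
      ... | inj₂ _ | inj₁ (refl , _) = ⊥-elim (z≢w (above-w' r))
      ... | inj₂ (_ , ec) | inj₂ (_ , ec') = subst (λ t → Agrees (typ t) N v) (sym ec)
              (ag nc nc' ne (trans (sym ec) (trans e ec')) (⊑-old z≢w r) (⊑-old (inner v ∘ sym) rv))

    module Leaf (x : Fin n) (w≡x : w ≡ leaf x) (q-inner : ∀ v → q ≢ leaf v) {E' : Fin n → Fin n → Set}
      (old : ∀ {v v'} → v ≢ x → v' ≢ x → (E v v' → E' v v') × (E' v v' → E v v'))
      {N : Fin n → Set} (new : ∀ {v} → v ≢ x → (N v → E' x v × E' v x) × (E' x v → N v) × (E' v x → N v))
      (ag : AgreesAbove par typ N q)
      (kids : ∀ {c} → c ≢ 0 → par c ≡ q → ∀ {v} → par ⊢ leaf v ⊑ c → Agrees (typ q) N v) where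

      -- Every branch `c` off the path from `w` to the root starts at `q`, where `kids` decides, or
      -- further up, where `ag` does. The leaf `w` itself lies on the path and not on the branch.
      near : ∀ {c c'} → c ≢ 0 → c' ≢ 0 → c ≢ c' → par' c ≡ par' c' → par' ⊢ w ⊑ c' →
        ∀ {v} → par' ⊢ leaf v ⊑ c → leaf v ≢ w × Agrees (typ (par' c)) N v
      near {c} {c'} nc nc' ne e r {v} rv with w ≟ c'
      ... | yes refl with cases c
      ...   | inj₁ (ec , _) = ⊥-elim (ne ec)
      ...   | inj₂ (cw , ec) = lw , subst (λ t → Agrees (typ t) N v) (sym (trans e (moved refl)))
                (kids nc (trans (sym ec) (trans e (moved refl))) (⊑-old lw rv))
        where
        lw : leaf v ≢ w
        lw refl = cw (sibling' rv)
          where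
          sibling' : par' ⊢ w ⊑ c → c ≡ w
          sibling' stay = refl
          sibling' (step nz s) = ⊥-elim (<⇒≱ (rank<' nc) (rank'-≤ (subst (λ t → par' ⊢ t ⊑ c) (sym e) s)))
            where
            rank'-≤ : ∀ {a b} → par' ⊢ a ⊑ b → rank' a ≤ rank' b
            rank'-≤ stay = ≤-refl
            rank'-≤ (step nz p) = ≤-trans (<⇒≤ (rank<' nz)) (rank'-≤ p)
      near {c} {c'} nc nc' ne e r {v} rv | no w≢c' with cases c | cases c'
      ...   | _ | inj₁ (ec' , _) = ⊥-elim (w≢c' (sym ec'))
      ...   | inj₁ (refl , ec) | inj₂ (_ , ec') = ⊥-elim (parent-above nc' refl (subst (λ t → par ⊢ t ⊑ c') (trans (sym (moved refl)) (trans e ec')) (⊑-old q≢w (subst (λ t → par' ⊢ t ⊑ c') (moved refl) (⊑-step⁻ r w≢c')))))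
      ...   | inj₂ (cw , ec) | inj₂ (_ , ec') = lw , subst (λ t → Agrees (typ t) N v) (sym ec)
                (ag nc nc' ne pe q⊑c' (⊑-old lw rv))
        where
        pe = trans (sym ec) (trans e ec')
        q⊑c' : par ⊢ q ⊑ c'
        q⊑c' = ⊑-old q≢w (subst (λ t → par' ⊢ t ⊑ c') (moved refl) (⊑-step⁻ r w≢c'))
        lw : leaf v ≢ w
        lw refl = ne (sibling-unique nc nc' pe (⊑-old q≢w (subst (λ t → par' ⊢ t ⊑ c) (moved refl) (⊑-step⁻ rv (cw ∘ sym)))) q⊑c')

      core : Core par' typ E'
      core .Core.rank = rank'
      core .Core.rank< = rank<'
      core .Core.par0 = par0'
      core .Core.childless = childless' q-inner
      core .Core.adj {d} {d'} nd nd' ne e {v} {v'} r r' with leaf v ≟ w | leaf v' ≟ w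
      ... | yes ev | _ with near nd' nd (ne ∘ sym) (sym e) (subst (λ t → par' ⊢ t ⊑ d) ev r) r'
      ...   | lw , (f , g) = (λ t → subst (λ v → E' v v') (sym (leaf-injective (trans ev w≡x))) (proj₁ (proj₁ (new v'≢x) (f (trans (cong typ (sym e)) t))))) , (λ h → trans (cong typ e) (g (proj₁ (proj₂ (new v'≢x)) (subst (λ t → E' t v') (leaf-injective (trans ev w≡x)) h))))
        where
        v'≢x : v' ≢ x
        v'≢x refl = lw (sym w≡x)
      core .Core.adj {d} {d'} nd nd' ne e {v} {v'} r r' | no lv | yes ev' with near nd nd' ne e (subst (λ t → par' ⊢ t ⊑ d') ev' r') r
      ...   | lw , (f , g) = (λ t → subst (E' v) (sym (leaf-injective (trans ev' w≡x))) (proj₂ (proj₁ (new v≢x) (f t)))) , (λ h → g (proj₂ (proj₂ (new v≢x)) (subst (E' v) (leaf-injective (trans ev' w≡x)) h)))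
        where
        v≢x : v ≢ x
        v≢x refl = lw (sym w≡x)
      core .Core.adj {d} {d'} nd nd' ne e {v} {v'} r r' | no lv | no lv' with cases d | cases d'
      ... | inj₁ (refl , _) | _ = ⊥-elim (lv (above-w' r))
      ... | inj₂ _ | inj₁ (refl , _) = ⊥-elim (lv' (above-w' r'))
      ... | inj₂ (_ , ed) | inj₂ (_ , ed') with adj nd nd' ne (trans (sym ed) (trans e ed')) (⊑-old lv r) (⊑-old lv' r')
      ...   | f , g = (λ t → proj₁ o (f (trans (cong typ (sym ed)) t))) , (λ h → trans (cong typ ed) (g (proj₂ o h)))
        where
        o = old (λ { refl → lv (sym w≡x) }) (λ { refl → lv' (sym w≡x) })

  -- Inserting a vertex into a cotree

  Edge : ℕ → Fin n → Fin n → Set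
  Edge k v v' = v ~ v' × toℕ v < k × toℕ v' < k

  -- The cotree of the first k vertices. Later vertices and unused node numbers are
  -- children of the root; types alternate along edges, except possibly above z.
  record Cotree (k z nx : ℕ) (par typ : ℕ → ℕ) : Set where
    field
      core    : Core par typ (Edge k)
      low     : ∀ c → par c ≡ 0 ⊎ (n < par c × par c < nx)
      fresh   : ∀ c → nx ≤ c → par c ≡ 0
      n<nx    : n < nx
      binary  : ∀ a → typ a ≤ 1
      typ0    : typ 0 ≡ 0
      alt     : ∀ a → n < a → a < nx → a ≢ z → typ a ≢ typ (par a)
      two     : ∀ a → n < a → a < nx → ∃[ d ] ∃[ d' ] (d ≢ d' × par d ≡ a × par d' ≡ a)
      outside : ∀ v → k ≤ toℕ v → par (leaf v) ≡ 0
    open Core core public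

    parent-inner : ∀ {c a} → par c ≡ a → a ≢ 0 → n < a × a < nx
    parent-inner {c} refl ne with low c
    ... | inj₁ e = ⊥-elim (ne e)
    ... | inj₂ p = p

    child-node : ∀ {c a} → par c ≡ a → a ≢ 0 → c ≢ 0 × c < nx
    child-node {c} refl ne = (λ { refl → ne par0 }) , ≰⇒> (λ le → ne (fresh c le))

    inner≢0 : ∀ {a} → n < a → a ≢ 0
    inner≢0 () refl

    inner≢leaf : ∀ {a} → n < a → ∀ v → a ≢ leaf v
    inner≢leaf lt v refl = <⇒≱ lt (leaf≤ v)

    other-child : ∀ {a} → n < a → a < nx → ∀ d → ∃[ d' ] (par d' ≡ a × d' ≢ d)
    other-child {a} na an d with two a na an
    ... | e , e' , e≢e' , p , p' with e ≟ d
    ... | no ne = e , p , ne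
    ... | yes refl = e' , p' , e≢e' ∘ sym

    leaf-under : ∀ k {c} → rank c ≤ k → c ≢ 0 → c < nx → ∃[ v ] (par ⊢ leaf v ⊑ c)
    leaf-under k {c} le nz lt with c ≤? n
    ... | yes c≤n = let (v , e) = leaf-of nz c≤n in v , subst (par ⊢ leaf v ⊑_) (sym e) stay
    ... | no c≰n with other-child (≰⇒> c≰n) lt 0
    leaf-under zero {c} le nz lt | no c≰n | d , pd , nd = ⊥-elim (<⇒≱ (rank< nd) (≤-trans (≤-trans (≤-reflexive (cong rank pd)) le) z≤n))
    leaf-under (suc k) {c} le nz lt | no c≰n | d , pd , nd
      with leaf-under k (≤-pred (≤-trans (rank< nd) (≤-trans (≤-reflexive (cong rank pd)) le))) nd (proj₂ (child-node pd nz))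
    ... | v , r = v , ⊑-trans r (step nd (subst (λ t → par ⊢ t ⊑ c) (sym pd) stay))

    some-leaf : ∀ {c} → c ≢ 0 → c < nx → ∃[ v ] (par ⊢ leaf v ⊑ c)
    some-leaf = leaf-under _ ≤-refl

    below-inner : ∀ {c v w} → v ≢ w → par ⊢ leaf v ⊑ c → par ⊢ leaf w ⊑ c → c ≢ 0 → n < c × c < nx
    below-inner ne p q nz with leaf-below p | leaf-below q
    ... | inj₂ (d , pd , nd , _) | _ = parent-inner pd nz
    ... | inj₁ _ | inj₂ (d , pd , nd , _) = parent-inner pd nz
    ... | inj₁ refl | inj₁ e = ⊥-elim (ne (leaf-injective e))

    one-or-zero : ∀ a → typ a ≢ 1 → typ a ≡ 0
    one-or-zero a ne with typ a | binary a
    ... | zero | _ = refl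
    ... | suc zero | _ = ⊥-elim (ne refl)
    ... | suc (suc _) | s≤s ()

    zero-or-one : ∀ a → typ a ≢ 0 → typ a ≡ 1
    zero-or-one a ne with typ a | binary a
    ... | zero | _ = ⊥-elim (ne refl)
    ... | suc zero | _ = refl
    ... | suc (suc _) | s≤s ()

  -- D is the set of nodes below which every leaf satisfies N.
  record Closed (nx : ℕ) (par : ℕ → ℕ) (N : Fin n → Set) (D : List ℕ) : Set where
    field
      node  : ∀ {d} → d ∈ D → d ≢ 0 × d < nx
      leaf∈ : ∀ {v} → N v → leaf v ∈ D
      ∈leaf : ∀ {v} → leaf v ∈ D → N v
      down  : ∀ {a c} → a ∈ D → par c ≡ a → c ∈ D
      up    : ∀ {a} → n < a → a < nx → (∀ c → par c ≡ a → c ∈ D) → a ∈ D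

  -- The lowest partially full node

  module Lowest (cog : IsCograph G) {k nx : ℕ} {par typ : ℕ → ℕ} (T : Cotree k 0 nx par typ)
    (x : Fin n) {D : List ℕ} (C : Closed nx par (λ v → x ~ v × toℕ v < k) D) where
    open Cotree T
    open Closed C

    N : Fin n → Set
    N v = x ~ v × toℕ v < k

    N? : ∀ v → Dec (N v)
    N? v = (x ~? v) ×-dec (toℕ v <? k)

    down* : ∀ {c d} → d ∈ D → par ⊢ c ⊑ d → c ∈ D
    down* m stay = m
    down* m (step nz p) = down (down* m p) refl

    full : ∀ {d v} → d ∈ D → par ⊢ leaf v ⊑ d → N v
    full m p = ∈leaf (down* m p)

    full⁻ : ∀ j {d} → rank d ≤ j → d ≢ 0 → d < nx → (∀ {v} → par ⊢ leaf v ⊑ d → N v) → d ∈ D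
    full⁻ j {d} le nz lt f with d ≤? n
    ... | yes d≤n with leaf-of nz d≤n
    ... | v , refl = leaf∈ (f stay)
    full⁻ zero {d} le nz lt f | no d≰n with other-child (≰⇒> d≰n) lt 0
    ... | c , pc , nc = ⊥-elim (<⇒≱ (rank< nc) (≤-trans (≤-trans (≤-reflexive (cong rank pc)) le) z≤n))
    full⁻ (suc j) {d} le nz lt f | no d≰n = up (≰⇒> d≰n) lt λ c pc →
      let (nc , c<) = child-node pc nz in
      full⁻ j (≤-pred (≤-trans (rank< nc) (≤-trans (≤-reflexive (cong rank pc)) le))) nc c<
        (λ p → f (⊑-trans p (step nc (subst (λ t → par ⊢ t ⊑ d) (sym pc) stay))))

    child∉ : ∀ {a} → n < a → a < nx → a ∉ D → ∃[ c ] (par c ≡ a × c ∉ D)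
    child∉ {a} na an m with bounded-search (λ c → (par c ≟ a) ×-dec ¬? (c ∈ℕ? D)) nx
    ... | inj₁ r = r
    ... | inj₂ none = ⊥-elim (m (up na an h))
      where
      h : ∀ c → par c ≡ a → c ∈ D
      h c pc with c ∈ℕ? D
      ... | yes r = r
      ... | no r = ⊥-elim (none c (proj₂ (child-node pc (inner≢0 na))) (pc , r))

    non-neighbour : ∀ j {c} → rank c ≤ j → c ≢ 0 → c < nx → c ∉ D → ∃[ v ] (par ⊢ leaf v ⊑ c × ¬ N v)
    non-neighbour j {c} le nz lt m with c ≤? n
    ... | yes c≤n with leaf-of nz c≤n
    ... | v , refl = v , stay , λ y → m (leaf∈ y)
    non-neighbour j {c} le nz lt m | no c≰n with child∉ (≰⇒> c≰n) lt m
    ... | d , pd , md with child-node pd nz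
    non-neighbour zero {c} le nz lt m | no c≰n | d , pd , md | nd , d< = ⊥-elim (<⇒≱ (rank< nd) (≤-trans (≤-trans (≤-reflexive (cong rank pd)) le) z≤n))
    non-neighbour (suc j) {c} le nz lt m | no c≰n | d , pd , md | nd , d<
      with non-neighbour j (≤-pred (≤-trans (rank< nd) (≤-trans (≤-reflexive (cong rank pd)) le))) nd d< md
    ... | v , r , y = v , ⊑-trans r (step nd (subst (λ t → par ⊢ t ⊑ c) (sym pd) stay)) , y

    Mixed : ℕ → Set
    Mixed c = (∃[ v ] (par ⊢ leaf v ⊑ c × N v)) × (∃[ v ] (par ⊢ leaf v ⊑ c × ¬ N v))

    mixed : ∀ {c v} → c ≢ 0 → c < nx → c ∉ D → par ⊢ leaf v ⊑ c → N v → Mixed c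
    mixed nz lt m p y = (_ , p , y) , non-neighbour _ ≤-refl nz lt m

    mixed-inner : ∀ {c} → c ≢ 0 → Mixed c → n < c × c < nx
    mixed-inner nz ((v , p , y) , (w , q , z)) = below-inner (λ { refl → z y }) p q nz

    mixed-up : ∀ {c d} → par ⊢ c ⊑ d → Mixed c → Mixed d
    mixed-up r ((v , p , y) , (w , q , z)) = (v , ⊑-trans p r , y) , (w , ⊑-trans q r , z)

    -- If the neighbour and the non-neighbour lie below the same child, take a leaf below another
    -- child; whichever kind it is, it replaces the leaf of that kind.
    across : ∀ {c} → c ≢ 0 → Mixed c → ∃[ v ] ∃[ w ] ∃[ d ] ∃[ e ]
      (N v × ¬ N w × d ≢ 0 × e ≢ 0 × d ≢ e × par d ≡ c × par e ≡ c × par ⊢ leaf v ⊑ d × par ⊢ leaf w ⊑ e)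
    across {c} nz mx@((v , p , y) , (w , q , z)) with mixed-inner nz mx
    ... | nc , cn with leaf-below p | leaf-below q
    ... | inj₁ refl | _ = ⊥-elim (inner≢leaf nc v refl)
    ... | inj₂ _ | inj₁ refl = ⊥-elim (inner≢leaf nc w refl)
    ... | inj₂ (d , pd , nd , rd) | inj₂ (e , pe , ne , re) with d ≟ e
    ... | no d≢e = v , w , d , e , y , z , nd , ne , d≢e , pd , pe , rd , re
    ... | yes refl with other-child nc cn d
    ... | f , pf , f≢d with child-node pf nz
    ... | nf , f< with some-leaf nf f<
    ... | u , ru with N? u
    ... | yes yu = u , w , f , e , yu , z , nf , ne , f≢d , pf , pe , ru , re
    ... | no zu = v , u , d , f , y , zu , nd , nf , (f≢d ∘ sym) , pd , pf , rd , ru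

    ⊑-parent : ∀ {v d c} → d ≢ 0 → par d ≡ c → par ⊢ leaf v ⊑ d → par ⊢ leaf v ⊑ c
    ⊑-parent nd refl p = ⊑-trans p (step nd stay)

    -- Let `v` be a neighbour and `w` a non-neighbour of `x` below different children of `c'`. If
    -- the parent is a join, then `x v y w` would be an induced path unless `y` is a neighbour; if
    -- it is a union, then `y x v w` would be one unless `y` is a non-neighbour. Alternation of
    -- types tells whether `v` and `w` are adjacent.
    sibling-of-mixed : ∀ {c c'} → c ≢ 0 → c' ≢ 0 → c ≢ c' → par c ≡ par c' → Mixed c' →
      ∀ {y} → par ⊢ leaf y ⊑ c → Agrees (typ (par c)) N y
    sibling-of-mixed {c} {c'} nc nc' ne e mx {y} py
      with across nc' mx
    ... | v , w , d , d' , Nv , Nw , nd , nd' , d≢d' , pd , pd' , rv , rw = join , union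
      where
      inner = mixed-inner nc' mx
      alt' : typ c' ≢ typ (par c')
      alt' = alt c' (proj₁ inner) (proj₂ inner) nc'
      vw : Agrees (typ c') (Edge k v) w
      vw = subst (λ t → Agrees (typ t) (Edge k v) w) pd (adj nd nd' d≢d' (trans pd (sym pd')) rv rw)
      yv : Agrees (typ (par c)) (Edge k y) v
      yv = adj nc nc' ne e py (⊑-parent nd pd rv)
      yw : Agrees (typ (par c)) (Edge k y) w
      yw = adj nc nc' ne e py (⊑-parent nd' pd' rw)
      join : typ (par c) ≡ 1 → N y
      join t with N? y
      ... | yes r = r
      ... | no ny = ⊥-elim (no-P₄ cog (proj₁ Nv) (~-sym (proj₁ (proj₁ yv t))) (proj₁ (proj₁ yw t))
              (λ a → ny (a , proj₁ (proj₂ (proj₁ yv t)))) (λ a → Nw (a , w<k))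
              (λ a → alt' (trans (proj₂ vw (a , proj₂ Nv , w<k)) (trans (sym t) (cong typ e)))))
        where w<k = proj₂ (proj₂ (proj₁ yw t))
      union : N y → typ (par c) ≡ 1
      union ny with typ (par c) ≟ 1
      ... | yes t = t
      ... | no t = ⊥-elim (no-P₄ cog (~-sym (proj₁ ny)) (proj₁ Nv) (proj₁ (proj₁ vw t'))
              (λ a → t (proj₂ yv (a , proj₂ ny , proj₂ Nv))) (λ a → t (proj₂ yw (a , proj₂ ny , w<k)))
              (λ a → Nw (a , w<k)))
        where
        t' : typ c' ≡ 1
        t' = zero-or-one c' (λ z → alt' (trans z (sym (one-or-zero (par c') (λ o → t (trans (cong typ e) o))))))
        w<k = proj₂ (proj₂ (proj₁ vw t'))

    module _ {u f : ℕ} (f∈D : f ∈ D) (pf : par f ≡ u) (u∉D : u ∉ D)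
      (lowest : ∀ {p g} → g ∈ D → par g ≡ p → p ∉ D → p ≢ 0 → par p ≢ u × par (par p) ≢ u) where

      nf = node f∈D

      u-mixed : u ≢ 0 → Mixed u
      u-mixed nz = let (v , p) = some-leaf (proj₁ nf) (proj₂ nf) in
        mixed nz (proj₂ (parent-inner pf nz)) u∉D (⊑-parent (proj₁ nf) pf p) (full f∈D p)

      above : AgreesAbove par typ N u
      above nc nc' ne e p pv = sibling-of-mixed nc nc' ne e
        (mixed-up p (u-mixed (λ { refl → nc' (⊑-zero p) }))) pv

      -- A mixed child of u would be a union, and its mixed child a join with a full child.
      empty : ∀ {c} → par c ≡ u → c ≢ 0 → c ∉ D → ∀ {v} → par ⊢ leaf v ⊑ c → ¬ N v
      empty {c} pc nc c∉D {v} pv Nv with c ≤? n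
      ... | yes c≤n with leaf-of nc c≤n
      ...   | w , refl with leaf-below pv
      ...     | inj₁ e = c∉D (subst (_∈ D) (sym e) (leaf∈ Nv))
      ...     | inj₂ (d , pd , _) = childless w d pd
      empty {c} pc nc c∉D {v} pv Nv | no c≰n with leaf-below pv
      ... | inj₁ refl = c≰n (leaf≤ v)
      ... | inj₂ (d , pd , nd , rd) with typ u ≟ 1
      -- The full child `f` beside the mixed child `c` forces `u` to be a join.
      ...   | no t = t (trans (sym (cong typ pf)) (proj₂ (sibling-of-mixed (proj₁ nf) nc (λ { refl → c∉D f∈D }) (trans pf (sym pc))
                (mixed nc (proj₂ (parent-inner pd nc)) c∉D pv Nv) (proj₂ (some-leaf (proj₁ nf) (proj₂ nf)))) (full f∈D (proj₂ (some-leaf (proj₁ nf) (proj₂ nf))))))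
      ...   | yes t with d ∈ℕ? D
      ...     | yes d∈D = proj₁ (lowest d∈D pd c∉D nc) pc
      ...     | no d∉D with leaf-below rd
      ...       | inj₁ refl = d∉D (leaf∈ Nv)
      ...       | inj₂ (e , pe , ne , re) with e ∈ℕ? D
      ...         | yes e∈D = proj₂ (lowest e∈D pe d∉D nd) (trans (cong par pd) pc)
      ...         | no e∉D with other-child (proj₁ (parent-inner pe nd)) (proj₂ (parent-inner pe nd)) e
      ...           | e' , pe' , e'≢e with child-node pe nd | child-node pe' nd
      ...             | _ , e< | ne' , e'< = proj₂ (lowest e'∈D pe' d∉D nd) (trans (cong par pd) pc)
        where
        ci = parent-inner pd nc
        di = parent-inner pe nd
        typ-c : typ c ≡ 0
        typ-c = one-or-zero c (λ o → alt c (proj₁ ci) (proj₂ ci) nc (trans o (trans (sym t) (cong typ (sym pc)))))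
        typ-d : typ d ≡ 1
        typ-d = zero-or-one d (λ z → alt d (proj₁ di) (proj₂ di) nd (trans z (trans (sym typ-c) (cong typ (sym pd)))))
        e'∈D : e' ∈ D
        e'∈D = full⁻ _ ≤-refl ne' e'< (λ p → proj₁ (sibling-of-mixed ne' ne e'≢e (trans pe' (sym pe))
          (mixed ne e< e∉D re Nv) p) (trans (cong typ pe') typ-d))

    module _ {d₀ : ℕ} {D₀ : List ℕ} (D≡ : D ≡ d₀ ∷ D₀) where

      -- Ranks increase strictly towards the root, so the parent of a node of greatest rank in `D`
      -- is outside.
      touched : ∃[ f ] (f ∈ D × par f ∉ D)
      touched with argmax rank d₀ D₀
      ... | f , m , mx = f , subst (f ∈_) (sym D≡) m , λ m' →
        <⇒≱ (rank< (proj₁ (node (subst (f ∈_) (sym D≡) m)))) (mx (subst (par f ∈_) D≡ m'))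

      -- Take a parent of least rank among those outside `D` that have a child in `D`: a further
      -- such parent one or two levels below it would have smaller rank.
      lowest-touched : ∃[ f ] (f ∈ D × par f ∉ D ×
        (∀ {p g} → g ∈ D → par g ≡ p → p ∉ D → p ≢ 0 → par p ≢ par f × par (par p) ≢ par f))
      lowest-touched with argmin (rank ∘ par) (λ f → ¬? (par f ∈ℕ? D)) D touched
      ... | f , m , m' , mn = f , m , m' , λ { mg refl pm nz →
          (λ e → <⇒≱ (rank< nz) (≤-trans (≤-reflexive (cong rank e)) (mn mg pm)))
        , (λ e → <⇒≱ (lt nz) (≤-trans (≤-reflexive (cong rank e)) (mn mg pm))) }
        where
        lt : ∀ {p} → p ≢ 0 → rank p < rank (par (par p))
        lt {p} nz with par p ≟ 0
        ... | yes e = ≤-trans (rank< nz) (≤-reflexive (cong rank (trans e (sym (trans (cong par e) par0)))))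
        ... | no ne = <-trans (rank< nz) (rank< ne)

  update-step : ∀ {par par'} c q → par' ≡ par [ c ↦ q ] → Step par par' (_≡ c) q
  update-step {par} c q refl .Step.cases d with d ≟ c
  ... | yes e = inj₁ (e , update-eq par c (sym e))
  ... | no ne = inj₂ (ne , update-neq par c (ne ∘ sym))

  -- Adjacency only consults the types of nodes with children, so a new number may be given a type
  -- before it is used.
  retype : ∀ {par typ typ' E} → (∀ d → d ≢ 0 → typ' (par d) ≡ typ (par d)) → Core par typ E → Core par typ' E
  retype h C .Core.rank = Core.rank C
  retype h C .Core.rank< = Core.rank< C
  retype h C .Core.par0 = Core.par0 C
  retype h C .Core.childless = Core.childless C
  retype {E = E} h C .Core.adj {d} nd nd' ne e {v} {v'} p p' = subst (λ t → Agrees t (E v) v') (sym (h d nd)) (Core.adj C nd nd' ne e p p')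

  retype-above : ∀ {par typ typ' N u} → (∀ d → d ≢ 0 → typ' (par d) ≡ typ (par d)) → AgreesAbove par typ N u → AgreesAbove par typ' N u
  retype-above {N = N} h ag {c} nc nc' ne e p {v} pv = subst (λ t → Agrees t N v) (sym (h c nc)) (ag nc nc' ne e p pv)

  Nbr : Fin n → ℕ → Fin n → Set
  Nbr x k v = x ~ v × toℕ v < k

  -- Inserting x below a node of the other type right above z is correct.
  record Place (x : Fin n) (k z nx : ℕ) (par typ : ℕ → ℕ) : Set where
    field
      tree  : Cotree k z nx par typ
      z≢0   : z ≢ 0
      z<nx  : z < nx
      z≢x   : z ≢ leaf x
      above : AgreesAbove par typ (Nbr x k) z
      under : ∀ {v} → par ⊢ leaf v ⊑ z → (typ (par z) ≡ 1 → ¬ Nbr x k v) × (typ (par z) ≢ 1 → Nbr x k v)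

  edge-old : ∀ {x k} → toℕ x ≡ k → ∀ {v v'} → v ≢ x → v' ≢ x → (Edge k v v' → Edge (suc k) v v') × (Edge (suc k) v v' → Edge k v v')
  edge-old refl nv nv' = (λ (a , p , q) → a , m≤n⇒m≤1+n p , m≤n⇒m≤1+n q) ,
    (λ (a , p , q) → a , ≤∧≢⇒< (≤-pred p) (nv ∘ Fin.toℕ-injective) , ≤∧≢⇒< (≤-pred q) (nv' ∘ Fin.toℕ-injective))

  edge-new : ∀ {x k} → toℕ x ≡ k → ∀ {v} → v ≢ x →
    (Nbr x k v → Edge (suc k) x v × Edge (suc k) v x) × (Edge (suc k) x v → Nbr x k v) × (Edge (suc k) v x → Nbr x k v)
  edge-new refl nv = (λ (a , p) → (a , ≤-refl , m≤n⇒m≤1+n p) , (~-sym a , m≤n⇒m≤1+n p , ≤-refl)) ,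
    (λ (a , p , q) → a , ≤∧≢⇒< (≤-pred q) (nv ∘ Fin.toℕ-injective)) , (λ (a , p , q) → ~-sym a , ≤∧≢⇒< (≤-pred p) (nv ∘ Fin.toℕ-injective))

  attach : ∀ {x k z nx par par' typ} → toℕ x ≡ k → Place x k z nx par typ → n < z → typ z ≢ typ (par z) →
    Step par par' (_≡ leaf x) z → Cotree (suc k) 0 nx par' typ
  attach {x} {k} {z} {nx} {par} {par'} {typ} x≡k P nz tz S = record
    { core = L.core ; low = low' ; fresh = fresh' ; n<nx = n<nx ; binary = binary ; typ0 = typ0
    ; alt = alt' ; two = two' ; outside = outside' }
    where
    open Place P
    open Cotree tree
    open Step S
    d₀ = other-child nz z<nx 0
    module H = Hang core S (λ ()) (childless x) z≢x (proj₁ d₀ , proj₂ (proj₂ d₀) , proj₁ (proj₂ d₀))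
    kids : ∀ {c} → c ≢ 0 → par c ≡ z → ∀ {v} → par ⊢ leaf v ⊑ c → Agrees (typ z) (Nbr x k) v
    kids {c} nc pc p with under (⊑-trans p (step nc (subst (λ t → par ⊢ t ⊑ z) (sym pc) stay)))
    ... | f , g = (λ t → g (λ o → tz (trans t (sym o)))) , (λ y → zero-or-one z (λ o → tz (trans o (sym (one-or-zero (par z) (λ t → f t y))))))
    module L = H.Leaf x refl (inner≢leaf nz) (edge-old x≡k) (edge-new x≡k) above kids
    low' : ∀ c → par' c ≡ 0 ⊎ (n < par' c × par' c < nx)
    low' c with cases c
    ... | inj₁ (_ , e) = inj₂ (subst (λ t → n < t × t < nx) (sym e) (nz , z<nx))
    ... | inj₂ (_ , e) = subst (λ t → t ≡ 0 ⊎ (n < t × t < nx)) (sym e) (low c)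
    fresh' : ∀ c → nx ≤ c → par' c ≡ 0
    fresh' c le = trans (kept (λ e → <⇒≱ (≤-trans (s≤s (leaf≤ x)) n<nx) (≤-trans le (≤-reflexive e)))) (fresh c le)
    inner-kept : ∀ a → n < a → par' a ≡ par a
    inner-kept a na = kept (inner≢leaf na x)
    alt' : ∀ a → n < a → a < nx → a ≢ 0 → typ a ≢ typ (par' a)
    alt' a na an _ e with a ≟ z
    ... | yes refl = tz (trans e (cong typ (inner-kept a na)))
    ... | no ne = alt a na an ne (trans e (cong typ (inner-kept a na)))
    child-kept : ∀ {d a} → n < a → par d ≡ a → par' d ≡ a
    child-kept {d} na pd = trans (kept (λ { refl → inner≢0 na (trans (sym pd) (outside x (≤-reflexive (sym x≡k)))) })) pd
    two' : ∀ a → n < a → a < nx → ∃[ d ] ∃[ d' ] (d ≢ d' × par' d ≡ a × par' d' ≡ a)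
    two' a na an with two a na an
    ... | d , d' , ne , p , p' = d , d' , ne , child-kept na p , child-kept na p'
    outside' : ∀ v → suc k ≤ toℕ v → par' (leaf v) ≡ 0
    outside' v le = trans (kept (λ e → <⇒≱ le (≤-reflexive (trans (cong toℕ (leaf-injective e)) x≡k)))) (outside v (<⇒≤ le))

  retyped : ∀ {k z nx} {par typ typ' : ℕ → ℕ} → Cotree k z nx par typ → (∀ a → a ≢ nx → typ' a ≡ typ a) → ∀ d → typ' (par d) ≡ typ (par d)
  retyped {nx = nx} {par} T h d with par d ≟ nx
  ... | no ne = h (par d) ne
  ... | yes e with Cotree.low T d
  ...   | inj₁ e0 = ⊥-elim (<⇒≱ (Cotree.n<nx T) (≤-trans (≤-reflexive (trans (sym e) e0)) z≤n))
  ...   | inj₂ (_ , lt) = ⊥-elim (<⇒≢ lt e)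

  bare-fresh : ∀ {k z nx par typ} → Cotree k z nx par typ → ∀ c → par c ≢ nx
  bare-fresh T c e with Cotree.low T c
  ... | inj₁ e0 = ⊥-elim (<⇒≱ (Cotree.n<nx T) (≤-trans (≤-reflexive (trans (sym e) e0)) z≤n))
  ... | inj₂ (_ , lt) = ⊥-elim (<⇒≢ lt e)

  -- The steps are the moves of the program: the new node `nx` below `q`, then `z` below `nx`, then
  -- `x` below `nx`. The opposite type of `nx` separates `x` from what is below `z` when `q` is a
  -- join and connects them when `q` is a union; it also restores alternation in case `z` had the
  -- type of its parent.
  pair : ∀ {x k z nx q par par₁ par₂ par₃ typ typ'} → toℕ x ≡ k → Place x k z nx par typ → (n < z → typ z ≡ typ (par z)) →
    par z ≡ q → Step par par₁ (_≡ nx) q → Step par₁ par₂ (_≡ z) nx → Step par₂ par₃ (_≡ leaf x) nx →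
    (∀ a → a ≢ nx → typ' a ≡ typ a) → typ' nx ≡ 1 ∸ typ q →
    Cotree (suc k) 0 (suc nx) par₃ typ'
  pair {x} {k} {z} {nx} {q} {par} {par₁} {par₂} {par₃} {typ} {typ'} x≡k P tz pz S₁ S₂ S₃ ty tyw = record
    { core = L.core ; low = low' ; fresh = fresh' ; n<nx = m≤n⇒m≤1+n n<nx ; binary = binary' ; typ0 = trans (ty 0 (nx≢0 ∘ sym)) typ0
    ; alt = alt' ; two = two' ; outside = outside' }
    where
    open Place P
    open Cotree tree
    nx≢0 = inner≢0 n<nx
    nx≢leaf = inner≢leaf n<nx
    z≢nx = <⇒≢ z<nx
    q≢nx : q ≢ nx
    q≢nx e = bare-fresh tree z (trans pz e)
    q≢leaf : ∀ v → q ≢ leaf v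
    q≢leaf v e = childless v z (trans pz e)
    same-typ : ∀ d → typ' (par d) ≡ typ (par d)
    same-typ = retyped {typ' = typ'} tree ty
    core₀ : Core par typ' (Edge k)
    core₀ = retype (λ d _ → same-typ d) core
    module H₁ = Hang core₀ S₁ nx≢0 (bare-fresh tree) q≢nx (z , z≢0 , pz)
    module I₁ = H₁.Inner nx≢leaf q≢leaf
    above₁ : AgreesAbove par₁ typ' (Nbr x k) z
    above₁ = I₁.above z≢nx (retype-above {typ = typ} {typ'} {Nbr x k} (λ d _ → same-typ d) above)
    pz₁ : par₁ z ≡ q
    pz₁ = trans (Step.kept S₁ z≢nx) pz
    z-child : ∀ {c} → c ≡ z → par₁ c ≡ q × c ≢ 0
    z-child refl = pz₁ , z≢0
    module D₂ = Down I₁.core S₂ z-child nx≢0 (Step.moved S₁ refl) (z≢nx ∘ sym) nx≢leaf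
    core₂ = D₂.core (inj₂ (H₁.bare' , λ { refl refl → refl }))
    above₂ : AgreesAbove par₂ typ' (Nbr x k) nx
    above₂ = D₂.above-tg {Nbr x k}
      (λ nc nc' ne e p pv → above₁ nc nc' ne e (step z≢0 (subst (λ t → par₁ ⊢ t ⊑ _) (sym pz₁) p)) pv)
      (λ {c} nc pc ne _ pv → subst (λ t → Agrees (typ' t) (Nbr x k) _) pc (above₁ nc z≢0 ne (trans pc (sym pz₁)) stay pv))
    kids : ∀ {c} → c ≢ 0 → par₂ c ≡ nx → ∀ {v} → par₂ ⊢ leaf v ⊑ c → Agrees (typ' nx) (Nbr x k) v
    kids {c} nc pc {v} p with Step.cases S₂ c
    ... | inj₂ (_ , e) = ⊥-elim (H₁.bare' c (trans (sym e) pc))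
    ... | inj₁ (refl , _) with under (H₁.⊑-old (nx≢leaf v ∘ sym) (D₂.⊑-old-≢ z≢nx p))
    ...   | f , g = (λ t → g (λ o → 0≢1+n (trans (cong (1 ∸_) (sym (trans (sym (cong typ pz)) o))) (trans (sym tyw) t))))
                  , (λ y → trans tyw (cong (1 ∸_) (one-or-zero q (λ t → f (trans (cong typ pz) t) y))))
    module H₃ = Hang core₂ S₃ (λ ()) (Core.childless core₂ x) (nx≢leaf x) (z , z≢0 , Step.moved S₂ refl)
    module L = H₃.Leaf x refl nx≢leaf (edge-old x≡k) (edge-new x≡k) above₂ kids
    cases : ∀ c → (c ≡ leaf x ⊎ c ≡ z) × par₃ c ≡ nx ⊎ (c ≡ nx × par₃ c ≡ q) ⊎ (c ≢ leaf x × c ≢ z × c ≢ nx × par₃ c ≡ par c)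
    cases c with Step.cases S₃ c | Step.cases S₂ c | Step.cases S₁ c
    ... | inj₁ (e , p) | _ | _ = inj₁ (inj₁ e , p)
    ... | inj₂ (_ , p) | inj₁ (e , p') | _ = inj₁ (inj₂ e , trans p p')
    ... | inj₂ (_ , p) | inj₂ (_ , p') | inj₁ (e , p'') = inj₂ (inj₁ (e , trans p (trans p' p'')))
    ... | inj₂ (a , p) | inj₂ (b , p') | inj₂ (d , p'') = inj₂ (inj₂ (a , b , d , trans p (trans p' p'')))
    range : ∀ {a} → a ≡ 0 ⊎ (n < a × a < nx) → a ≡ 0 ⊎ (n < a × a < suc nx)
    range (inj₁ e) = inj₁ e
    range (inj₂ (p , r)) = inj₂ (p , m≤n⇒m≤1+n r)
    low' : ∀ c → par₃ c ≡ 0 ⊎ (n < par₃ c × par₃ c < suc nx)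
    low' c with cases c
    ... | inj₁ (_ , e) = inj₂ (subst (λ t → n < t × t < suc nx) (sym e) (n<nx , ≤-refl))
    ... | inj₂ (inj₁ (_ , e)) = subst (λ t → t ≡ 0 ⊎ (n < t × t < suc nx)) (trans pz (sym e)) (range (low z))
    ... | inj₂ (inj₂ (_ , _ , _ , e)) = subst (λ t → t ≡ 0 ⊎ (n < t × t < suc nx)) (sym e) (range (low c))
    fresh' : ∀ c → suc nx ≤ c → par₃ c ≡ 0
    fresh' c le with cases c
    ... | inj₁ (inj₁ refl , e) = ⊥-elim (<⇒≱ (≤-trans (s≤s (leaf≤ x)) n<nx) (<⇒≤ le))
    ... | inj₁ (inj₂ refl , e) = ⊥-elim (<⇒≱ z<nx (<⇒≤ le))
    ... | inj₂ (inj₁ (refl , e)) = ⊥-elim (<-irrefl refl le)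
    ... | inj₂ (inj₂ (_ , _ , _ , e)) = trans e (fresh c (<⇒≤ le))
    binary' : ∀ a → typ' a ≤ 1
    binary' a with a ≟ nx
    ... | yes refl = ≤-trans (≤-reflexive tyw) (m∸n≤m 1 (typ q))
    ... | no ne = ≤-trans (≤-reflexive (ty a ne)) (binary a)
    flip : ∀ {t} → t ≢ 1 ∸ t
    flip {zero} ()
    flip {suc t} e with 1+n≢0 {t} (trans e (0∸n≡0 t))
    ... | ()
    tyq : typ' q ≡ typ q
    tyq = ty q q≢nx
    alt' : ∀ a → n < a → a < suc nx → a ≢ 0 → typ' a ≢ typ' (par₃ a)
    alt' a na an nz e with cases a
    ... | inj₁ (inj₁ refl , _) = inner≢leaf na x refl
    ... | inj₁ (inj₂ refl , p) = flip (trans (trans (sym (cong typ pz)) (trans (sym (tz na)) (sym (ty a z≢nx)))) (trans e (trans (cong typ' p) tyw)))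
    ... | inj₂ (inj₁ (refl , p)) = flip (trans (sym tyq) (trans (sym (cong typ' p)) (trans (sym e) tyw)))
    ... | inj₂ (inj₂ (_ , az , anx , p)) = alt a na (≤∧≢⇒< (≤-pred an) anx) az (trans (sym (ty a anx)) (trans e (trans (cong typ' p) (same-typ a))))
    two' : ∀ a → n < a → a < suc nx → ∃[ d ] ∃[ d' ] (d ≢ d' × par₃ d ≡ a × par₃ d' ≡ a)
    two' a na an with a ≟ nx
    ... | yes refl = z , leaf x , z≢x , trans (Step.kept S₃ z≢x) (Step.moved S₂ refl) , Step.moved S₃ refl
    ... | no a≢nx with a ≟ q
    two' a na an | no a≢nx | yes refl with other-child na (≤∧≢⇒< (≤-pred an) a≢nx) z
    ... | d , pd , d≢z with cases d
    ... | inj₁ (inj₁ refl , _) = ⊥-elim (inner≢0 na (trans (sym pd) (outside x (≤-reflexive (sym x≡k)))))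
    ... | inj₁ (inj₂ e , _) = ⊥-elim (d≢z e)
    ... | inj₂ (inj₁ (refl , _)) = ⊥-elim (inner≢0 na (trans (sym pd) (fresh _ ≤-refl)))
    ... | inj₂ (inj₂ (_ , _ , dnx , e)) = d , nx , dnx , trans e pd , trans (Step.kept S₃ (nx≢leaf x)) (trans (Step.kept S₂ (z≢nx ∘ sym)) (Step.moved S₁ refl))
    two' a na an | no a≢nx | no a≢q with two a na (≤∧≢⇒< (≤-pred an) a≢nx)
    ... | d , d' , ne , p , p' = d , d' , ne , still p , still p'
      where
      still : ∀ {d} → par d ≡ a → par₃ d ≡ a
      still {d} pd with cases d
      ... | inj₁ (inj₁ refl , _) = ⊥-elim (inner≢0 na (trans (sym pd) (outside x (≤-reflexive (sym x≡k)))))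
      ... | inj₁ (inj₂ refl , _) = ⊥-elim (a≢q (trans (sym pd) pz))
      ... | inj₂ (inj₁ (refl , _)) = ⊥-elim (inner≢0 na (trans (sym pd) (fresh _ ≤-refl)))
      ... | inj₂ (inj₂ (_ , _ , _ , e)) = trans e pd
    outside' : ∀ v → suc k ≤ toℕ v → par₃ (leaf v) ≡ 0
    outside' v le with cases (leaf v)
    ... | inj₁ (inj₁ e , _) = ⊥-elim (<⇒≱ le (≤-reflexive (trans (cong toℕ (leaf-injective e)) x≡k)))
    -- `z` is no vertex still to come: such a vertex is a child of the root, a union, and below a
    -- union all leaves under `z` are earlier neighbours.
    ... | inj₁ (inj₂ refl , _) with typ (par (leaf v)) ≟ 1 | outside v (<⇒≤ le)
    ...   | yes t | o = ⊥-elim (0≢1+n (trans (sym (trans (cong typ o) typ0)) t))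
    ...   | no t | o = ⊥-elim (<⇒≱ (proj₂ (proj₂ (under stay) t)) (<⇒≤ le))
    outside' v le | inj₂ (inj₁ (e , _)) = ⊥-elim (nx≢leaf v (sym e))
    outside' v le | inj₂ (inj₂ (_ , _ , _ , e)) = trans e (outside v (<⇒≤ le))

  -- Preparing the place of the new vertex

  module Splitting (cog : IsCograph G)
      {k nx : ℕ} {par typ : ℕ → ℕ} (T : Cotree k 0 nx par typ)
      (x : Fin n) (x≡k : toℕ x ≡ k) {D : List ℕ} (C : Closed nx par (Nbr x k) D)
      {u f : ℕ} (f∈D : f ∈ D) (pf : par f ≡ u) (u∉D : u ∉ D)
      (lowest : ∀ {p g} → g ∈ D → par g ≡ p → p ∉ D → p ≢ 0 → par p ≢ u × par (par p) ≢ u) where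
    open Cotree T
    open Closed C
    module L = Lowest cog T x C

    above-u : AgreesAbove par typ (Nbr x k) u
    above-u = L.above f∈D pf u∉D lowest

    empty : ∀ {c} → par c ≡ u → c ≢ 0 → c ∉ D → ∀ {v} → par ⊢ leaf v ⊑ c → ¬ Nbr x k v
    empty = L.empty f∈D pf u∉D lowest

    leafx∉D : leaf x ∉ D
    leafx∉D m = ~-irrefl x (proj₁ (∈leaf m))

    -- The case in which no child has to move: `z` is the only child of a join that is not full, or
    -- the only full child of a union.
    place-child : ∀ {z} → par z ≡ u → z ≢ 0 → (typ u ≡ 1 → z ∉ D) → (typ u ≢ 1 → z ∈ D) →
      (∀ {c} → par c ≡ u → c ≢ 0 → c ≢ z → (typ u ≡ 1 → c ∈ D) × (typ u ≢ 1 → c ∉ D)) →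
      Place x k z nx par typ
    place-child {z} pz z≢0 join union sib = record
      { tree = record { core = core ; low = low ; fresh = fresh ; n<nx = n<nx ; binary = binary ; typ0 = typ0
                      ; alt = λ a na an _ → alt a na an (inner≢0 na) ; two = two ; outside = outside }
      ; z≢0 = z≢0 ; z<nx = z<nx ; z≢x = z≢x ; above = above ; under = under }
      where
      typ1⇒≢0 : typ u ≡ 1 → u ≢ 0
      typ1⇒≢0 t refl = 0≢1+n (trans (sym typ0) t)
      z<nx : z < nx
      z<nx with typ u ≟ 1
      ... | yes t = proj₂ (child-node pz (typ1⇒≢0 t))
      ... | no t = proj₂ (node (union t))
      z≢x : z ≢ leaf x
      z≢x refl with typ u ≟ 1
      ... | yes t = typ1⇒≢0 t (trans (sym pz) (outside x (≤-reflexive (sym x≡k))))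
      ... | no t = leafx∉D (union t)
      above : AgreesAbove par typ (Nbr x k) z
      above {c} {c'} nc nc' ne e p {v} pv with z ≟ c'
      ... | no z≢c' = above-u nc nc' ne e (subst (λ t → par ⊢ t ⊑ c') pz (⊑-step⁻ p z≢c')) pv
      ... | yes refl with sib (trans e pz) nc ne
      ...   | j , o = (λ t → L.full (j (trans (cong typ (sym (trans e pz))) t)) pv) , g
        where
        g : Nbr x k v → typ (par c) ≡ 1
        g y with typ u ≟ 1
        ... | yes t = trans (cong typ (trans e pz)) t
        ... | no t = ⊥-elim (empty (trans e pz) nc (o t) pv y)
      under : ∀ {v} → par ⊢ leaf v ⊑ z → (typ (par z) ≡ 1 → ¬ Nbr x k v) × (typ (par z) ≢ 1 → Nbr x k v)
      under p = (λ t → empty pz z≢0 (join (trans (cong typ (sym pz)) t)) p) , (λ t → L.full (union (t ∘ trans (cong typ pz))) p)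

    u≢leaf : ∀ v → u ≢ leaf v
    u≢leaf v e = childless v f (trans pf e)

    u<nx : u < nx
    u<nx with low f
    ... | inj₁ e = ≤-trans (s≤s (≤-reflexive (trans (sym pf) e))) (≤-trans (s≤s z≤n) n<nx)
    ... | inj₂ (_ , lt) = ≤-trans (s≤s (≤-reflexive (sym pf))) lt

    nx≢0 : nx ≢ 0
    nx≢0 = inner≢0 n<nx

    nx≢leaf : ∀ v → nx ≢ leaf v
    nx≢leaf = inner≢leaf n<nx

    nx∉D : nx ∉ D
    nx∉D m = <-irrefl refl (proj₂ (node m))

    range : ∀ {a} → a ≡ 0 ⊎ (n < a × a < nx) → a ≡ 0 ⊎ (n < a × a < suc nx)
    range (inj₁ e) = inj₁ e
    range (inj₂ (p , r)) = inj₂ (p , m≤n⇒m≤1+n r)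

    module _ {typ' : ℕ → ℕ} (ty : ∀ a → a ≢ nx → typ' a ≡ typ a) where

      same-typ : ∀ d → typ' (par d) ≡ typ (par d)
      same-typ = retyped {typ' = typ'} T ty

      core₀ : Core par typ' (Edge k)
      core₀ = retype (λ d _ → same-typ d) core

      above₀ : AgreesAbove par typ' (Nbr x k) u
      above₀ = retype-above {typ = typ} {typ'} {Nbr x k} (λ d _ → same-typ d) above-u

      tyu : typ' u ≡ typ u
      tyu = ty u (<⇒≢ u<nx)

      -- A union inside the union `u` collects the full children. The pair of equal types is
      -- tolerated at `nx` alone, until a join with `x` is put in between.
      split-union : ∀ {par₁ par₂ f'} → typ u ≢ 1 → f' ∈ D → par f' ≡ u → f' ≢ f →
        Step par par₁ (_≡ nx) u → Step par₁ par₂ (λ c → c ∈ D × par₁ c ≡ u) nx → typ' nx ≡ typ u →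
        Place x k nx (suc nx) par₂ typ' × par₂ nx ≡ u
      split-union {par₁} {par₂} {f'} tu f'∈D pf' f'≢f S₁ S₂ tyw = record
        { tree = record { core = core₂ ; low = low' ; fresh = fresh' ; n<nx = m≤n⇒m≤1+n n<nx ; binary = binary'
                        ; typ0 = trans (ty 0 (nx≢0 ∘ sym)) typ0 ; alt = alt' ; two = two' ; outside = outside' }
        ; z≢0 = nx≢0 ; z<nx = ≤-refl ; z≢x = nx≢leaf x ; above = above₂ ; under = under' } , par₂-nx
        where
        module H = Hang core₀ S₁ nx≢0 (bare-fresh T) (<⇒≢ u<nx) (f , proj₁ (node f∈D) , pf)
        module I = H.Inner nx≢leaf u≢leaf
        open Step using (moved; kept)
        A : ℕ → Set
        A c = c ∈ D × par₁ c ≡ u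
        nx∉A : ¬ A nx
        nx∉A (m , _) = nx∉D m
        module D₂ = Down I.core S₂ (λ (m , e) → e , proj₁ (node m)) nx≢0 (moved S₁ refl) nx∉A nx≢leaf
        core₂ = D₂.core (inj₁ (trans tyw (sym tyu)))
        par₂-nx : par₂ nx ≡ u
        par₂-nx = D₂.par'-tg
        old₁ : ∀ {v c} → par₁ ⊢ leaf v ⊑ c → par ⊢ leaf v ⊑ c
        old₁ {v} = H.⊑-old (nx≢leaf v ∘ sym)
        t0 : typ u ≡ 0
        t0 = one-or-zero u tu
        above₂ : AgreesAbove par₂ typ' (Nbr x k) nx
        above₂ = D₂.above-tg {Nbr x k} (I.above (<⇒≢ u<nx) above₀) λ {c} nc pc nac c≢nx {v} pv →
          (λ t → ⊥-elim (0≢1+n (trans (sym (trans tyu t0)) t)))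
          , (λ y → ⊥-elim (empty (trans (sym (kept S₁ c≢nx)) pc) nc (λ m → nac (m , pc)) (old₁ pv) y))
        cases : ∀ c → (c ∈ D × par c ≡ u × par₂ c ≡ nx) ⊎ (c ≡ nx × par₂ c ≡ u) ⊎ (¬ (c ∈ D × par c ≡ u) × c ≢ nx × par₂ c ≡ par c)
        cases c with c ≟ nx | Step.cases S₂ c
        ... | yes refl | _ = inj₂ (inj₁ (refl , par₂-nx))
        ... | no ne | inj₁ ((m , e) , p) = inj₁ (m , trans (sym (kept S₁ ne)) e , p)
        ... | no ne | inj₂ (na , p) = inj₂ (inj₂ ((λ (m , e) → na (m , trans (kept S₁ ne) e)) , ne , trans p (kept S₁ ne)))
        under' : ∀ {v} → par₂ ⊢ leaf v ⊑ nx → (typ' (par₂ nx) ≡ 1 → ¬ Nbr x k v) × (typ' (par₂ nx) ≢ 1 → Nbr x k v)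
        under' {v} p = (λ t → ⊥-elim (tu (trans (sym tyu) (trans (cong typ' (sym par₂-nx)) t)))) , (λ _ → g)
          where
          g : Nbr x k v
          g with ⊑-last p (nx≢leaf v ∘ sym)
          ... | d , pd , nd , r with cases d
          ...   | inj₁ (m , _ , _) = L.full m (old₁ (D₂.⊑-old-≢ (λ { refl → nx∉D m }) r))
          ...   | inj₂ (inj₁ (refl , e)) = ⊥-elim (<⇒≢ u<nx (trans (sym e) pd))
          ...   | inj₂ (inj₂ (_ , _ , e)) = ⊥-elim (bare-fresh T d (trans (sym e) pd))
        low' : ∀ c → par₂ c ≡ 0 ⊎ (n < par₂ c × par₂ c < suc nx)
        low' c with cases c
        ... | inj₁ (_ , _ , e) = inj₂ (subst (λ t → n < t × t < suc nx) (sym e) (n<nx , ≤-refl))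
        ... | inj₂ (inj₁ (_ , e)) = subst (λ t → t ≡ 0 ⊎ (n < t × t < suc nx)) (trans pf (sym e)) (range (low f))
        ... | inj₂ (inj₂ (_ , _ , e)) = subst (λ t → t ≡ 0 ⊎ (n < t × t < suc nx)) (sym e) (range (low c))
        fresh' : ∀ c → suc nx ≤ c → par₂ c ≡ 0
        fresh' c le with cases c
        ... | inj₁ (m , _) = ⊥-elim (<⇒≱ (proj₂ (node m)) (<⇒≤ le))
        ... | inj₂ (inj₁ (refl , _)) = ⊥-elim (<-irrefl refl le)
        ... | inj₂ (inj₂ (_ , _ , e)) = trans e (fresh c (<⇒≤ le))
        binary' : ∀ a → typ' a ≤ 1
        binary' a with a ≟ nx
        ... | yes refl = ≤-trans (≤-reflexive tyw) (binary u)
        ... | no ne = ≤-trans (≤-reflexive (ty a ne)) (binary a)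
        alt' : ∀ a → n < a → a < suc nx → a ≢ nx → typ' a ≢ typ' (par₂ a)
        alt' a na an ne e with cases a
        ... | inj₁ (m , pa , p) = alt a na (≤∧≢⇒< (≤-pred an) ne) (inner≢0 na)
                (trans (sym (ty a ne)) (trans e (trans (cong typ' p) (trans tyw (cong typ (sym pa))))))
        ... | inj₂ (inj₁ (e' , _)) = ne e'
        ... | inj₂ (inj₂ (_ , _ , p)) = alt a na (≤∧≢⇒< (≤-pred an) ne) (inner≢0 na) (trans (sym (ty a ne)) (trans e (trans (cong typ' p) (same-typ a))))
        two' : ∀ a → n < a → a < suc nx → ∃[ d ] ∃[ d' ] (d ≢ d' × par₂ d ≡ a × par₂ d' ≡ a)
        two' a na an with a ≟ nx
        ... | yes refl = f , f' , f'≢f ∘ sym , in-A f∈D pf , in-A f'∈D pf'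
          where
          in-A : ∀ {g} → g ∈ D → par g ≡ u → par₂ g ≡ nx
          in-A {g} m e = moved S₂ (m , trans (kept S₁ (λ { refl → nx∉D m })) e)
        ... | no a≢nx with a ≟ u
        two' a na an | no a≢nx | yes refl with L.child∉ na u<nx u∉D
        ... | c , pc , c∉D with cases c
        ...   | inj₁ (m , _) = ⊥-elim (c∉D m)
        ...   | inj₂ (inj₁ (refl , _)) = ⊥-elim (inner≢0 na (trans (sym pc) (fresh _ ≤-refl)))
        ...   | inj₂ (inj₂ (_ , ne , e)) = c , nx , ne , trans e pc , par₂-nx
        two' a na an | no a≢nx | no a≢u with two a na (≤∧≢⇒< (≤-pred an) a≢nx)
        ... | d , d' , ne , p , p' = d , d' , ne , still p , still p'
          where
          still : ∀ {d} → par d ≡ a → par₂ d ≡ a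
          still {d} pd with cases d
          ... | inj₁ (_ , e , _) = ⊥-elim (a≢u (trans (sym pd) e))
          ... | inj₂ (inj₁ (refl , _)) = ⊥-elim (inner≢0 na (trans (sym pd) (fresh _ ≤-refl)))
          ... | inj₂ (inj₂ (_ , _ , e)) = trans e pd
        outside' : ∀ v → k ≤ toℕ v → par₂ (leaf v) ≡ 0
        outside' v le with cases (leaf v)
        ... | inj₁ (m , _) = ⊥-elim (<⇒≱ (proj₂ (∈leaf m)) le)
        ... | inj₂ (inj₁ (e , _)) = ⊥-elim (nx≢leaf v (sym e))
        ... | inj₂ (inj₂ (_ , _ , e)) = trans e (outside v le)

      -- The new join `nx` is hung beside `u`, then `u` goes below it, and the full children rise
      -- from `u` to `nx`. What remains below `u` contains no neighbour of `x`, and the two children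
      -- `c` and `c'` keep `u` binary.
      split-join : ∀ {par₁ par₂ par₃ q c c'} → typ u ≡ 1 → par u ≡ q →
        par c ≡ u → c ∉ D → par c' ≡ u → c' ∉ D → c ≢ c' →
        Step par par₁ (_≡ nx) q → Step par₁ par₂ (_≡ u) nx → Step par₂ par₃ (λ c → c ∈ D × par₂ c ≡ u) nx → typ' nx ≡ 1 →
        Place x k u (suc nx) par₃ typ' × par₃ u ≡ nx
      split-join {par₁} {par₂} {par₃} {q} {c₁} {c₂} tu pu pc₁ c₁∉D pc₂ c₂∉D c₁≢c₂ S₁ S₂ S₃ tyw = record
        { tree = record { core = U.core ; low = low' ; fresh = fresh' ; n<nx = m≤n⇒m≤1+n n<nx ; binary = binary'
                        ; typ0 = trans (ty 0 (nx≢0 ∘ sym)) typ0 ; alt = alt' ; two = two' ; outside = outside' }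
        ; z≢0 = u≢0 ; z<nx = m≤n⇒m≤1+n u<nx ; z≢x = u≢leaf x ; above = above₃ ; under = under' } , U.par'-p
        where
        open Step using (moved; kept)
        u≢0 : u ≢ 0
        u≢0 refl = 0≢1+n (trans (sym typ0) tu)
        n<u = proj₁ (parent-inner pf u≢0)
        u≢nx = <⇒≢ u<nx
        q≢nx : q ≢ nx
        q≢nx e = bare-fresh T u (trans pu e)
        q≢leaf : ∀ v → q ≢ leaf v
        q≢leaf v e = childless v u (trans pu e)
        module H = Hang core₀ S₁ nx≢0 (bare-fresh T) q≢nx (u , u≢0 , pu)
        module I = H.Inner nx≢leaf q≢leaf
        pu₁ : par₁ u ≡ q
        pu₁ = trans (kept S₁ u≢nx) pu
        u-child : ∀ {c} → c ≡ u → par₁ c ≡ q × c ≢ 0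
        u-child refl = pu₁ , u≢0
        module D₂ = Down I.core S₂ u-child nx≢0 (moved S₁ refl) (u≢nx ∘ sym) nx≢leaf
        core₂ = D₂.core (inj₂ (H.bare' , λ { refl refl → refl }))
        above₁ : AgreesAbove par₁ typ' (Nbr x k) u
        above₁ = I.above u≢nx above₀
        above-nx : AgreesAbove par₂ typ' (Nbr x k) nx
        above-nx = D₂.above-tg {Nbr x k}
          (λ nc nc' ne e p pv → above₁ nc nc' ne e (step u≢0 (subst (λ t → par₁ ⊢ t ⊑ _) (sym pu₁) p)) pv)
          (λ {c} nc pc ne _ pv → subst (λ t → Agrees (typ' t) (Nbr x k) _) pc (above₁ nc u≢0 ne (trans pc (sym pu₁)) stay pv))
        above₂ : AgreesAbove par₂ typ' (Nbr x k) u
        above₂ = D₂.above-only-child {Nbr x k} H.bare' (λ e → e) refl above-nx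
        tyu1 : typ' u ≡ 1
        tyu1 = trans tyu tu
        module U = Up core₂ S₃ (λ (m , e) → e , proj₁ (node m)) u≢0 (moved S₂ refl) (trans tyu1 (sym tyw)) nx≢leaf
        old₂ : ∀ {v c} → c ≢ nx → par₂ ⊢ leaf v ⊑ c → par ⊢ leaf v ⊑ c
        old₂ {v} ne p = H.⊑-old (nx≢leaf v ∘ sym) (D₂.⊑-old-≢ ne p)
        above₃ : AgreesAbove par₃ typ' (Nbr x k) u
        above₃ = U.above {Nbr x k} above₂ (λ (m , _) p → (λ _ → L.full m (old₂ (λ { refl → nx∉D m }) p)) , (λ _ → tyw))
        cases : ∀ c → (c ∈ D × par c ≡ u × par₃ c ≡ nx) ⊎ (c ≡ u × par₃ c ≡ nx) ⊎ (c ≡ nx × par₃ c ≡ q)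
          ⊎ (¬ (c ∈ D × par c ≡ u) × c ≢ nx × c ≢ u × par₃ c ≡ par c)
        cases c with c ≟ nx | c ≟ u
        ... | yes refl | _ = inj₂ (inj₂ (inj₁ (refl , trans (kept S₃ (λ (m , _) → nx∉D m)) (trans (kept S₂ (u≢nx ∘ sym)) (moved S₁ refl)))))
        ... | no _ | yes refl = inj₂ (inj₁ (refl , U.par'-p))
        ... | no ne | no nu with Step.cases S₃ c
        ...   | inj₁ ((m , e) , p) = inj₁ (m , trans (sym (trans (kept S₂ nu) (kept S₁ ne))) e , p)
        ...   | inj₂ (na , p) = inj₂ (inj₂ (inj₂ ((λ (m , e) → na (m , trans (trans (kept S₂ nu) (kept S₁ ne)) e)) , ne , nu , trans p (trans (kept S₂ nu) (kept S₁ ne)))))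
        under' : ∀ {v} → par₃ ⊢ leaf v ⊑ u → (typ' (par₃ u) ≡ 1 → ¬ Nbr x k v) × (typ' (par₃ u) ≢ 1 → Nbr x k v)
        under' {v} p = (λ _ → g) , (λ t → ⊥-elim (t (trans (cong typ' U.par'-p) tyw)))
          where
          g : ¬ Nbr x k v
          g y with ⊑-last p (u≢leaf v ∘ sym)
          ... | d , pd , nd , r with cases d
          ...   | inj₁ (_ , _ , e) = u≢nx (trans (sym pd) e)
          ...   | inj₂ (inj₁ (_ , e)) = u≢nx (trans (sym pd) e)
          ...   | inj₂ (inj₂ (inj₁ (_ , e))) = <⇒≢ (rank< u≢0) (cong rank (trans (sym pd) (trans e (sym pu))))
          ...   | inj₂ (inj₂ (inj₂ (na , ne , _ , e))) = empty (trans (sym e) pd) nd (λ m → na (m , trans (sym e) pd)) (old₂ ne (U.⊑-old r)) y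
        low' : ∀ c → par₃ c ≡ 0 ⊎ (n < par₃ c × par₃ c < suc nx)
        low' c with cases c
        ... | inj₁ (_ , _ , e) = inj₂ (subst (λ t → n < t × t < suc nx) (sym e) (n<nx , ≤-refl))
        ... | inj₂ (inj₁ (_ , e)) = inj₂ (subst (λ t → n < t × t < suc nx) (sym e) (n<nx , ≤-refl))
        ... | inj₂ (inj₂ (inj₁ (_ , e))) = subst (λ t → t ≡ 0 ⊎ (n < t × t < suc nx)) (trans pu (sym e)) (range (low u))
        ... | inj₂ (inj₂ (inj₂ (_ , _ , _ , e))) = subst (λ t → t ≡ 0 ⊎ (n < t × t < suc nx)) (sym e) (range (low c))
        fresh' : ∀ c → suc nx ≤ c → par₃ c ≡ 0
        fresh' c le with cases c
        ... | inj₁ (m , _) = ⊥-elim (<⇒≱ (proj₂ (node m)) (<⇒≤ le))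
        ... | inj₂ (inj₁ (refl , _)) = ⊥-elim (<⇒≱ u<nx (<⇒≤ le))
        ... | inj₂ (inj₂ (inj₁ (refl , _))) = ⊥-elim (<-irrefl refl le)
        ... | inj₂ (inj₂ (inj₂ (_ , _ , _ , e))) = trans e (fresh c (<⇒≤ le))
        binary' : ∀ a → typ' a ≤ 1
        binary' a with a ≟ nx
        ... | yes refl = ≤-reflexive tyw
        ... | no ne = ≤-trans (≤-reflexive (ty a ne)) (binary a)
        alt' : ∀ a → n < a → a < suc nx → a ≢ u → typ' a ≢ typ' (par₃ a)
        alt' a na an a≢u e with cases a
        ... | inj₁ (m , pa , p) = alt a na (proj₂ (node m)) (inner≢0 na)
                (trans (sym (ty a (λ { refl → nx∉D m }))) (trans e (trans (cong typ' p) (trans tyw (trans (sym tu) (cong typ (sym pa)))))))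
        ... | inj₂ (inj₁ (e' , _)) = a≢u e'
        ... | inj₂ (inj₂ (inj₁ (refl , p))) = alt u n<u u<nx (inner≢0 n<u)
                (trans tu (trans (sym tyw) (trans e (trans (cong typ' p) (trans (ty q q≢nx) (cong typ (sym pu)))))))
        ... | inj₂ (inj₂ (inj₂ (_ , ne , _ , p))) = alt a na (≤∧≢⇒< (≤-pred an) ne) (inner≢0 na) (trans (sym (ty a ne)) (trans e (trans (cong typ' p) (same-typ a))))
        two' : ∀ a → n < a → a < suc nx → ∃[ d ] ∃[ d' ] (d ≢ d' × par₃ d ≡ a × par₃ d' ≡ a)
        two' a na an with a ≟ nx
        ... | yes refl = f , u , (λ { refl → u∉D f∈D })
              , moved S₃ (f∈D , trans (kept S₂ (λ { refl → u∉D f∈D })) (trans (kept S₁ (λ { refl → nx∉D f∈D })) pf)) , U.par'-p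
        ... | no a≢nx with a ≟ u
        two' a na an | no a≢nx | yes refl = c₁ , c₂ , c₁≢c₂ , still pc₁ c₁∉D , still pc₂ c₂∉D
          where
          still : ∀ {d} → par d ≡ a → d ∉ D → par₃ d ≡ a
          still {d} pd d∉D with cases d
          ... | inj₁ (m , _) = ⊥-elim (d∉D m)
          ... | inj₂ (inj₁ (refl , _)) = ⊥-elim (<⇒≢ (rank< u≢0) (cong rank (sym pd)))
          ... | inj₂ (inj₂ (inj₁ (refl , _))) = ⊥-elim (inner≢0 na (trans (sym pd) (fresh _ ≤-refl)))
          ... | inj₂ (inj₂ (inj₂ (_ , _ , _ , e))) = trans e pd
        two' a na an | no a≢nx | no a≢u with a ≟ q
        two' a na an | no a≢nx | no a≢u | yes refl with other-child na (≤∧≢⇒< (≤-pred an) a≢nx) u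
        ... | d , pd , d≢u with cases d
        ... | inj₁ (_ , e , _) = ⊥-elim (a≢u (trans (sym pd) e))
        ... | inj₂ (inj₁ (e , _)) = ⊥-elim (d≢u e)
        ... | inj₂ (inj₂ (inj₁ (refl , _))) = ⊥-elim (inner≢0 na (trans (sym pd) (fresh _ ≤-refl)))
        ... | inj₂ (inj₂ (inj₂ (_ , ne , _ , e))) = d , nx , ne , trans e pd , trans (kept S₃ (λ (m , _) → nx∉D m)) (trans (kept S₂ (u≢nx ∘ sym)) (moved S₁ refl))
        two' a na an | no a≢nx | no a≢u | no a≢q with two a na (≤∧≢⇒< (≤-pred an) a≢nx)
        ... | d , d' , ne , p , p' = d , d' , ne , still p , still p'
          where
          still : ∀ {d} → par d ≡ a → par₃ d ≡ a
          still {d} pd with cases d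
          ... | inj₁ (_ , e , _) = ⊥-elim (a≢u (trans (sym pd) e))
          ... | inj₂ (inj₁ (refl , _)) = ⊥-elim (a≢q (trans (sym pd) pu))
          ... | inj₂ (inj₂ (inj₁ (refl , _))) = ⊥-elim (inner≢0 na (trans (sym pd) (fresh _ ≤-refl)))
          ... | inj₂ (inj₂ (inj₂ (_ , _ , _ , e))) = trans e pd
        outside' : ∀ v → k ≤ toℕ v → par₃ (leaf v) ≡ 0
        outside' v le with cases (leaf v)
        ... | inj₁ (m , _) = ⊥-elim (<⇒≱ (proj₂ (∈leaf m)) le)
        ... | inj₂ (inj₁ (e , _)) = ⊥-elim (u≢leaf v (sym e))
        ... | inj₂ (inj₂ (inj₁ (e , _))) = ⊥-elim (nx≢leaf v (sym e))
        ... | inj₂ (inj₂ (inj₂ (_ , _ , _ , e))) = trans e (outside v le)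

  -- Best sequences of joins and unions

  -- Nothing is required of the link out of the last vertex. Lists need no end marker, and stale
  -- links do no harm.
  data Seg (nx : ℕ → ℕ) : ℕ → ℕ → List (Fin n) → Set where
    last : ∀ {v} → Seg nx (leaf v) (leaf v) (v ∷ [])
    link : ∀ {v h t L} → nx (leaf v) ≡ h → Seg nx h t L → Seg nx (leaf v) t (v ∷ L)

  seg-head : ∀ {nx h t L} → Seg nx h t L → ∃[ v ] (v ∈ L × h ≡ leaf v)
  seg-head last = _ , here refl , refl
  seg-head (link _ _) = _ , here refl , refl

  seg-last : ∀ {nx h t L} → Seg nx h t L → ∃[ v ] (v ∈ L × t ≡ leaf v)
  seg-last last = _ , here refl , refl
  seg-last (link _ s) with seg-last s
  ... | v , m , e = v , there m , e

  seg-frame : ∀ {nx nx' h t L} → (∀ {v} → v ∈ L → nx' (leaf v) ≡ nx (leaf v)) → Seg nx h t L → Seg nx' h t L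
  seg-frame f last = last
  seg-frame f (link e s) = link (trans (f (here refl)) e) (seg-frame (λ m → f (there m)) s)

  -- Redirecting the link of the last vertex `t` must not touch an earlier cell, which holds because
  -- no vertex is repeated.
  seg-append : ∀ {nx nx' h t h' t' L L'} → Unique L → Seg nx h t L → Seg nx' h' t' L' → nx' t ≡ h' →
    (∀ {v} → v ∈ L → leaf v ≢ t → nx' (leaf v) ≡ nx (leaf v)) → Seg nx' h t' (L ++ L')
  seg-append u last s' e f = link e s'
  seg-append u (link {v} e₁ s) s' e f = link (trans (f (here refl) ne) e₁) (seg-append (unique-tail u) s s' e (λ m → f (there m)))
    where
    ne : leaf v ≢ _
    ne e' with seg-last s
    ... | w , m , e'' = unique-head u (subst (_∈ _) (sym (leaf-injective (trans e' e''))) m)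

  record Best (X : Fin n → Set) (nx : ℕ → ℕ) (g i h t : ℕ) : Set where
    field
      L     : List (Fin n)
      legal : Legal X L
      len   : length L ≡ g
      max   : Max X g
      flag  : IsoFlag X i
      seg   : Seg nx h t L

    some : ∃[ v ] (X v × h ≡ leaf v)
    some with seg-head seg
    ... | v , m , e = v , legal-⊆ legal m , e

    h≢0 : h ≢ 0
    h≢0 e with some
    ... | v , _ , e' = 1+n≢0 (trans (sym e') e)

    g≤n : g ≤ n
    g≤n = ≤-trans (≤-reflexive (sym len)) (≤-trans (length≤∣∣ (legal-unique legal) (λ _ → ∈⊤)) (∣p∣≤n ⊤ₛ))

    i≤1 : i ≤ 1
    i≤1 with flag
    ... | inj₁ (refl , _) = ≤-refl
    ... | inj₂ (refl , _) = z≤n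

  best-map : ∀ {X Z nx g i h t} → (∀ {v} → X v → Z v) → (∀ {v} → Z v → X v) → Best X nx g i h t → Best Z nx g i h t
  best-map {X} {Z} f f⁻ b = record { L = L ; legal = legal-mono f legal ; len = len ; max = λ S l → max S (legal-mono f⁻ l) ; flag = fl flag ; seg = seg }
    where
    open Best b
    fl : ∀ {i} → IsoFlag X i → IsoFlag Z i
    fl (inj₁ (e , w , xw , iw)) = inj₁ (e , w , f xw , λ v z → iw v (f⁻ z))
    fl (inj₂ (e , h)) = inj₂ (e , λ u z → let (w , xw , a) = h u (f⁻ z) in w , f xw , a)

  best-frame : ∀ {X nx nx' g i h t} → (∀ {v} → X v → nx' (leaf v) ≡ nx (leaf v)) → Best X nx g i h t → Best X nx' g i h t
  best-frame f b = record { Best b ; seg = seg-frame (λ m → f (legal-⊆ (Best.legal b) m)) (Best.seg b) }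

  module _ {X Y Z : Fin n → Set} (Z⇒ : ∀ {v} → Z v → X v ⊎ Y v) (X⇒ : ∀ {v} → X v → Z v) (Y⇒ : ∀ {v} → Y v → Z v) where

    -- The list of `Y` is put in front: one new link at its end `t'` suffices, and the end of the
    -- result is still `t`.
    best-union : ∀ {nx g i h t g' i' h' t' i''} → Nonadjacent X Y → Best X nx g i h t → Best Y nx g' i' h' t' →
      (i' ≢ 0 → i'' ≡ 1) → (i' ≡ 0 → i'' ≡ i) → Best Z (nx [ t' ↦ h ]) (g + g') i'' h' t
    best-union {nx} {g} {h = h} {g' = g'} {t' = t'} na b b' k₁ k₀ = record
      { L = L b' ++ L b
      ; legal = legal-union Y⇒ X⇒ (nonadjacent-sym na) (legal b') (legal b)
      ; len = trans (length-++ (L b')) (trans (cong₂ _+_ (len b') (len b)) (+-comm g' g))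
      ; max = max-union Z⇒ na (max b) (max b')
      ; flag = iso-union (λ z → [ inj₂ , inj₁ ]′ (Z⇒ z)) Y⇒ X⇒ (nonadjacent-sym na) (flag b') (flag b) k₁ k₀
      ; seg = seg-append (legal-unique (legal b')) (seg b')
          (seg-frame (λ m → update-neq nx t' (λ e → in-both m e)) (seg b)) (update-eq nx t' refl) (λ _ ne → update-neq nx t' (ne ∘ sym)) }
      where
      open Best
      in-both : ∀ {v} → v ∈ L b → t' ≢ leaf v
      in-both m e with seg-last (seg b')
      ... | w , mw , e' = proj₁ (na (legal-⊆ (legal b) m) (legal-⊆ (legal b') mw)) (leaf-injective (trans (sym e) e'))

  -- Only the better side is kept; if it has a vertex isolated in its own side,
  -- then one more vertex of the other side still fits at the end.
  module _ {X Y Z : Fin n → Set} (Z⇒ : ∀ {v} → Z v → X v ⊎ Y v) (X⇒ : ∀ {v} → X v → Z v) (Y⇒ : ∀ {v} → Y v → Z v) (jn : Joined X Y)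
    {nx : ℕ → ℕ} {g i h t g' i' h' t' : ℕ} (b : Best X nx g i h t) (b' : Best Y nx g' i' h' t') (better : g' + i' ≤ g + i) where
    open Best

    max-join-better : Max Z (g + i)
    max-join-better = max-join Z⇒ jn (max b) (flag b) (max b') (flag b') ≤-refl better

    iso-zero : IsoFlag Z 0
    iso-zero with some b | some b'
    ... | v , xv , _ | w , yw , _ = iso-join Z⇒ X⇒ Y⇒ jn (v , xv) (w , yw)

    best-join-keep : i ≡ 0 → Best Z nx g i h t
    best-join-keep refl = record { L = L b ; legal = legal-mono X⇒ (legal b) ; len = len b
      ; max = λ S l → ≤-trans (max-join-better S l) (≤-reflexive (+-identityʳ g)) ; flag = iso-zero ; seg = seg b }

    best-join-extend : i ≢ 0 → Best Z (nx [ h' ↦ h ]) (g + 1) 0 h' t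
    best-join-extend ne with flag b
    ... | inj₂ (e , _) = ⊥-elim (ne e)
    ... | inj₁ (refl , w , iw) with some b'
    ... | y , yy , e = record { L = y ∷ L b ; legal = legal-join X⇒ Y⇒ jn (legal b) iw yy ; len = trans (cong suc (len b)) (+-comm 1 g)
      ; max = max-join-better ; flag = iso-zero
      ; seg = subst (λ a → Seg (nx [ h' ↦ h ]) a t (y ∷ L b)) (sym e) (link (update-eq nx h' e)
          (seg-frame (λ m → update-neq nx h' (λ e' → ~-irrefl y (subst (_~ y) (leaf-injective (trans (sym e') e)) (jn (legal-⊆ (legal b) m) yy)))) (seg b))) }

  best-leaf : ∀ {X nx} v → X v → (∀ {w} → X w → w ≡ v) → Best X nx 1 1 (leaf v) (leaf v)
  best-leaf {X} v xv only = record { L = v ∷ [] ; legal = add xv (λ ()) xv (dominates-self v) z≤n [] ; len = refl ; max = mx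
    ; flag = inj₁ (refl , v , xv , λ w xw a → ~-irrefl v (subst (v ~_) (only xw) a)) ; seg = last }
    where
    mx : Max X 1
    mx [] l = z≤n
    mx (a ∷ []) l = s≤s z≤n
    mx (a ∷ b ∷ S) (add xa a∉ _ _ _ l) = ⊥-elim (a∉ (here (trans (only xa) (sym (only (legal-⊆ l (here refl)))))))

  -- `own` assigns every vertex to the node whose record covers it at the moment; evaluation pushes
  -- this assignment upwards until all vertices belong to the root. The first alternative is a node
  -- that has received nothing so far.
  Slot : (Fin n → ℕ) → State → ℕ → Set
  Slot own σ a = (arrays σ hd a ≡ 0 × arrays σ gam a ≡ 0 × (∀ v → own v ≢ a))
    ⊎ Best (λ v → own v ≡ a) (arrays σ nxt) (arrays σ gam a) (arrays σ iso a) (arrays σ hd a) (arrays σ tl a)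

  Elsewhere : State → State → ℕ → Set
  Elsewhere σ τ p = ∀ b → p ≢ b → arrays τ hd b ≡ arrays σ hd b × arrays τ gam b ≡ arrays σ gam b × arrays τ iso b ≡ arrays σ iso b × arrays τ tl b ≡ arrays σ tl b

  best-≡ : ∀ {X nx g g' i i' h h' t t'} → g' ≡ g → i' ≡ i → h' ≡ h → t' ≡ t → Best X nx g i h t → Best X nx g' i' h' t'
  best-≡ refl refl refl refl b = b

  -- Merging a node into its parent

  module MergeStep (W : ℕ) (1≤W : 1 ≤ W) (n<W : n < W) (own own' : Fin n → ℕ) (σ : State)
    (p≢a : regs σ rP ≢ regs σ rA)
    (changed : ∀ {v} → own v ≡ regs σ rA → own' v ≡ regs σ rP) (unchanged : ∀ {v} → own v ≢ regs σ rA → own' v ≡ own v)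
    (slot-p : Slot own σ (regs σ rP))
    (best-a : Best (λ v → own v ≡ regs σ rA) (arrays σ nxt) (arrays σ gam (regs σ rA)) (arrays σ iso (regs σ rA)) (arrays σ hd (regs σ rA)) (arrays σ tl (regs σ rA)))
    (join : arrays σ type (regs σ rP) ≢ 0 → Joined (λ v → own v ≡ regs σ rP) (λ v → own v ≡ regs σ rA))
    (union : arrays σ type (regs σ rP) ≡ 0 → Nonadjacent (λ v → own v ≡ regs σ rP) (λ v → own v ≡ regs σ rA)) where

    p = regs σ rP
    a = regs σ rA

    X Y Z : Fin n → Set
    X v = own v ≡ p
    Y v = own v ≡ a
    Z v = own' v ≡ p

    Z⇒ : ∀ {v} → Z v → X v ⊎ Y v
    Z⇒ {v} z with own v ≟ a
    ... | yes e = inj₂ e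
    ... | no ne = inj₁ (trans (sym (unchanged ne)) z)

    X⇒ : ∀ {v} → X v → Z v
    X⇒ x = trans (unchanged (λ e → p≢a (trans (sym x) e))) x

    Y⇒ : ∀ {v} → Y v → Z v
    Y⇒ = changed

    Post : State → Set
    Post τ = ∀ b → b ≢ a → Slot own σ b → Slot own' τ b

    post : ∀ {τ} → Best Z (arrays τ nxt) (arrays τ gam p) (arrays τ iso p) (arrays τ hd p) (arrays τ tl p) → Elsewhere σ τ p →
      (∀ v → ¬ Z v → arrays τ nxt (leaf v) ≡ arrays σ nxt (leaf v)) → Post τ
    post {τ} bz els nx b b≢a s with p ≟ b
    ... | yes refl = inj₂ bz
    ... | no p≢b with els b p≢b | s
    ...   | eh , eg , ei , et | inj₁ (h0 , g0 , none) = inj₁ (trans eh h0 , trans eg g0 , none')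
      where
      none' : ∀ v → own' v ≢ b
      none' v e with own v ≟ a
      ... | yes y = p≢b (trans (sym (changed y)) e)
      ... | no ne = none v (trans (sym (unchanged ne)) e)
    ...   | eh , eg , ei , et | inj₂ bb = inj₂ (best-≡ eg ei eh et (best-map f f⁻ (best-frame (λ {v} e → nx v (λ z → p≢b (trans (sym z) (f e)))) bb)))
      where
      f : ∀ {v} → own v ≡ b → own' v ≡ b
      f e = trans (unchanged (λ y → b≢a (trans (sym e) y))) e
      f⁻ : ∀ {v} → own' v ≡ b → own v ≡ b
      f⁻ {v} e with own v ≟ a
      ... | yes y = ⊥-elim (p≢b (trans (sym (changed y)) e))
      ... | no ne = trans (sym (unchanged ne)) e

    elsewhere-update : ∀ (f : ℕ → ℕ) {c} b → p ≢ b → (f [ p ↦ c ]) b ≡ f b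
    elsewhere-update f b ne = update-neq f p ne

    exec-copy : arrays σ hd p ≡ 0 → wp W copyP Post σ
    exec-copy z = tt , tt , tt , tt , tt , tt , tt , tt ,
      post {τ} (best-≡ (update-eq (arrays σ gam) p refl) (update-eq (arrays σ iso) p refl) (update-eq (arrays σ hd) p refl) (update-eq (arrays σ tl) p refl)
        (best-map Y⇒ Z⇒Y best-a)) (λ b ne → elsewhere-update (arrays σ hd) b ne , elsewhere-update (arrays σ gam) b ne , elsewhere-update (arrays σ iso) b ne , elsewhere-update (arrays σ tl) b ne) (λ _ _ → refl)
      where
      τ = setCell iso p (arrays σ iso a) (setCell gam p (arrays σ gam a) (setCell tl p (arrays σ tl a) (setCell hd p (arrays σ hd a) σ)))
      Z⇒Y : ∀ {v} → Z v → Y v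
      Z⇒Y {v} zv = pick slot-p (Z⇒ zv)
        where
        pick : Slot own σ p → X v ⊎ Y v → Y v
        pick _ (inj₂ y) = y
        pick (inj₁ (_ , _ , none)) (inj₁ x) = ⊥-elim (none _ x)
        pick (inj₂ b) (inj₁ x) = ⊥-elim (Best.h≢0 b z)

    best-p : arrays σ hd p ≢ 0 → Best X (arrays σ nxt) (arrays σ gam p) (arrays σ iso p) (arrays σ hd p) (arrays σ tl p)
    best-p ne = pick slot-p
      where
      pick : Slot own σ p → _
      pick (inj₁ (z , _)) = ⊥-elim (ne z)
      pick (inj₂ b) = b

    exec-union : arrays σ hd p ≢ 0 → arrays σ type p ≡ 0 → wp W unionP Post σ
    exec-union ne t = tt , tt , tt , tt , tt , (tt , tt , gg≤W) , tt ,
        (λ nz → tt , z≤n′ , fin (setCell iso p 1 τ) (update-eq (arrays σ iso) p refl) (λ _ → refl) (λ z → ⊥-elim (nz z)) (λ b ne → elsewhere-update (arrays σ iso) b ne) refl) ,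
        (λ z → fin τ refl (λ nz → ⊥-elim (nz z)) (λ _ → refl) (λ _ _ → refl) refl)
      where
      b = best-p ne
      z≤n′ = 1≤W
      nx₁ = arrays σ nxt [ arrays σ tl a ↦ arrays σ hd p ]
      τ = setCell gam p (arrays σ gam p + arrays σ gam a) (setCell hd p (arrays σ hd a) (setCell nxt (arrays σ tl a) (arrays σ hd p) σ))
      bz : ∀ {i''} → (arrays σ iso a ≢ 0 → i'' ≡ 1) → (arrays σ iso a ≡ 0 → i'' ≡ arrays σ iso p) → Best Z nx₁ (arrays σ gam p + arrays σ gam a) i'' (arrays σ hd a) (arrays σ tl p)
      bz k₁ k₀ = best-union Z⇒ X⇒ Y⇒ (union t) b best-a k₁ k₀
      gg≤W : arrays σ gam p + arrays σ gam a ≤ W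
      -- The sum is the length of a sequence of distinct vertices and thus at most `n`. Since the
      -- bound is due before the flag is computed, `if0` anticipates the value of the flag.
      gg≤W = ≤-trans (Best.g≤n (bz {if0 (arrays σ iso a) (arrays σ iso p)} (λ nz → if0-nz nz) (λ z → if0-z z))) (<⇒≤ n<W)
        where
        if0 : ℕ → ℕ → ℕ
        if0 zero k = k
        if0 (suc _) k = 1
        if0-nz : ∀ {m k} → m ≢ 0 → if0 m k ≡ 1
        if0-nz {zero} nz = ⊥-elim (nz refl)
        if0-nz {suc m} nz = refl
        if0-z : ∀ {m k} → m ≡ 0 → if0 m k ≡ k
        if0-z refl = refl
      fin : ∀ τ' {i''} → arrays τ' iso p ≡ i'' → (arrays σ iso a ≢ 0 → i'' ≡ 1) → (arrays σ iso a ≡ 0 → i'' ≡ arrays σ iso p) → (∀ b → p ≢ b → arrays τ' iso b ≡ arrays σ iso b) →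
        (arrays τ' nxt , arrays τ' hd , arrays τ' gam , arrays τ' tl) ≡ (arrays τ nxt , arrays τ hd , arrays τ gam , arrays τ tl) → Post τ'
      fin τ' refl k₁ k₀ ei e with cong proj₁ e | cong (proj₁ ∘ proj₂) e | cong (proj₁ ∘ proj₂ ∘ proj₂) e | cong (proj₂ ∘ proj₂ ∘ proj₂) e
      ... | en | eh | eg | et = post {τ'} (subst (λ f → Best Z f (arrays τ' gam p) (arrays τ' iso p) (arrays τ' hd p) (arrays τ' tl p)) (sym en) (best-≡ (trans (cong (λ f → f p) eg) (update-eq (arrays σ gam) p refl)) refl
              (trans (cong (λ f → f p) eh) (update-eq (arrays σ hd) p refl)) (cong (λ f → f p) et) (bz k₁ k₀)))
          (λ b ne → trans (cong (λ f → f b) eh) (elsewhere-update (arrays σ hd) b ne) , trans (cong (λ f → f b) eg) (elsewhere-update (arrays σ gam) b ne) , ei b ne , cong (λ f → f b) et)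
          (λ v nz → trans (cong (λ f → f (leaf v)) en) (update-neq (arrays σ nxt) (arrays σ tl a) (λ e' → nz (in-a e'))))
        where
        in-a : ∀ {v} → arrays σ tl a ≡ leaf v → Z v
        in-a e' with seg-last (Best.seg best-a)
        ... | w , m , e'' = Y⇒ (subst Y (leaf-injective (trans (sym e'') e')) (legal-⊆ (Best.legal best-a) m))

    -- What holds after `chooseP`, whichever side won: `X'` is the side whose sequence is kept and
    -- `Y'` the other one, so the extension is verified only once.
    record Kept (τ : State) : Set₁ where
      field
        X' Y' : Fin n → Set
        Z⇒' : ∀ {v} → Z v → X' v ⊎ Y' v
        X⇒' : ∀ {v} → X' v → Z v
        Y⇒' : ∀ {v} → Y' v → Z v
        jn  : Joined X' Y'
        g' i' t' : ℕ
        kept  : Best X' (arrays τ nxt) (arrays τ gam (regs τ rP)) (arrays τ iso (regs τ rP)) (arrays τ hd (regs τ rP)) (arrays τ tl (regs τ rP))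
        other : Best Y' (arrays τ nxt) g' i' (regs τ rE) t'
        better : g' + i' ≤ arrays τ gam (regs τ rP) + arrays τ iso (regs τ rP)
        els   : Elsewhere σ τ p
        same-nxt : arrays τ nxt ≡ arrays σ nxt
        same-p : regs τ rP ≡ p

    wp-extend : ∀ τ → Kept τ → wp W extendP Post τ
    wp-extend τ K = tt ,
        (λ nz → tt , tt , tt , tt , tt , (tt , 1≤W , ≤-trans (Best.g≤n (ext nz)) (<⇒≤ n<W)) , tt , z≤n , done-ext nz) ,
        (λ z → post {τ} (at-p {τ} (best-join-keep Z⇒' X⇒' Y⇒' jn kept other better z)) els (λ v _ → cong (λ f → f (leaf v)) same-nxt))
      where
      open Kept K
      q = regs τ rP
      at-p : ∀ {τ'} → Best Z (arrays τ' nxt) (arrays τ' gam q) (arrays τ' iso q) (arrays τ' hd q) (arrays τ' tl q) →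
        Best Z (arrays τ' nxt) (arrays τ' gam p) (arrays τ' iso p) (arrays τ' hd p) (arrays τ' tl p)
      at-p {τ'} = subst (λ q → Best Z (arrays τ' nxt) (arrays τ' gam q) (arrays τ' iso q) (arrays τ' hd q) (arrays τ' tl q)) same-p
      ext : arrays τ iso q ≢ 0 → Best Z (arrays τ nxt [ regs τ rE ↦ arrays τ hd q ]) (arrays τ gam q + 1) 0 (regs τ rE) (arrays τ tl q)
      ext = best-join-extend Z⇒' X⇒' Y⇒' jn kept other better
      τ₁ : State
      τ₁ = setCell iso q 0 (setCell gam q (arrays τ gam q + 1) (setCell hd q (regs τ rE) (setCell nxt (regs τ rE) (arrays τ hd q) τ)))
      q≢ : ∀ {b} → p ≢ b → q ≢ b
      q≢ ne e = ne (trans (sym same-p) e)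
      done-ext : arrays τ iso q ≢ 0 → Post τ₁
      done-ext nz = post {τ₁} (at-p {τ₁} (best-≡ (update-eq (arrays τ gam) q refl) (update-eq (arrays τ iso) q refl) (update-eq (arrays τ hd) q refl) refl (ext nz)))
        (λ b ne → let (eh , eg , ei , et) = els b ne in trans (update-neq (arrays τ hd) q (q≢ ne)) eh , trans (update-neq (arrays τ gam) q (q≢ ne)) eg
                , trans (update-neq (arrays τ iso) q (q≢ ne)) ei , et)
        (λ v nz' → trans (update-neq (arrays τ nxt) (regs τ rE) (λ e → nz' (in-z e))) (cong (λ f → f (leaf v)) same-nxt))
        where
        in-z : ∀ {v} → regs τ rE ≡ leaf v → Z v
        in-z e with Best.some other
        ... | w , yw , e' = Y⇒' (subst Y' (leaf-injective (trans (sym e') e)) yw)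

    exec-join : arrays σ hd p ≢ 0 → arrays σ type p ≢ 0 → wp W joinP Post σ
    exec-join ne t = ((tt , tt , bound best-a) , (tt , tt , bound b)) ,
        (λ nz → tt , tt , tt , tt , tt , tt , tt , tt , tt , wp-extend τ₁ (take-a nz)) ,
        (λ z → tt , wp-extend (setReg rE (arrays σ hd a) σ) (record
          { X' = X ; Y' = Y ; Z⇒' = Z⇒ ; X⇒' = X⇒ ; Y⇒' = Y⇒ ; jn = join t ; kept = b ; other = best-a ; better = m∸n≡0⇒m≤n z
          ; els = λ _ _ → refl , refl , refl , refl ; same-nxt = refl ; same-p = refl }))
      where
      b = best-p ne
      bound : ∀ {X nx g i h t} → Best X nx g i h t → g + i ≤ W
      bound b = ≤-trans (+-mono-≤ (Best.g≤n b) (Best.i≤1 b)) (≤-trans (≤-reflexive (+-comm n 1)) n<W)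
      τ₁ : State
      τ₁ = setCell iso p (arrays σ iso a) (setCell gam p (arrays σ gam a) (setCell tl p (arrays σ tl a) (setCell hd p (arrays σ hd a) (setReg rE (arrays σ hd p) σ))))
      take-a : (arrays σ gam a + arrays σ iso a) ∸ (arrays σ gam p + arrays σ iso p) ≢ 0 → Kept τ₁
      take-a nz = record
        { X' = Y ; Y' = X ; Z⇒' = λ z → [ inj₂ , inj₁ ]′ (Z⇒ z) ; X⇒' = Y⇒ ; Y⇒' = X⇒ ; jn = λ y x → ~-sym (join t x y)
        ; kept = best-≡ eg ei (update-eq (arrays σ hd) p refl) (update-eq (arrays σ tl) p refl) best-a
        ; other = b ; better = ≤-trans (<⇒≤ (≰⇒> (λ le → nz (m≤n⇒m∸n≡0 le)))) (≤-reflexive (sym (cong₂ _+_ eg ei)))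
        ; els = λ b ne → update-neq (arrays σ hd) p ne , update-neq (arrays σ gam) p ne , update-neq (arrays σ iso) p ne , update-neq (arrays σ tl) p ne
        ; same-nxt = refl ; same-p = refl }
        where
        eg : (arrays σ gam [ p ↦ arrays σ gam a ]) p ≡ arrays σ gam a
        eg = update-eq (arrays σ gam) p refl
        ei : (arrays σ iso [ p ↦ arrays σ iso a ]) p ≡ arrays σ iso a
        ei = update-eq (arrays σ iso) p refl

    wp-merge : wp W mergeP Post σ
    wp-merge = tt , (λ ne → tt , (λ t → exec-join ne t) , (λ t → exec-union ne t)) , exec-copy


    exec-merge : Exec W mergeP σ (time mergeP) Post
    exec-merge = wp-sound mergeP {Post} σ wp-merge

  -- The size of the input

  module Sizes (A : AdjacencyLists G) where
    open AdjacencyLists A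

    deg : Fin n → ℕ
    deg v = length (neighbours v)

    degrees : List (Fin n) → ℕ
    degrees [] = 0
    degrees (v ∷ vs) = deg v + degrees vs

    arcs : List (Fin n) → List (Fin n × Fin n)
    arcs [] = []
    arcs (v ∷ vs) = map (v ,_) (neighbours v) ++ arcs vs

    length-arcs : ∀ vs → length (arcs vs) ≡ degrees vs
    length-arcs [] = refl
    length-arcs (v ∷ vs) = trans (length-++ (map (v ,_) (neighbours v))) (cong₂ _+_ (length-map (v ,_) (neighbours v)) (length-arcs vs))

    arc-∈ : ∀ vs {v u} → (v , u) ∈ arcs vs → v ∈ vs × v ~ u
    arc-∈ (w ∷ vs) m with ∈-++⁻ (map (w ,_) (neighbours w)) m
    ... | inj₂ m' = let (p , q) = arc-∈ vs m' in there p , q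
    ... | inj₁ m' with ∈-map⁻ (w ,_) m'
    ...   | u , mu , refl = here refl , Equivalence.to (correct w u) mu

    arcs-unique : ∀ {vs} → Unique vs → Unique (arcs vs)
    arcs-unique {[]} u = []
    arcs-unique {v ∷ vs} u = Uniqueₚ.++⁺ (Uniqueₚ.map⁺ (λ e → cong proj₂ e) (unique v)) (arcs-unique (unique-tail u)) disjoint
      where
      disjoint : ∀ {a} → ¬ (a ∈ map (v ,_) (neighbours v) × a ∈ arcs vs)
      disjoint (m , m') with ∈-map⁻ (v ,_) m
      ... | w , _ , refl = unique-head u (proj₁ (arc-∈ vs m'))

    up? : (a : Fin n × Fin n) → Dec (proj₁ a FinB.< proj₂ a)
    up? (u , v) = u Fin.<? v

    down? : (a : Fin n × Fin n) → Dec (proj₂ a FinB.< proj₁ a)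
    down? (u , v) = v Fin.<? u

    forward backward : List (Fin n × Fin n) → List (Fin n × Fin n)
    forward l = filter up? l
    backward l = map swap (filter down? l)

    forward-backward : ∀ l → (∀ {u v} → (u , v) ∈ l → u ~ v) → length l ≤ length (forward l) + length (backward l)
    forward-backward [] h = z≤n
    forward-backward ((u , v) ∷ l) h with Fin.<-cmp u v
    ... | tri≈ _ refl _ = ⊥-elim (~-irrefl u (h (here refl)))
    ... | tri< lt _ ngt = ≤-trans (s≤s (forward-backward l (λ m → h (there m)))) (≤-reflexive
            (sym (cong₂ (λ f b → length f + length (map swap b)) (filter-accept up? {u , v} {l} lt) (filter-reject down? {u , v} {l} ngt))))
    ... | tri> nlt _ gt = ≤-trans (s≤s (forward-backward l (λ m → h (there m)))) (≤-trans (≤-reflexive (sym (+-suc (length (forward l)) _))) (≤-reflexive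
            (sym (cong₂ (λ f b → length f + length (map swap b)) (filter-reject up? {u , v} {l} nlt) (filter-accept down? {u , v} {l} gt)))))

    ∈-edges : ∀ {u v} → u FinB.< v → u ~ v → (u , v) ∈ edges
    ∈-edges {u} {v} lt a = ∈-filter⁺ (λ (u , v) → (u Fin.<? v) ×-dec (u ~? v)) (∈-cartesianProduct⁺ (∈-allFin u) (∈-allFin v)) (lt , a)

    -- Entries of adjacency lists are arcs. Those leading to a larger vertex inject into the edge
    -- list, and those leading to a smaller one do so after a swap.
    handshake : degrees (allFin n) ≤ ∣E∣ + ∣E∣
    handshake = ≤-trans (≤-reflexive (sym (length-arcs (allFin n)))) (≤-trans (forward-backward l adjacent) (+-mono-≤
        (unique-⊆-length (Uniqueₚ.filter⁺ up? l-unique) fwd)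
        (unique-⊆-length (Uniqueₚ.map⁺ (λ { refl → refl }) (Uniqueₚ.filter⁺ down? l-unique)) bwd)))
      where
      l = arcs (allFin n)
      l-unique : Unique l
      l-unique = arcs-unique (Uniqueₚ.allFin⁺ n)
      adjacent : ∀ {u v} → (u , v) ∈ l → u ~ v
      adjacent m = proj₂ (arc-∈ (allFin n) m)
      fwd : ∀ {a} → a ∈ forward l → a ∈ edges
      fwd m with ∈-filter⁻ up? {xs = l} m
      ... | m' , lt = ∈-edges lt (adjacent m')
      bwd : ∀ {a} → a ∈ backward l → a ∈ edges
      bwd m with ∈-map⁻ swap m
      ... | (u , v) , m' , refl with ∈-filter⁻ down? {xs = l} m'
      ...   | m'' , lt = ∈-edges lt (~-sym (adjacent m''))

    length-blocks : ∀ vs → length (concatMap (λ v → deg v ∷ map toℕ (neighbours v)) vs) ≡ length vs + degrees vs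
    length-blocks [] = refl
    length-blocks (v ∷ vs) = cong suc (trans (length-++ (map toℕ (neighbours v))) (trans (cong₂ _+_ (length-map toℕ (neighbours v)) (length-blocks vs)) (lem (deg v) (length vs) (degrees vs))))
      where
      lem : ∀ a b c → a + (b + c) ≡ b + (a + c)
      lem = solve-∀

    totalCost-linear : ∀ g c d vs → totalCost g (λ v → c + d * deg v) vs ≡ g + (g + c) * length vs + d * degrees vs
    totalCost-linear g c d [] = lem g c d
      where
      lem : ∀ g c d → g ≡ g + (g + c) * 0 + d * 0
      lem = solve-∀
    totalCost-linear g c d (v ∷ vs) = trans (cong (g + (c + d * deg v) +_) (totalCost-linear g c d vs)) (lem g c d (deg v) (length vs) (degrees vs))
      where
      lem : ∀ g c d x l s → g + (c + d * x) + (g + (g + c) * l + d * s) ≡ g + (g + c) * suc l + d * (x + s)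
      lem = solve-∀

    all≡n : length (allFin n) ≡ n
    all≡n = length-tabulate (λ i → i)

    -- Collecting terms gives the constant 264 and the coefficients 2224 for the vertices and 2200
    -- for the edges, where the sum of the degrees counts each edge twice; 4688 is the sum of the
    -- three.
    running-time-≤ : (40 + 40 * M) + (totalCost 4 (λ v → 1100 + 1100 * deg v) (allFin n) + (100 + 1000 * n)) ≤ 4688 * (1 + size G)
    running-time-≤ = ≤-trans (+-monoʳ-≤ (40 + 40 * M) (+-monoˡ-≤ (100 + 1000 * n) (≤-trans (≤-reflexive (totalCost-linear 4 1100 1100 (allFin n)))
        (+-mono-≤ {4 + 1104 * length (allFin n)} {4 + 1104 * n} (≤-reflexive (cong (λ k → 4 + 1104 * k) all≡n)) (*-monoʳ-≤ 1100 handshake)))))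
      (≤-trans (≤-reflexive (collect-terms 40 40 4 1104 1100 100 1000 n (Graph.∣E∣ G))) (linear-≤ 264 2224 2200 n (Graph.∣E∣ G)))

  module Bounded (cog : IsCograph G) (A : AdjacencyLists G) (W len : ℕ) (1≤W : 1 ≤ W) (n<W : n < W) (len≤W : len ≤ W)
    (M≤W : M ≤ W) (MM≤W : M * M ≤ W) where
    open AdjacencyLists A
    open Sizes A

    -- Closing the neighbours under full nodes

    module Closing {k nx : ℕ} {par typ cnt : ℕ → ℕ} (T : Cotree k 0 nx par typ) (nx≤M : nx ≤ M)
      (counts : ∀ p → cnt p ≡ occ par p (ids M))
      {Y : List ℕ} (Y-unique : Unique Y) (Y-leaf : ∀ {y} → y ∈ Y → y ≢ 0 × y ≤ n) where
      open Cotree T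

      -- `P` is the popped part of the queue, and the whole queue is `I`, the inner nodes pushed so
      -- far, in front of the starting nodes `Y`. Only popped children count in `done`, and an inner
      -- node is in `I` exactly if its count is complete.
      record Inv (τ : State) (I P : List ℕ) : Set where
        field
          par≡   : arrays τ parent ≡ par
          cnt≡   : arrays τ count ≡ cnt
          h≤t    : regs τ rH ≤ regs τ rTail
          popped : slice (arrays τ queue) (regs τ rH) ≡ P
          pushed : slice (arrays τ queue) (regs τ rTail) ≡ I ++ Y
          uniq   : Unique (I ++ Y)
          inner  : ∀ {i} → i ∈ I → n < i × i < nx
          done≡  : ∀ p → arrays τ done p ≡ occ par p P
          full   : ∀ {p} → p ∈ I → occ par p P ≡ cnt p
          open′  : ∀ {p} → n < p → p < nx → p ∉ I → occ par p P ≢ cnt p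
          order  : ∀ j → j < regs τ rTail → n < arrays τ queue j → ∀ c → par c ≡ arrays τ queue j → c ∈ slice (arrays τ queue) j

        P-unique : Unique P
        P-unique = subst Unique popped (slice-unique (arrays τ queue) h≤t (subst Unique (sym pushed) uniq))

        P⊆ : ∀ {c} → c ∈ P → c ∈ I ++ Y
        P⊆ {c} m = subst (c ∈_) pushed (slice-⊆ (arrays τ queue) h≤t (subst (c ∈_) (sym popped) m))

        node : ∀ {c} → c ∈ I ++ Y → c ≢ 0 × c < nx
        node m with ∈-++⁻ I m
        ... | inj₁ m' = inner≢0 (proj₁ (inner m')) , proj₂ (inner m')
        ... | inj₂ m' = proj₁ (Y-leaf m') , ≤-trans (s≤s (proj₂ (Y-leaf m'))) n<nx

        -- Double counting of popped nodes by their parents: twice the length of `I` is at most the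
        -- number of popped nodes, which is at most `length I + length Y`; then `length I` cancels.
        I≤Y : length I ≤ length Y
        I≤Y = +-cancelˡ-≤ (length I) _ _ (≤-trans (≤-reflexive (lem (length I))) (≤-trans
            (sumOver-≥ (λ p → occ par p P) I 2 λ {p} m → ≤-trans (two' p (inner m)) (≤-reflexive (sym (full m))))
            (≤-trans (sumOver-occ par I P (I-unique I uniq)) (≤-trans (≤-reflexive (trans (cong length (sym popped)) (length-slice (arrays τ queue) (regs τ rH))))
            (≤-trans h≤t (≤-reflexive (trans (sym (length-slice (arrays τ queue) (regs τ rTail))) (trans (cong length pushed) (length-++ I)))))))))
          where
          lem : ∀ a → a + a ≡ a * 2
          lem = solve-∀
          I-unique : ∀ I → Unique (I ++ Y) → Unique I
          I-unique [] u = []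
          I-unique (i ∷ I) u = unique-cons (λ m → unique-head u (∈-++⁺ˡ m)) (I-unique I (unique-tail u))
          two' : ∀ p → n < p × p < nx → 2 ≤ cnt p
          two' p (np , pn) with two p np pn
          ... | d , d' , ne , e , e' = ≤-trans (occ-two par p M
                (≤-trans (proj₂ (child-node e (inner≢0 np))) nx≤M) (≤-trans (proj₂ (child-node e' (inner≢0 np))) nx≤M) ne e e') (≤-reflexive (sym (counts p)))

        tail≤ : regs τ rTail ≤ length Y + length Y
        tail≤ = ≤-trans (≤-reflexive (trans (sym (length-slice (arrays τ queue) (regs τ rTail))) (trans (cong length pushed) (length-++ I)))) (+-monoˡ-≤ (length Y) I≤Y)

      -- The number of pops is not known in advance, so the fuel is its bound `length Y + length Y`,
      -- and `tail≤` shows that the queue is exhausted when the fuel is.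
      Loop : List ⊤ → State → Set
      Loop l τ = ∃[ I ] ∃[ P ] (Inv τ I P × regs τ rH + length l ≡ length Y + length Y)

      iterate : ∀ l τ → Loop (tt ∷ l) τ → regs τ rTail ∸ regs τ rH ≢ 0 → Exec W closeB τ (time closeB) (Loop l)
      iterate l τ (I , P , inv , fuel) guard = wp-sound closeB τ
        (tt , (tt , 1≤W , ≤-trans h<t (≤-trans t≤DM M≤W)) , tt , tt , (tt , 1≤W , ≤-trans (≤-trans (≤-reflexive (+-comm _ 1)) (≤-reflexive done-p)) (≤-trans occ≤M M≤W)) ,
         wp-ifEq {σ = σ₁} (done ! reg rP) (count ! reg rP) (queue [ reg rTail ]:= reg rP ⨾ rTail := reg rTail ⊕ const 1) skip {Loop l} tt tt push nopush)
        where
        open Inv inv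
        q = arrays τ queue
        h = regs τ rH
        t = regs τ rTail
        a = q h
        p = arrays τ parent a
        p≡ : p ≡ par a
        p≡ = cong (λ f → f a) par≡
        h<t : h + 1 ≤ t
        h<t = ≤-trans (≤-reflexive (+-comm h 1)) (≰⇒> (λ le → guard (m≤n⇒m∸n≡0 le)))
        sh≤t : suc h ≤ t
        sh≤t = ≤-trans (≤-reflexive (+-comm 1 h)) h<t
        P' = a ∷ P
        P'≡ : slice q (suc h) ≡ P'
        P'≡ = cong (a ∷_) popped
        P'-unique : Unique P'
        P'-unique = subst Unique P'≡ (slice-unique q sh≤t (subst Unique (sym pushed) uniq))
        P'⊆ : ∀ {c} → c ∈ P' → c ∈ I ++ Y
        P'⊆ {c} m = subst (c ∈_) pushed (slice-⊆ q sh≤t (subst (c ∈_) (sym P'≡) m))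
        P'<M : ∀ {c} → c ∈ P' → c < M
        P'<M m = ≤-trans (proj₂ (node (P'⊆ m))) nx≤M
        t≤DM : t ≤ M
        t≤DM = ≤-trans (≤-reflexive (trans (sym (length-slice q t)) (cong length pushed))) (length≤M uniq)
          where
          length≤M : ∀ {l} → Unique l → length (I ++ Y) ≤ M
          length≤M _ = ≤-trans (≤-reflexive (length-occ (I ++ Y))) (≤-trans (total-mono one (λ _ → 0) 0 uniq (λ m _ → ∈-ids M (≤-trans (proj₂ (node m)) nx≤M))) (occ-ids≤ (λ _ → 0) 0 M))
        occ-p : occ par p P' ≡ suc (occ par p P)
        occ-p = cong (_+ occ par p P) (weight-yes one par (sym p≡))
        done-p : suc (arrays τ done p) ≡ occ par p P'
        done-p = trans (cong suc (done≡ p)) (sym occ-p)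
        occ≤ : ∀ r → occ par r P' ≤ occ par r (ids M)
        occ≤ r = total-mono one par r P'-unique (λ m _ → ∈-ids M (P'<M m))
        occ≤M : occ par p P' ≤ M
        occ≤M = ≤-trans (occ≤ p) (occ-ids≤ par p M)
        done₁ = arrays τ done [ p ↦ arrays τ done p + 1 ]
        done₁≡ : ∀ r → done₁ r ≡ occ par r P'
        done₁≡ r with p ≟ r
        ... | yes refl = trans (update-eq (arrays τ done) p refl) (trans (+-comm _ 1) done-p)
        ... | no ne = trans (update-neq (arrays τ done) p ne) (trans (done≡ r) (sym (cong (_+ occ par r P) (weight-no one par (λ e → ne (trans p≡ e))))))
        fuel' : suc (h + length l) ≡ length Y + length Y
        fuel' = trans (sym (+-suc h (length l))) fuel
        full-kept : ∀ {r} → r ∈ I → occ par r P' ≡ cnt r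
        full-kept {r} m = ≤-antisym (≤-trans (occ≤ r) (≤-reflexive (sym (counts r)))) (≤-trans (≤-reflexive (sym (full m))) (m≤n+m _ (weight one par r a)))
        σ₁ = setCell done p (arrays τ done p + 1) (setReg rP p (setReg rH (h + 1) (setReg rA a τ)))
        push : done₁ p ≡ arrays τ count p → wp W (queue [ reg rTail ]:= reg rP ⨾ rTail := reg rTail ⊕ const 1) (Loop l) σ₁
        push e = tt , tt , (tt , 1≤W , ≤-trans (≤-trans (≤-reflexive (+-comm t 1)) t<M) M≤W) ,
          p ∷ I , P' , record
          { par≡ = par≡ ; cnt≡ = cnt≡ ; h≤t = ≤-trans h<t (m≤m+n t 1)
          ; popped = subst (λ j → slice q₁ j ≡ P') (+-comm 1 h) (trans (slice-ext (suc h) (λ i i<h → q₁-old (<-≤-trans i<h sh≤t))) P'≡)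
          ; pushed = subst (λ j → slice q₁ j ≡ p ∷ I ++ Y) (+-comm 1 t) (trans (slice-push q t p) (cong (p ∷_) pushed))
          ; uniq = uniq'
          ; inner = λ { (here refl) → p-inner ; (there m) → inner m }
          ; done≡ = done₁≡
          ; full = λ { (here refl) → occ≡cnt ; (there m) → full-kept m }
          ; open′ = open-kept
          ; order = order' }
          , trans (cong (_+ length l) (+-comm h 1)) fuel'
          where
          q₁ = q [ t ↦ p ]
          q₁-old : ∀ {i} → i < t → q₁ i ≡ q i
          q₁-old lt = update-neq q t (λ e → <⇒≢ lt (sym e))
          occ≡cnt : occ par p P' ≡ cnt p
          occ≡cnt = trans (sym (done₁≡ p)) (trans e (cong (λ f → f p) cnt≡))
          children : ∀ c → c < M → par c ≡ p → c ∈ P'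
          children = occ-full par p M P'-unique (trans occ≡cnt (counts p)) P'<M
          -- Node 0 counts among its own children but never enters the queue. Thus the root is never
          -- complete and the program needs no test for it.
          p≢0 : p ≢ 0
          p≢0 z = proj₁ (node (P'⊆ (children 0 (≤-trans (s≤s z≤n) (≤-trans n<nx nx≤M)) (trans par0 (sym z))))) refl
          p-inner : n < p × p < nx
          p-inner = parent-inner (sym p≡) p≢0
          p∉ : p ∉ I ++ Y
          p∉ m with ∈-++⁻ I m
          ... | inj₁ m' = 1+n≢n (trans (sym occ-p) (trans occ≡cnt (sym (full m'))))
          ... | inj₂ m' = <⇒≱ (proj₁ p-inner) (proj₂ (Y-leaf m'))
          uniq' : Unique (p ∷ I ++ Y)
          uniq' = unique-cons p∉ uniq
          t<M : suc t ≤ M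
          t<M = ≤-trans (≤-reflexive (cong suc (trans (sym (length-slice q t)) (cong length pushed)))) (≤-trans (≤-reflexive (length-occ (p ∷ I ++ Y)))
              (≤-trans (total-mono one (λ _ → 0) 0 uniq' (λ { (here refl) _ → ∈-ids M (≤-trans (proj₂ p-inner) nx≤M) ; (there m) _ → ∈-ids M (≤-trans (proj₂ (node m)) nx≤M) })) (occ-ids≤ (λ _ → 0) 0 M)))
          open-kept : ∀ {r} → n < r → r < nx → r ∉ p ∷ I → occ par r P' ≢ cnt r
          open-kept {r} nr rn m with p ≟ r
          ... | yes refl = ⊥-elim (m (here refl))
          ... | no ne = subst (_≢ cnt r) (sym (cong (_+ occ par r P) (weight-no one par (λ e → ne (trans p≡ e))))) (open′ nr rn (λ m' → m (there m')))
          order' : ∀ j → j < t + 1 → n < q₁ j → ∀ c → par c ≡ q₁ j → c ∈ slice q₁ j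
          order' j j<t nj c pc with t ≟ j
          ... | yes refl = subst (c ∈_) (sym (slice-ext t (λ i i<t → q₁-old i<t)))
                (slice-⊆ q sh≤t (subst (c ∈_) (sym P'≡) (children c (≤-trans (proj₂ (child-node pc' p≢0)) nx≤M) pc')))
            where pc' = trans pc (update-eq q t refl)
          ... | no ne = subst (c ∈_) (sym (slice-ext j (λ i i<j → q₁-old (<-trans i<j lt)))) (order j lt (subst (n <_) qj nj) c (trans pc qj))
            where
            lt : j < t
            lt = ≤∧≢⇒< (≤-pred (≤-trans j<t (≤-reflexive (+-comm t 1)))) (ne ∘ sym)
            qj : q₁ j ≡ q j
            qj = q₁-old lt
        nopush : done₁ p ≢ arrays τ count p → Loop l σ₁
        nopush ne = I , P' , record
          { par≡ = par≡ ; cnt≡ = cnt≡ ; h≤t = h<t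
          ; popped = subst (λ j → slice q j ≡ P') (+-comm 1 h) P'≡
          ; pushed = pushed ; uniq = uniq ; inner = inner ; done≡ = done₁≡
          ; full = full-kept ; open′ = open-kept ; order = order }
          , trans (cong (_+ length l) (+-comm h 1)) fuel'
          where
          open-kept : ∀ {r} → n < r → r < nx → r ∉ I → occ par r P' ≢ cnt r
          open-kept {r} nr rn m with p ≟ r
          ... | yes refl = λ e → ne (trans (done₁≡ p) (trans e (sym (cong (λ f → f p) cnt≡))))
          ... | no pr = subst (_≢ cnt r) (sym (cong (_+ occ par r P) (weight-no one par (λ e → pr (trans p≡ e))))) (open′ nr rn m)

      Closed′ : State → Set
      Closed′ τ = Closure n nx par Y D × (∀ p → arrays τ done p ≡ occ par p D) ×
          (∀ j → j < regs τ rTail → n < arrays τ queue j → ∀ c → par c ≡ arrays τ queue j → c ∈ slice (arrays τ queue) j)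
        where D = slice (arrays τ queue) (regs τ rTail)

      exec-close : ∀ σ → arrays σ parent ≡ par → arrays σ count ≡ cnt → (∀ p → arrays σ done p ≡ 0) →
        slice (arrays σ queue) (regs σ rTail) ≡ Y → Exec W closeP σ (10 + 60 * (length Y + length Y)) Closed′
      exec-close σ pe ce dz qe = exec-mono (exec-seq (wp-sound (rH := const 0) σ (z≤n ,
          exec-while {A = ⊤} Loop (reg rTail ⊖ reg rH) (λ _ → time closeB) (λ _ _ _ → tt , tt)
            (λ { τ (I , P , inv , e) → m≤n⇒m∸n≡0 (≤-trans (Inv.tail≤ inv) (≤-reflexive (trans (sym e) (+-identityʳ _)))) })
            (λ { tt l τ j g → iterate l τ j g }) (replicate (length Y + length Y) tt) _
            ([] , [] , init , length-replicate (length Y + length Y)))))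
        (≤-trans (≤-reflexive (cong (2 +_) (trans (totalCost-const 4 (time closeB) (replicate (length Y + length Y) tt)) (cong (λ t → 4 + (4 + time closeB) * t) (length-replicate (length Y + length Y))))))
          (+-mono-≤ {6} {10} (closed≤ 6 10) (*-monoˡ-≤ (length Y + length Y) (closed≤ (4 + time closeB) 60))))
        fin
        where
        init : Inv (setReg rH 0 σ) [] []
        init = record { par≡ = pe ; cnt≡ = ce ; h≤t = z≤n ; popped = refl ; pushed = qe ; uniq = Y-unique ; inner = λ ()
          ; done≡ = dz ; full = λ () ; open′ = λ {p} np pn _ e → two-pos p np pn e
          ; order = λ j j<t nj c pc → ⊥-elim (<⇒≱ nj (proj₂ (Y-leaf (subst (arrays σ queue j ∈_) qe (∈-slice j<t))))) }
          where
          two-pos : ∀ p → n < p → p < nx → 0 ≢ cnt p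
          two-pos p np pn e with two p np pn
          ... | d , _ , _ , pd , _ = <⇒≱ {0} (≤-trans (≤-reflexive (sym (weight-yes one par pd))) (weight≤total one par p (∈-ids M (≤-trans (proj₂ (child-node pd (inner≢0 np))) nx≤M)))) (≤-reflexive (sym (trans e (counts p))))
          ∈-slice : ∀ {f j t} → j < t → f j ∈ slice f t
          ∈-slice {f} {j} {suc t} lt with j ≟ t
          ... | yes refl = here refl
          ... | no ne = there (∈-slice (≤∧≢⇒< (≤-pred lt) ne))
        fin : ∀ τ → ∃[ l ] (Loop l τ × regs τ rTail ∸ regs τ rH ≡ 0) → Closed′ τ
        fin τ (l , (I , P , inv , _) , z) = subst (Closure n nx par Y) (sym pushed) clo , (λ p → trans (done≡ p) (cong (occ par p) (sym D≡P))) , order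
          where
          open Inv inv
          D≡P : slice (arrays τ queue) (regs τ rTail) ≡ P
          D≡P = trans (cong (slice (arrays τ queue)) (≤-antisym (m∸n≡0⇒m≤n z) h≤t)) popped
          P≡ : P ≡ I ++ Y
          P≡ = trans (sym D≡P) pushed
          P<M : ∀ {c} → c ∈ P → c < M
          P<M m = ≤-trans (proj₂ (node (P⊆ m))) nx≤M
          inI : ∀ {a} → n < a → a ∈ I ++ Y → a ∈ I
          inI na m with ∈-++⁻ I m
          ... | inj₁ m' = m'
          ... | inj₂ m' = ⊥-elim (<⇒≱ na (proj₂ (Y-leaf m')))
          clo : Closure n nx par Y (I ++ Y)
          clo .Closure.unique = uniq
          clo .Closure.start m = ∈-++⁺ʳ I m
          clo .Closure.kind m with ∈-++⁻ I m
          ... | inj₁ m' = inj₂ (inner m')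
          ... | inj₂ m' = inj₁ m'
          clo .Closure.down {a} {c} na m pc = subst (c ∈_) P≡ (occ-full par a M P-unique (trans (full (inI na m)) (counts a)) P<M c
            (≤-trans (proj₂ (child-node pc (inner≢0 na))) nx≤M) pc)
          clo .Closure.up {a} na an h with a ∈ℕ? I
          ... | yes m = ∈-++⁺ˡ m
          ... | no m = ⊥-elim (open′ na an m (≤-antisym (≤-trans (total-mono one par a P-unique (λ m _ → ∈-ids M (P<M m))) (≤-reflexive (sym (counts a))))
                (≤-trans (≤-reflexive (counts a)) (total-mono one par a (ids-unique M) (λ {c} _ pc → subst (c ∈_) (sym P≡) (h c pc))))))
          clo .Closure.small = ≤-trans (≤-reflexive (length-++ I)) (+-monoˡ-≤ (length Y) I≤Y)

    -- Running one insertion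

    CountedV : TreeView → Set
    CountedV V = (∀ p → cnt p ≡ occ par p (ids M)) × (∀ p → sm p ≡ total (λ i → i) par p (ids M))
      where open TreeView V

    record Chosen (x : Fin n) (k : ℕ) (V : TreeView) (f u : ℕ) : Set where
      open TreeView V
      field
        tree   : Cotree k 0 nx par typ
        closed : Closed nx par (Nbr x k) D
        uniq   : Unique D
        f∈D    : f ∈ D
        pf     : par f ≡ u
        u∉D    : u ∉ D
        lowest : ∀ {p g} → g ∈ D → par g ≡ p → p ∉ D → p ≢ 0 → par p ≢ u × par (par p) ≢ u
        counts : CountedV V

      D<M : nx ≤ M → ∀ {d} → d ∈ D → d < M
      D<M le m = ≤-trans (proj₂ (Closed.node closed m)) le

      total-D≤ : nx ≤ M → ∀ g p → total g par p D ≤ total g par p (ids M)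
      total-D≤ le g p = total-mono g par p uniq (λ m _ → ∈-ids M (D<M le m))

    Placed : Fin n → ℕ → ℕ → State → Set
    Placed x k b τ = Place x k (regs τ rZ) (regs τ rNx) (arrays τ parent) (arrays τ type) × Counted M τ
      × arrays τ type (arrays τ parent (regs τ rZ)) ≡ arrays τ type (regs τ rU) × regs τ rNx ≤ b

    module SplitStep (x : Fin n) (k : ℕ) (x≡k : toℕ x ≡ k) (σ : State) (nx<M : regs σ rNx < M)
      (ch : Chosen x k (treeView σ) (regs σ rF) (regs σ rU))
      (cC : regs σ rC ≡ occ (arrays σ parent) (regs σ rU) (TreeView.D (treeView σ)))
      (cK : regs σ rK ≡ arrays σ count (regs σ rU) ∸ regs σ rC)
      (cS : regs σ rS ≡ arrays σ sumOf (regs σ rU) ∸ total (λ i → i) (arrays σ parent) (regs σ rU) (TreeView.D (treeView σ))) where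
      open Chosen ch
      open TreeView (treeView σ)
      open Closed closed
      module T = Cotree tree
      u = regs σ rU
      f = regs σ rF
      module S = Splitting cog tree x x≡k closed f∈D pf u∉D lowest
      nx≤M = <⇒≤ nx<M
      u<M = ≤-trans S.u<nx nx≤M
      tg≢u : nx ≢ u
      tg≢u e = <⇒≢ S.u<nx (sym e)

      Goal : State → Set
      Goal = Placed x k (suc nx)

      union-single : typ u ≡ 0 → regs σ rC ∸ 1 ≡ 0 → wp W (rZ := reg rF) Goal σ
      union-single tu c1 = tt , S.place-child pf (proj₁ (node f∈D)) (λ t → ⊥-elim (0≢1+n (trans (sym tu) t))) (λ _ → f∈D)
          (λ {c} pc nc c≢f → (λ t → ⊥-elim (0≢1+n (trans (sym tu) t))) , λ _ m → <⇒≱ (occ-two∈ par u m f∈D c≢f pc pf) (≤-trans (≤-reflexive (sym cC)) (m∸n≡0⇒m≤n c1)))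
        , counts , cong typ pf , n≤1+n nx

      -- The children of `u` are `b` and the full ones. The difference of the sums is therefore the
      -- number of `b`, found without searching for it.
      join-single : typ u ≡ 1 → regs σ rK ∸ 1 ≡ 0 → wp W (rZ := reg rS) Goal σ
      join-single tu k1 = tt , subst (λ z → Place x k z nx par typ) (sym s≡) place , counts , trans (cong (typ ∘ par) s≡) (cong typ pb) , n≤1+n nx
        where
        u≢0 : u ≢ 0
        u≢0 e = 0≢1+n (trans (sym (trans (cong typ e) T.typ0)) tu)
        b∉ = S.L.child∉ (proj₁ (T.parent-inner pf u≢0)) S.u<nx u∉D
        b = proj₁ b∉
        pb = proj₁ (proj₂ b∉)
        b∉D = proj₂ (proj₂ b∉)
        b<M = ≤-trans (proj₂ (T.child-node pb u≢0)) nx≤M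
        few : occ par u (ids M) ≤ suc (occ par u D)
        few = ≤-trans (m≤n+m∸n (occ par u (ids M)) (occ par u D)) (≤-trans (+-monoʳ-≤ (occ par u D)
          (≤-trans (≤-reflexive (sym (trans cK (cong₂ _∸_ (proj₁ counts u) cC)))) (m∸n≡0⇒m≤n k1))) (≤-reflexive (+-comm _ 1)))
        only : ∀ {c} → par c ≡ u → c ≢ b → c ∈ D
        only {c} pc c≢b with c ∈ℕ? D
        ... | yes m = m
        ... | no m = ⊥-elim (<⇒≱ {suc (occ par u D)} (≤-trans (≤-reflexive (sym (cong₂ (λ p q → p + (q + occ par u D)) (weight-yes one par pc) (weight-yes one par pb))))
                (total-mono one par u {c ∷ b ∷ D} (unique-cons (λ { (here e) → c≢b e ; (there m') → m m' }) (unique-cons b∉D uniq))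
                  (λ { (here refl) _ → ∈-ids M (≤-trans (proj₂ (T.child-node pc u≢0)) nx≤M) ; (there (here refl)) _ → ∈-ids M b<M ; (there (there m')) _ → ∈-ids M (D<M nx≤M m') }))) few)
        all-sum : sm u ≡ b + total (λ i → i) par u D
        all-sum = trans (proj₂ counts u) (trans (≤-antisym
            (total-mono (λ i → i) par u {l' = b ∷ D} (ids-unique M) (λ {c} _ pc → sub c pc))
            (total-mono (λ i → i) par u {b ∷ D} (unique-cons b∉D uniq) (λ { (here refl) _ → ∈-ids M b<M ; (there m) _ → ∈-ids M (D<M nx≤M m) })))
            (cong (_+ total (λ i → i) par u D) (weight-yes (λ i → i) par pb)))
          where
          sub : ∀ c → par c ≡ u → c ∈ b ∷ D
          sub c pc with c ≟ b
          ... | yes refl = here refl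
          ... | no ne = there (only pc ne)
        s≡ : regs σ rS ≡ b
        s≡ = trans cS (trans (cong (_∸ total (λ i → i) par u D) all-sum) (m+n∸n≡m b (total (λ i → i) par u D)))
        place : Place x k b nx par typ
        place = S.place-child pb (proj₁ (T.child-node pb u≢0)) (λ _ → b∉D) (λ t → ⊥-elim (t tu)) (λ pc _ ne → (λ _ → only pc ne) , λ t → ⊥-elim (t tu))

      typ₁ : ℕ → ℕ
      typ₁ = typ [ nx ↦ typ u ]
      ty : ∀ a → a ≢ nx → typ₁ a ≡ typ a
      ty a ne = update-neq typ nx (ne ∘ sym)
      ty-nx : typ₁ nx ≡ typ u
      ty-nx = update-eq typ nx refl

      union-split : typ u ≡ 0 → regs σ rC ∸ 1 ≢ 0 →
        Exec W (openP ⨾ move rTg rU ⨾ rZ := reg rTg ⨾ forQueue transferB) σ (80 + 100 * regs σ rTail) Goal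
      union-split tu c1 = exec-mono (exec-bind {W = W} (wp-sound {W = W} openP {λ τ → τ ≡ σ₁} σ (tt , (tt , 1≤W , ≤-trans (≤-trans (≤-reflexive (+-comm nx 1)) nx<M) M≤W) , tt , tt , refl))
          (λ { τ _ refl → exec-bind (exec-move W 1≤W M M≤W MM≤W rTg rU σ₁ nx<M counts)
            (λ τ₂ fr₂ (pe₂ , cs₂) → exec-bind (wp-sound (rZ := reg rTg) {λ τ → τ ≡ setReg rZ (regs τ₂ rTg) τ₂} τ₂ (tt , refl))
              (λ { τ₃ _ refl → exec-mono (exec-frame (exec-transfer W 1≤W M M≤W MM≤W (setReg rZ (regs τ₂ rTg) τ₂)
                  (subst Unique (sym (D≡ fr₂)) uniq) (λ {d} m → D<M nx≤M (subst (d ∈_) (D≡ fr₂) m)) cs₂ (λ e → tg≢u (trans (sym (reg≡ fr₂ rTg)) (trans e (reg≡ fr₂ rU)))))) (≤-reflexive (cong (λ t → 4 + 100 * t) (reg≡ fr₂ rTail)))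
                (λ τ₄ (fr₄ , vals , cs₄) → finish τ₂ fr₂ pe₂ τ₄ fr₄ vals cs₄) })) }))
        (+-monoˡ-≤ (100 * regs σ rTail) (closed≤ (time openP + (40 + (2 + 4))) 80)) (λ _ q → q)
        where
        σ₁ = setCell type nx (typ u) (setReg rNx (nx + 1) (setReg rTg nx σ))
        D≡ : ∀ {τ} → Frame (move rTg rU) σ₁ τ → slice (arrays τ queue) (regs τ rTail) ≡ D
        D≡ fr = cong₂ slice (arr≡ fr queue) (reg≡ fr rTail)
        finish : ∀ τ₂ → Frame (move rTg rU) σ₁ τ₂ → arrays τ₂ parent ≡ par [ nx ↦ u ] → ∀ τ₄ → Frame (forQueue transferB) (setReg rZ (regs τ₂ rTg) τ₂) τ₄ → _ → Counted M τ₄ → Goal τ₄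
        finish τ₂ fr₂ pe₂ τ₄ fr₄ vals cs₄ = subst₂ (λ z nx' → Place x k z nx' (arrays τ₄ parent) (arrays τ₄ type)) (sym z≡) (sym nx≡)
              (subst (Place x k nx (suc nx) (arrays τ₄ parent)) (sym typ≡) (proj₁ result))
            , cs₄ , trans (cong (λ z → arrays τ₄ type (arrays τ₄ parent z)) z≡) (trans (cong (arrays τ₄ type) (proj₂ result)) (cong (arrays τ₄ type) (sym u≡))) , ≤-reflexive nx≡
          where
          open Step
          z≡ : regs τ₄ rZ ≡ nx
          z≡ = trans (reg≡ fr₄ rZ) (reg≡ fr₂ rTg)
          u≡ : regs τ₄ rU ≡ u
          u≡ = trans (reg≡ fr₄ rU) (reg≡ fr₂ rU)
          nx≡ : regs τ₄ rNx ≡ suc nx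
          nx≡ = trans (reg≡ fr₄ rNx) (trans (reg≡ fr₂ rNx) (+-comm nx 1))
          typ≡ : arrays τ₄ type ≡ typ₁
          typ≡ = trans (arr≡ fr₄ type) (arr≡ fr₂ type)
          S₁ : Step par (arrays τ₂ parent) (_≡ nx) u
          S₁ = update-step nx u pe₂
          S₂ : Step (arrays τ₂ parent) (arrays τ₄ parent) (λ c → c ∈ D × arrays τ₂ parent c ≡ u) nx
          S₂ = subst₂ (λ D' u' → Step (arrays τ₂ parent) (arrays τ₄ parent) (λ c → c ∈ D' × arrays τ₂ parent c ≡ u') nx) (D≡ fr₂) (reg≡ fr₂ rU)
                 (subst (Step (arrays τ₂ parent) (arrays τ₄ parent) _) (reg≡ fr₂ rTg) (record { cases = vals }))
          -- A second full child besides `f`, so that the new union has two children.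
          f' = another par u f uniq (≤-trans (≤-trans (s≤s (n≢0⇒n>0 c1)) (≤-reflexive (m+[n∸m]≡n {1} (n≢0⇒n>0 (λ e → c1 (cong (_∸ 1) e)))))) (≤-reflexive cC))
          result = S.split-union {typ' = typ₁} ty (λ t → 0≢1+n (trans (sym tu) t)) (proj₁ (proj₂ f')) (proj₁ (proj₂ (proj₂ f'))) (proj₂ (proj₂ (proj₂ f'))) S₁ S₂ ty-nx

      join-split : typ u ≡ 1 → regs σ rK ∸ 1 ≢ 0 →
        Exec W ((openP ⨾ rQ := parent ! reg rU) ⨾ move rTg rQ ⨾ move rU rTg ⨾ rZ := reg rU ⨾ forQueue transferB) σ (120 + 100 * regs σ rTail) Goal
      join-split tu k1 = exec-mono (exec-bind {W = W} (wp-sound {W = W} (openP ⨾ rQ := parent ! reg rU) {λ τ → τ ≡ σ₁} σ (tt , (tt , 1≤W , ≤-trans (≤-trans (≤-reflexive (+-comm nx 1)) nx<M) M≤W) , tt , tt , tt , refl))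
          (λ { τ _ refl → exec-bind (exec-move W 1≤W M M≤W MM≤W rTg rQ σ₁ nx<M counts)
            (λ τ₂ fr₂ (pe₂ , cs₂) → exec-bind (exec-move W 1≤W M M≤W MM≤W rU rTg τ₂ (≤-trans (s≤s (≤-reflexive (reg≡ fr₂ rU))) u<M) cs₂)
              (λ τ₃ fr₃ (pe₃ , cs₃) → exec-bind (wp-sound (rZ := reg rU) {λ τ → τ ≡ setReg rZ (regs τ₃ rU) τ₃} τ₃ (tt , refl))
                (λ { τ _ refl → exec-mono (exec-frame (exec-transfer W 1≤W M M≤W MM≤W (setReg rZ (regs τ₃ rU) τ₃)
                  (subst Unique (sym (D≡ fr₂ fr₃)) uniq) (λ {d} m → D<M nx≤M (subst (d ∈_) (D≡ fr₂ fr₃) m)) cs₃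
                    (λ e → tg≢u (trans (sym (trans (reg≡ fr₃ rTg) (reg≡ fr₂ rTg))) (trans e (trans (reg≡ fr₃ rU) (reg≡ fr₂ rU))))))) (≤-reflexive (cong (λ t → 4 + 100 * t) (trans (reg≡ fr₃ rTail) (reg≡ fr₂ rTail))))
                  (λ τ₄ (fr₄ , vals , cs₄) → finish τ₂ fr₂ pe₂ τ₃ fr₃ pe₃ τ₄ fr₄ vals cs₄) }))) }))
        (+-monoˡ-≤ (100 * regs σ rTail) (closed≤ (time (openP ⨾ rQ := parent ! reg rU) + (40 + (40 + (2 + 4)))) 120)) (λ _ q → q)
        where
        σ₁ = setReg rQ (par u) (setCell type nx (typ u) (setReg rNx (nx + 1) (setReg rTg nx σ)))
        D≡ : ∀ {τ₂ τ₃} → Frame (move rTg rQ) σ₁ τ₂ → Frame (move rU rTg) τ₂ τ₃ → slice (arrays τ₃ queue) (regs τ₃ rTail) ≡ D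
        D≡ fr fr' = trans (cong₂ slice (arr≡ fr' queue) (reg≡ fr' rTail)) (cong₂ slice (arr≡ fr queue) (reg≡ fr rTail))
        finish : ∀ τ₂ → Frame (move rTg rQ) σ₁ τ₂ → arrays τ₂ parent ≡ par [ nx ↦ par u ] → ∀ τ₃ → Frame (move rU rTg) τ₂ τ₃ →
          arrays τ₃ parent ≡ arrays τ₂ parent [ regs τ₂ rU ↦ regs τ₂ rTg ] → ∀ τ₄ → Frame (forQueue transferB) (setReg rZ (regs τ₃ rU) τ₃) τ₄ → _ → Counted M τ₄ → Goal τ₄
        finish τ₂ fr₂ pe₂ τ₃ fr₃ pe₃ τ₄ fr₄ vals cs₄ = subst₂ (λ z nx' → Place x k z nx' (arrays τ₄ parent) (arrays τ₄ type)) (sym z≡) (sym nx≡)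
              (subst (Place x k u (suc nx) (arrays τ₄ parent)) (sym typ≡) (proj₁ result))
            , cs₄ , trans (cong (λ z → arrays τ₄ type (arrays τ₄ parent z)) z≡) (trans (cong (arrays τ₄ type) (proj₂ result))
                (trans (cong (λ t → t nx) typ≡) (trans ty-nx (sym (trans (cong (arrays τ₄ type) u≡) (trans (cong (λ t → t u) typ≡) (ty u (tg≢u ∘ sym)))))))) , ≤-reflexive nx≡
          where
          u₃ : regs τ₃ rU ≡ u
          u₃ = trans (reg≡ fr₃ rU) (reg≡ fr₂ rU)
          tg₃ : regs τ₃ rTg ≡ nx
          tg₃ = trans (reg≡ fr₃ rTg) (reg≡ fr₂ rTg)
          z≡ : regs τ₄ rZ ≡ u
          z≡ = trans (reg≡ fr₄ rZ) u₃
          u≡ : regs τ₄ rU ≡ u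
          u≡ = trans (reg≡ fr₄ rU) u₃
          nx≡ : regs τ₄ rNx ≡ suc nx
          nx≡ = trans (reg≡ fr₄ rNx) (trans (reg≡ fr₃ rNx) (trans (reg≡ fr₂ rNx) (+-comm nx 1)))
          typ≡ : arrays τ₄ type ≡ typ₁
          typ≡ = trans (arr≡ fr₄ type) (trans (arr≡ fr₃ type) (arr≡ fr₂ type))
          S₁ : Step par (arrays τ₂ parent) (_≡ nx) (par u)
          S₁ = update-step nx (par u) pe₂
          S₂ : Step (arrays τ₂ parent) (arrays τ₃ parent) (_≡ u) nx
          S₂ = update-step u nx (trans pe₃ (cong₂ (λ a b → arrays τ₂ parent [ a ↦ b ]) (reg≡ fr₂ rU) (reg≡ fr₂ rTg)))
          S₃ : Step (arrays τ₃ parent) (arrays τ₄ parent) (λ c → c ∈ D × arrays τ₃ parent c ≡ u) nx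
          S₃ = subst₂ (λ D' u' → Step (arrays τ₃ parent) (arrays τ₄ parent) (λ c → c ∈ D' × arrays τ₃ parent c ≡ u') nx) (D≡ fr₂ fr₃) u₃
                 (subst (Step (arrays τ₃ parent) (arrays τ₄ parent) _) tg₃ (record { cases = vals }))
          u≢0 : u ≢ 0
          u≢0 e = 0≢1+n (trans (sym (trans (cong typ e) T.typ0)) tu)
          b = S.L.child∉ (proj₁ (T.parent-inner pf u≢0)) S.u<nx u∉D
          many : suc (suc (occ par u D)) ≤ occ par u (ids M)
          many = ≤-trans (+-monoˡ-≤ (occ par u D) {2} {occ par u (ids M) ∸ occ par u D} two≤) (≤-reflexive (m∸n+n≡m (total-D≤ nx≤M one u)))
            where
            k≡ : regs σ rK ≡ occ par u (ids M) ∸ occ par u D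
            k≡ = trans cK (cong₂ _∸_ (proj₁ counts u) cC)
            two≤ : 2 ≤ occ par u (ids M) ∸ occ par u D
            two≤ = ≤-trans (≤-trans (s≤s (n≢0⇒n>0 k1)) (≤-reflexive (m+[n∸m]≡n {1} (n≢0⇒n>0 (λ e → k1 (cong (_∸ 1) e)))))) (≤-reflexive k≡)
          b' = two-outside par u M uniq (proj₂ (proj₂ b)) (proj₁ (proj₂ b)) many
          result = S.split-join {typ' = typ₁} ty tu refl (proj₁ (proj₂ b)) (proj₂ (proj₂ b)) (proj₁ (proj₂ (proj₂ b'))) (proj₁ (proj₂ b')) (proj₂ (proj₂ (proj₂ b'))) S₁ S₂ S₃ (trans ty-nx tu)

      exec-split : Exec W splitP σ (300 + 200 * regs σ rTail) Goal
      exec-split = exec-mono (exec-if tt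
          (λ t → exec-if (tt , 1≤W) (join-split (T.zero-or-one u t)) (λ z → wp-sound (rZ := reg rS) σ (join-single (T.zero-or-one u t) z)))
          (λ t → exec-if (tt , 1≤W) (union-split t) (λ z → wp-sound (rZ := reg rF) σ (union-single t z))))
        (≤-trans (≤-reflexive (lem (regs σ rTail))) (+-monoˡ-≤ (200 * regs σ rTail) (closed≤ 215 300))) (λ _ q → q)
        where
        lem : ∀ a → 3 + ((4 + ((120 + 100 * a) + 2)) + (4 + ((80 + 100 * a) + 2))) ≡ 215 + 200 * a
        lem = solve-∀

    module _ (x : Fin n) (k : ℕ) (x≡k : toℕ x ≡ k) where

      Inserted : ℕ → State → Set
      Inserted b τ = Cotree (suc k) 0 (regs τ rNx) (arrays τ parent) (arrays τ type) × Counted M τ × regs τ rNx ≤ b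

      -- Both branches of `attachP` are followed by the same move of `x`. The tree is therefore
      -- promised for every array that this last move can produce.
      AlmostInserted : ℕ → State → Set
      AlmostInserted b τ = (∀ par' → par' ≡ arrays τ parent [ leaf x ↦ regs τ rW ] → Cotree (suc k) 0 (regs τ rNx) par' (arrays τ type))
        × Counted M τ × regs τ rX ≡ leaf x × regs τ rNx ≤ b

      module Pairing (σ : State) (nx<M : regs σ rNx < M) (rx : regs σ rX ≡ leaf x) (counts : Counted M σ)
        (P : Place x k (regs σ rZ) (regs σ rNx) (arrays σ parent) (arrays σ type))
        (tu : arrays σ type (arrays σ parent (regs σ rZ)) ≡ arrays σ type (regs σ rU)) where
        open Place P
        z = regs σ rZ
        nx = regs σ rNx
        par = arrays σ parent
        typ = arrays σ type
        u = regs σ rU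
        module T = Cotree tree
        nx≤M = <⇒≤ nx<M

        leafx<M : leaf x < M
        leafx<M = <-trans (s≤s (leaf≤ x)) (≤-trans (s≤s T.n<nx) nx<M)

        -- The value 0 of `rW` requests a new node; it is available as a signal because `z` is never
        -- the root.
        Target : State → Set
        Target τ = (regs τ rW ≡ z × n < z × typ z ≢ typ u) ⊎ (regs τ rW ≡ 0 × (n < z → typ z ≡ typ u))

        targetP : Program
        targetP = rW := const 0 ⨾ ifNonzero count ! reg rZ then (ifEq (type ! reg rZ) (type ! reg rU) skip (rW := reg rZ)) else skip

        exec-target : Exec W targetP σ (time targetP) Target
        exec-target = wp-sound targetP σ (z≤n , tt ,
            (λ nz → wp-ifEq {W = W} {σ = setReg rW 0 σ} (type ! reg rZ) (type ! reg rU) skip (rW := reg rZ) {Target} tt tt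
              (λ e → inj₂ (refl , λ _ → e)) (λ ne → tt , inj₁ (refl , inner nz , ne))) ,
            (λ e → inj₂ (refl , λ nz → ⊥-elim (none nz e))))
          where
          -- Having children separates inner nodes from leaves; types are compared only for the
          -- former.
          inner : arrays σ count z ≢ 0 → n < z
          inner nz with child-of par z M (λ e → nz (trans (proj₁ counts z) e))
          ... | c , pc = proj₁ (T.parent-inner pc z≢0)
          none : n < z → arrays σ count z ≢ 0
          none nz e with T.two z nz z<nx
          ... | d , d' , ne , p , p' = <⇒≱ {1} (≤-trans (occ-two par z M (≤-trans (proj₂ (T.child-node p z≢0)) nx≤M) (≤-trans (proj₂ (T.child-node p' z≢0)) nx≤M) ne p p')
                  (≤-reflexive (trans (sym (proj₁ counts z)) e))) z≤n

        exec-attach : ∀ τ → Frame targetP σ τ → Target τ → Exec W attachP τ 200 (AlmostInserted (suc nx))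
        exec-attach τ fr (inj₁ (w≡ , nz , ne)) = exec-mono (exec-if {W = W} {P₁ = skip} {T = 1} {T' = 0} tt
            (λ _ → wp-sound skip τ almost) (λ e → ⊥-elim (z≢0 (trans (sym w≡) e)))) (closed≤ _ 200) (λ _ q → q)
          where
          almost : AlmostInserted (suc nx) τ
          almost = (λ par' e → subst₂ (λ nx' t → Cotree (suc k) 0 nx' par' t) (sym (reg≡ fr rNx)) (sym (arr≡ fr type))
                (attach x≡k P nz (λ e' → ne (trans e' tu)) (update-step (leaf x) z (trans e (cong₂ (λ f w → f [ leaf x ↦ w ]) (arr≡ fr parent) w≡)))))
              , counted-frame {M} {σ} {τ} (arr≡ fr parent) (arr≡ fr count) (arr≡ fr sumOf) counts , trans (reg≡ fr rX) rx , ≤-trans (≤-reflexive (reg≡ fr rNx)) (n≤1+n nx)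
        exec-attach τ fr (inj₂ (w≡ , tz)) = exec-mono (exec-if {W = W} {P₁ = skip} {T = 0} tt (λ ne → ⊥-elim (ne w≡))
            (λ _ → exec-bind (wp-sound {W = W} newP {λ τ' → τ' ≡ τ₁} τ
                (tt , (tt , 1≤W , ≤-trans (≤-trans (≤-reflexive (+-comm _ 1)) (≤-trans (s≤s (≤-reflexive (reg≡ fr rNx))) nx<M)) M≤W) , tt , (1≤W , tt) , tt , refl))
              (λ { _ _ refl → exec-bind (exec-move W 1≤W M M≤W MM≤W rW rQ τ₁ (≤-trans (s≤s (≤-reflexive (reg≡ fr rNx))) nx<M) (counted-frame {M} {σ} {τ₁} (arr≡ fr parent) (arr≡ fr count) (arr≡ fr sumOf) counts))
                (λ τ₂ fr₂ (pe₂ , cs₂) → exec-mono (exec-frame (exec-move W 1≤W M M≤W MM≤W rZ rW τ₂ (≤-trans (s≤s (≤-reflexive (z₂ fr₂))) (≤-trans z<nx nx≤M)) cs₂)) ≤-refl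
                  (λ τ₃ (fr₃ , pe₃ , cs₃) → finish τ₂ fr₂ pe₂ τ₃ fr₃ pe₃ cs₃)) })))
            (closed≤ _ 200) (λ _ q → q)
          where
          newP : Program
          newP = rW := reg rNx ⨾ rNx := reg rNx ⊕ const 1 ⨾ type [ reg rW ]:= const 1 ⊖ type ! reg rU ⨾ rQ := parent ! reg rZ
          τ₁ : State
          τ₁ = setReg rQ (arrays τ parent (regs τ rZ)) (setCell type (regs τ rNx) (1 ∸ arrays τ type (regs τ rU)) (setReg rNx (regs τ rNx + 1) (setReg rW (regs τ rNx) τ)))
          z₂ : ∀ {τ₂} → Frame (move rW rQ) τ₁ τ₂ → regs τ₂ rZ ≡ z
          z₂ fr₂ = trans (reg≡ fr₂ rZ) (reg≡ fr rZ)
          finish : ∀ τ₂ → Frame (move rW rQ) τ₁ τ₂ → arrays τ₂ parent ≡ arrays τ parent [ regs τ rNx ↦ arrays τ parent (regs τ rZ) ] → ∀ τ₃ → Frame (move rZ rW) τ₂ τ₃ →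
            arrays τ₃ parent ≡ arrays τ₂ parent [ regs τ₂ rZ ↦ regs τ₂ rW ] → Counted M τ₃ → AlmostInserted (suc nx) τ₃
          finish τ₂ fr₂ pe₂ τ₃ fr₃ pe₃ cs₃ = (λ par' e → subst (λ nx' → Cotree (suc k) 0 nx' par' (arrays τ₃ type)) (sym nx≡)
                (pair x≡k P (λ nz → trans (tz nz) (sym tu)) refl S₁ S₂ (S₃ par' e) (λ a ne → trans (cong (λ t → t a) typ≡) (update-neq typ nx (ne ∘ sym)))
                  (trans (cong (λ t → t nx) typ≡) (trans (update-eq typ nx refl) (cong (1 ∸_) (sym tu))))))
              , cs₃ , trans (reg≡ fr₃ rX) (trans (reg≡ fr₂ rX) (trans (reg≡ fr rX) rx)) , ≤-reflexive nx≡
            where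
            w₂ : regs τ₂ rW ≡ nx
            w₂ = trans (reg≡ fr₂ rW) (reg≡ fr rNx)
            nx≡ : regs τ₃ rNx ≡ suc nx
            nx≡ = trans (reg≡ fr₃ rNx) (trans (reg≡ fr₂ rNx) (trans (+-comm _ 1) (cong suc (reg≡ fr rNx))))
            typ≡ : arrays τ₃ type ≡ typ [ nx ↦ 1 ∸ typ u ]
            typ≡ = trans (arr≡ fr₃ type) (trans (arr≡ fr₂ type) (lem (arr≡ fr type) (reg≡ fr rNx) (reg≡ fr rU)))
              where
              lem : ∀ {t t' : ℕ → ℕ} {a a' b b'} → t ≡ t' → a ≡ a' → b ≡ b' → t [ a ↦ 1 ∸ t b ] ≡ t' [ a' ↦ 1 ∸ t' b' ]
              lem refl refl refl = refl
            S₁ : Step par (arrays τ₂ parent) (_≡ nx) (par z)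
            S₁ = update-step nx (par z) (trans pe₂ (lem (arr≡ fr parent) (reg≡ fr rNx) (reg≡ fr rZ)))
              where
              lem : ∀ {t t' : ℕ → ℕ} {a a' b b'} → t ≡ t' → a ≡ a' → b ≡ b' → t [ a ↦ t b ] ≡ t' [ a' ↦ t' b' ]
              lem refl refl refl = refl
            S₂ : Step (arrays τ₂ parent) (arrays τ₃ parent) (_≡ z) nx
            S₂ = update-step z nx (trans pe₃ (cong₂ (λ a b → arrays τ₂ parent [ a ↦ b ]) (z₂ fr₂) w₂))
            S₃ : ∀ par' → par' ≡ arrays τ₃ parent [ leaf x ↦ regs τ₃ rW ] → Step (arrays τ₃ parent) par' (_≡ leaf x) nx
            S₃ par' e = update-step (leaf x) nx (trans e (cong (λ b → arrays τ₃ parent [ leaf x ↦ b ]) (trans (reg≡ fr₃ rW) w₂)))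

        exec-pair : Exec W pairP σ 300 (Inserted (suc nx))
        exec-pair = exec-mono (exec-bind exec-target (λ τ fr t → exec-bind (exec-attach τ fr t)
            (λ τ₂ _ (build , cs , rx₂ , le) → exec-mono (exec-frame (exec-move W 1≤W M M≤W MM≤W rX rW τ₂ (≤-trans (s≤s (≤-reflexive rx₂)) leafx<M) cs)) ≤-refl
              (λ τ₃ (fr₃ , pe , cs₃) → subst₂ (λ nx' t → Cotree (suc k) 0 nx' (arrays τ₃ parent) t) (sym (reg≡ fr₃ rNx)) (sym (arr≡ fr₃ type))
                  (build (arrays τ₃ parent) (trans pe (cong (λ a → arrays τ₂ parent [ a ↦ regs τ₂ rW ]) rx₂)))
                , cs₃ , ≤-trans (≤-reflexive (reg≡ fr₃ rNx)) le))))
          (closed≤ (time targetP + (200 + 40)) 300) (λ _ q → q)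

      record Loaded (σ : State) : Set where
        field
          tree   : Cotree k 0 (regs σ rNx) (arrays σ parent) (arrays σ type)
          counts : Counted M σ
          clean  : ∀ p → arrays σ done p ≡ 0
          marks  : ∀ a → arrays σ mark a < regs σ rX
          rx     : regs σ rX ≡ leaf x
          uniq   : Unique (View.D (view σ))
          Y⇒     : ∀ {y} → y ∈ View.D (view σ) → ∃[ v ] (y ≡ leaf v × Nbr x k v)
          Y⇐     : ∀ {v} → Nbr x k v → leaf v ∈ View.D (view σ)

      -- Without earlier neighbours the edge relation stays the same, and `x` already hangs at the
      -- root, which is a union.
      isolate : ∀ {nx par typ} → (∀ v → ¬ Nbr x k v) → Cotree k 0 nx par typ → Cotree (suc k) 0 nx par typ
      isolate {nx} {par} {typ} none T = record
        { core = record { rank = rank ; rank< = rank< ; par0 = par0 ; childless = childless ; adj = adj' }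
        ; low = low ; fresh = fresh ; n<nx = n<nx ; binary = binary ; typ0 = typ0 ; alt = alt ; two = two
        ; outside = λ v le → outside v (<⇒≤ le) }
        where
        open Cotree T
        old : ∀ {v v'} → Edge (suc k) v v' → Edge k v v'
        old {v} {v'} (a , p , q) with v Fin.≟ x | v' Fin.≟ x
        ... | yes refl | yes refl = ⊥-elim (~-irrefl v a)
        ... | yes refl | no ne = ⊥-elim (none v' (proj₁ (proj₂ (edge-new x≡k ne)) (a , p , q)))
        ... | no ne | yes refl = ⊥-elim (none v (proj₂ (proj₂ (edge-new x≡k ne)) (a , p , q)))
        ... | no ne | no ne' = proj₂ (edge-old x≡k ne ne') (a , p , q)
        adj' : ∀ {d d'} → d ≢ 0 → d' ≢ 0 → d ≢ d' → par d ≡ par d' → ∀ {v v'} → par ⊢ leaf v ⊑ d → par ⊢ leaf v' ⊑ d' → Agrees (typ (par d)) (Edge (suc k) v) v'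
        adj' nd nd' ne e {v} {v'} p p' with adj nd nd' ne e p p'
        ... | f , g = (λ t → let (a , r , s) = f t in a , m≤n⇒m≤1+n r , m≤n⇒m≤1+n s) , (λ h → g (old h))

      Done : ℕ → State → Set
      Done b τ = Inserted b τ × (∀ p → arrays τ done p ≡ 0) × (∀ a → arrays τ mark a ≤ leaf x)

      module Choosing (σ : State) (room : suc (regs σ rNx) < M) (ld : Loaded σ) where
        open Loaded ld
        module T = Cotree tree
        nx≤M : regs σ rNx ≤ M
        nx≤M = ≤-trans (n≤1+n _) (<⇒≤ room)
        par = arrays σ parent
        nx = regs σ rNx
        Y = View.D (view σ)

        Y-leaf : ∀ {y} → y ∈ Y → y ≢ 0 × y ≤ n
        Y-leaf m with Y⇒ m
        ... | v , refl , _ = (λ ()) , leaf≤ v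

        module C = Closing tree nx≤M (proj₁ counts) uniq Y-leaf

        closed : ∀ {D} → Closure n nx par Y D → Closed nx par (Nbr x k) D
        closed cl = record
          { node = nd
          ; leaf∈ = λ N → Closure.start cl (Y⇐ N)
          ; ∈leaf = lf
          ; down = dn
          ; up = Closure.up cl }
          where
          nd : ∀ {d} → d ∈ _ → d ≢ 0 × d < nx
          nd m with Closure.kind cl m
          ... | inj₁ y = proj₁ (Y-leaf y) , ≤-trans (s≤s (proj₂ (Y-leaf y))) T.n<nx
          ... | inj₂ (p , q) = T.inner≢0 p , q
          lf : ∀ {v} → leaf v ∈ _ → Nbr x k v
          lf {v} m with Closure.kind cl m
          ... | inj₂ (p , _) = ⊥-elim (<⇒≱ p (leaf≤ v))
          ... | inj₁ y with Y⇒ y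
          ...   | w , e , N = subst (Nbr x k) (sym (leaf-injective e)) N
          dn : ∀ {a c} → a ∈ _ → par c ≡ a → c ∈ _
          dn {a} {c} m pc with Closure.kind cl m
          ... | inj₂ (p , _) = Closure.down cl p m pc
          ... | inj₁ y with Y⇒ y
          ...   | w , refl , _ = ⊥-elim (T.childless w c pc)

        module _ {V : View} (V-par : View.par V ≡ par) (V-cnt : View.cnt V ≡ arrays σ count)
          (cl : Closure n nx par Y (View.D V)) (dn≡ : ∀ p → View.dn V p ≡ occ par p (View.D V)) where
          open View V using (D; dn; cnt; X)

          node<M : ∀ {d} → d ∈ D → d < M
          node<M m = ≤-trans (proj₂ (Closed.node (closed cl) m)) nx≤M

          -- A node with all its children in `D` is itself in `D`, so the test for `done` below
          -- `count` recognises the parents outside `D`. The root again stays outside, being its own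
          -- child.
          not-full : ∀ f → f ∈ D → (cnt (View.par V f) ∸ dn (View.par V f) ≢ 0 → par f ∉ D) × (par f ∉ D → cnt (View.par V f) ∸ dn (View.par V f) ≢ 0)
          not-full f f∈D rewrite V-par | V-cnt | dn≡ (par f) | proj₁ counts (par f) = l , r
            where
            p = par f
            l : occ par p (ids M) ∸ occ par p D ≢ 0 → p ∉ D
            l ne m = ne (m≤n⇒m∸n≡0 (total-mono one par p (ids-unique M) (λ _ e → Closed.down (closed cl) m e)))
            r : p ∉ D → occ par p (ids M) ∸ occ par p D ≢ 0
            r m z = m (Closed.up (closed cl) (proj₁ inner) (proj₂ inner) (λ c pc → all c (≤-trans (proj₂ (T.child-node pc p≢0)) nx≤M) pc))
              where
              all : ∀ c → c < M → par c ≡ p → c ∈ D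
              all = occ-full par p M (Closure.unique cl) (≤-antisym (total-mono one par p (Closure.unique cl) (λ m' _ → ∈-ids M (node<M m'))) (m∸n≡0⇒m≤n z)) node<M
              p≢0 : p ≢ 0
              p≢0 e = proj₁ (Closed.node (closed cl) (all 0 (≤-trans (s≤s z≤n) (≤-trans T.n<nx nx≤M)) (trans T.par0 (sym e)))) refl
              inner = T.parent-inner refl p≢0

          -- The parent of least rank is unmarked: a mark on it would come from a partially full
          -- node one or two levels below, contrary to minimality.
          candidate : ∀ {mk d₀ D₀} → Marked V [] mk → D ≡ d₀ ∷ D₀ → ∃[ f ] (f ∈ D × Candidate V mk f)
          candidate {mk} mkd D≡ with Lowest.lowest-touched cog tree x (closed cl) D≡
          ... | f , m , m' , low = f , m , proj₂ (not-full f m) m' , unmarked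
            where
            unmarked : X ∸ mk (View.par V f) ≢ 0
            unmarked z with Marked.sound mkd (View.par V f)
            ... | inj₁ lt = <⇒≱ lt (m∸n≡0⇒m≤n z)
            ... | inj₂ (_ , g , mg , nf , p≢0 , h) with proj₁ (not-full g mg) nf
            ...   | pg∉ rewrite V-par with low mg refl pg∉ p≢0 | h
            ...     | a , _ | inj₁ e = a e
            ...     | _ , b | inj₂ e = b e

          -- After the complete marking pass, a missing mark at `u` is just the local condition on
          -- the two levels below `u` from which `Lowest` argues, whichever candidate was selected.
          chosen-lowest : ∀ {mk f u} → Marked V [] mk → Selected V mk f u → par f ≡ u × u ∉ D ×
            (∀ {p g} → g ∈ D → par g ≡ p → p ∉ D → p ≢ 0 → par p ≢ u × par (par p) ≢ u)
          chosen-lowest {mk} {f} {u} mkd (m , (nf , um) , e) with not-full f m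
          ... | l , _ rewrite V-par | e = refl , l nf , low
            where
            low : ∀ {p g} → g ∈ D → par g ≡ p → p ∉ D → p ≢ 0 → par p ≢ par f × par (par p) ≢ par f
            low {p} {g} mg refl p∉ p≢0 with Marked.complete mkd mg
            ... | inj₂ h = (λ e' → um (m≤n⇒m∸n≡0 (≤-reflexive (sym (h _ (marks-g (inj₁ e'))))))) , (λ e' → um (m≤n⇒m∸n≡0 (≤-reflexive (sym (h _ (marks-g (inj₂ e')))))))
              where
              marks-g : (par (par g) ≡ par f ⊎ par (par (par g)) ≡ par f) → Marks V g (par f)
              marks-g r = subst (λ q → cnt (q g) ∸ dn (q g) ≢ 0 × q g ≢ 0 × (q (q g) ≡ par f ⊎ q (q (q g)) ≡ par f)) (sym V-par)
                (subst (λ q → cnt (q g) ∸ dn (q g) ≢ 0) V-par (proj₂ (not-full g mg) p∉) , p≢0 , r)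

        tree-view-≡ : ∀ {V V' : TreeView} → TreeView.par V ≡ TreeView.par V' → TreeView.typ V ≡ TreeView.typ V' → TreeView.cnt V ≡ TreeView.cnt V' →
          TreeView.sm V ≡ TreeView.sm V' → TreeView.nx V ≡ TreeView.nx V' → TreeView.D V ≡ TreeView.D V' → V ≡ V'
        tree-view-≡ refl refl refl refl refl refl = refl

        module Reshaped (τ₁ : State) (fr₁ : Frame closeP σ τ₁) (cl : Closure n nx par Y (View.D (view τ₁)))
          (dn≡ : ∀ p → arrays τ₁ done p ≡ occ par p (View.D (view τ₁))) (tail≢0 : regs τ₁ rTail ≢ 0) where

          t = regs τ₁ rTail
          D = View.D (view τ₁)

          X≡ : regs τ₁ rX ≡ leaf x
          X≡ = trans (reg≡ fr₁ rX) rx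

          D≡ : ∃[ d₀ ] ∃[ D₀ ] D ≡ d₀ ∷ D₀
          D≡ with nonzero tail≢0
          ... | i , e = _ , _ , cong (slice (arrays τ₁ queue)) e

          module AfterMark (τ₂ : State) (fr₂ : Frame (forQueue markB) τ₁ τ₂) (mk : Marked (view τ₁) [] (arrays τ₂ mark)) where

            v≡ : view τ₂ ≡ view τ₁
            v≡ = view-frame fr₂

            t₂ : regs τ₂ rTail ≡ t
            t₂ = reg≡ fr₂ rTail

            cand : ∃[ f ] (f ∈ View.D (view τ₂) × Candidate (view τ₂) (arrays τ₂ mark) f)
            cand = subst (λ V → ∃[ f ] (f ∈ View.D V × Candidate V (arrays τ₂ mark) f)) (sym v≡)
              (candidate (arr≡ fr₁ parent) (arr≡ fr₁ count) cl dn≡ mk (proj₂ (proj₂ D≡)))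

            marks≤ : ∀ a → arrays τ₂ mark a ≤ leaf x
            marks≤ a with Marked.sound mk a
            ... | inj₁ lt = ≤-trans (<⇒≤ lt) (≤-reflexive X≡)
            ... | inj₂ (e , _) = ≤-reflexive (trans e X≡)

            module AfterSelect (τ₃ : State) (fr₃ : Frame (forQueue selectB) τ₂ τ₃) (sel : Selected (view τ₂) (arrays τ₂ mark) (regs τ₃ rF) (regs τ₃ rU)) where

              t₃ : regs τ₃ rTail ≡ t
              t₃ = trans (reg≡ fr₃ rTail) t₂

              f = regs τ₃ rF
              u = regs τ₃ rU

              sel₁ : Selected (view τ₁) (arrays τ₂ mark) f u
              sel₁ = subst (λ V → Selected V (arrays τ₂ mark) f u) v≡ sel

              facts = chosen-lowest (arr≡ fr₁ parent) (arr≡ fr₁ count) cl dn≡ mk sel₁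

              ch : Chosen x k (tree-view par (arrays σ type) (arrays σ count) (arrays σ sumOf) nx D) f u
              ch = record { tree = tree ; closed = closed cl ; uniq = Closure.unique cl ; f∈D = proj₁ sel₁ ; pf = proj₁ facts ; u∉D = proj₁ (proj₂ facts)
                          ; lowest = proj₂ (proj₂ facts) ; counts = counts }

              par₃ : arrays τ₃ parent ≡ par
              par₃ = trans (arr≡ fr₃ parent) (trans (arr≡ fr₂ parent) (arr≡ fr₁ parent))
              cnt₃ : arrays τ₃ count ≡ arrays σ count
              cnt₃ = trans (arr≡ fr₃ count) (trans (arr≡ fr₂ count) (arr≡ fr₁ count))
              sum₃ : arrays τ₃ sumOf ≡ arrays σ sumOf
              sum₃ = trans (arr≡ fr₃ sumOf) (trans (arr≡ fr₂ sumOf) (arr≡ fr₁ sumOf))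
              done₃ : arrays τ₃ done ≡ arrays τ₁ done
              done₃ = trans (arr≡ fr₃ done) (arr≡ fr₂ done)
              D₃ : View.D (view τ₃) ≡ D
              D₃ = trans (cong₂ slice (arr≡ fr₃ queue) (reg≡ fr₃ rTail)) (cong₂ slice (arr≡ fr₂ queue) (reg≡ fr₂ rTail))

              R = arrays σ sumOf u ∸ total (λ i → i) par u D

              assignP : Program
              assignP = rC := done ! reg rU ⨾ rK := count ! reg rU ⊖ reg rC ⨾ rS := sumOf ! reg rU

              τ₄ : State
              τ₄ = setReg rS (arrays τ₃ sumOf u) (setReg rK (arrays τ₃ count u ∸ arrays τ₃ done u) (setReg rC (arrays τ₃ done u) τ₃))

              done₄ : ∀ p → arrays τ₄ done p ≡ occ (arrays τ₄ parent) p (View.D (view τ₄))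
              done₄ p = trans (cong (λ g → g p) done₃) (trans (dn≡ p) (sym (cong₂ (λ q l → occ q p l) par₃ D₃)))

              sum₄ : regs τ₄ rS ≡ R + total (λ i → i) (arrays τ₄ parent) (regs τ₄ rU) (View.D (view τ₄))
              sum₄ = trans (cong (λ g → g u) sum₃) (trans (sym (m∸n+n≡m (≤-trans (Chosen.total-D≤ ch nx≤M (λ i → i) u) (≤-reflexive (sym (proj₂ counts u))))))
                (sym (cong₂ (λ q l → R + total (λ i → i) q u l) par₃ D₃)))

              module AfterReset (τ₅ : State) (fr₅ : Frame (forQueue resetB) τ₄ τ₅) (zero₅ : ∀ p → arrays τ₅ done p ≡ 0) (s₅ : regs τ₅ rS ≡ R) where

                t₅ : regs τ₅ rTail ≡ t
                t₅ = trans (reg≡ fr₅ rTail) t₃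
                u₅ : regs τ₅ rU ≡ u
                u₅ = reg≡ fr₅ rU
                nx₅ : regs τ₅ rNx ≡ nx
                nx₅ = trans (reg≡ fr₅ rNx) (trans (reg≡ fr₃ rNx) (trans (reg≡ fr₂ rNx) (reg≡ fr₁ rNx)))
                par₅ : arrays τ₅ parent ≡ par
                par₅ = trans (arr≡ fr₅ parent) par₃
                D₅ : View.D (view τ₅) ≡ D
                D₅ = trans (cong₂ slice (arr≡ fr₅ queue) (reg≡ fr₅ rTail)) D₃
                tv : treeView τ₅ ≡ tree-view par (arrays σ type) (arrays σ count) (arrays σ sumOf) nx D
                tv = tree-view-≡ par₅ (trans (arr≡ fr₅ type) (trans (arr≡ fr₃ type) (trans (arr≡ fr₂ type) (arr≡ fr₁ type))))
                  (trans (arr≡ fr₅ count) cnt₃) (trans (arr≡ fr₅ sumOf) sum₃) nx₅ D₅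
                ch₅ : Chosen x k (treeView τ₅) (regs τ₅ rF) (regs τ₅ rU)
                ch₅ = subst₂ (Chosen x k (treeView τ₅)) (sym (reg≡ fr₅ rF)) (sym u₅) (subst (λ V → Chosen x k V f u) (sym tv) ch)
                c₅ : regs τ₅ rC ≡ occ (arrays τ₅ parent) (regs τ₅ rU) (View.D (view τ₅))
                c₅ = trans (reg≡ fr₅ rC) (trans (done₄ u) (sym (lem (arr≡ fr₅ parent) u₅ (cong₂ slice (arr≡ fr₅ queue) (reg≡ fr₅ rTail)))))
                  where
                  lem : ∀ {q q' : ℕ → ℕ} {a a'} {l l' : List ℕ} → q ≡ q' → a ≡ a' → l ≡ l' → occ q a l ≡ occ q' a' l'
                  lem refl refl refl = refl
                k₅ : regs τ₅ rK ≡ arrays τ₅ count (regs τ₅ rU) ∸ regs τ₅ rC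
                k₅ = trans (reg≡ fr₅ rK) (sym (cong₂ _∸_ (cong₂ (λ g a → g a) (arr≡ fr₅ count) u₅) (reg≡ fr₅ rC)))
                s₅' : regs τ₅ rS ≡ arrays τ₅ sumOf (regs τ₅ rU) ∸ total (λ i → i) (arrays τ₅ parent) (regs τ₅ rU) (View.D (view τ₅))
                s₅' = trans s₅ (sym (lem (trans (arr≡ fr₅ sumOf) sum₃) par₅ u₅ D₅))
                  where
                  lem : ∀ {s s' q q' : ℕ → ℕ} {a a'} {l l' : List ℕ} → s ≡ s' → q ≡ q' → a ≡ a' → l ≡ l' → s a ∸ total (λ i → i) q a l ≡ s' a' ∸ total (λ i → i) q' a' l'
                  lem refl refl refl refl = refl

                rx₅ : regs τ₅ rX ≡ leaf x
                rx₅ = trans (reg≡ fr₅ rX) (trans (reg≡ fr₃ rX) (trans (reg≡ fr₂ rX) X≡))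

                mark₅ : arrays τ₅ mark ≡ arrays τ₂ mark
                mark₅ = trans (arr≡ fr₅ mark) (arr≡ fr₃ mark)

                rest : Exec W (splitP ⨾ pairP) τ₅ (300 + 200 * t + 300) (Done (suc (suc nx)))
                rest = exec-bind (exec-mono (SplitStep.exec-split x k x≡k τ₅ (≤-trans (s≤s (≤-reflexive nx₅)) (<-trans ≤-refl room)) ch₅ c₅ k₅ s₅')
                    (≤-reflexive (cong (λ a → 300 + 200 * a) t₅)) (λ _ q → q))
                  (λ τ₆ fr₆ (P , cs , tu , le) → exec-mono (exec-frame (Pairing.exec-pair τ₆ (≤-trans (s≤s (≤-trans le (s≤s (≤-reflexive nx₅)))) room)
                      (trans (reg≡ fr₆ rX) rx₅) cs P tu)) ≤-refl
                    (λ τ₇ (fr₇ , T' , cs₇ , le₇) → (T' , cs₇ , ≤-trans le₇ (s≤s (≤-trans le (s≤s (≤-reflexive nx₅)))))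
                      , (λ p → trans (cong (λ g → g p) (trans (arr≡ fr₇ done) (arr≡ fr₆ done))) (zero₅ p))
                      , (λ a → ≤-trans (≤-reflexive (cong (λ g → g a) (trans (arr≡ fr₇ mark) (trans (arr≡ fr₆ mark) mark₅)))) (marks≤ a))))

          exec-reshape : Exec W reshapeP τ₁ (650 + 380 * t) (Done (suc (suc nx)))
          exec-reshape = exec-mono (exec-bind (exec-mark W 1≤W τ₁ (λ a → <-≤-trans (≤-trans (s≤s (≤-reflexive (cong (λ g → g a) (arr≡ fr₁ mark)))) (marks a)) (≤-reflexive (sym (reg≡ fr₁ rX)))))
            (λ τ₂ fr₂ mk → let open AfterMark τ₂ fr₂ mk in
              exec-bind (exec-mono (exec-select W 1≤W τ₂ cand) (≤-reflexive (cong (λ a → 4 + 60 * a) t₂)) (λ _ q → q))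
            (λ τ₃ fr₃ sel → let open AfterSelect τ₃ fr₃ sel in
              exec-bind (wp-sound {W = W} assignP {λ τ → τ ≡ τ₄} τ₃ (tt , (tt , tt) , tt , refl))
            (λ { _ _ refl → exec-bind (exec-mono (exec-reset W 1≤W τ₄ R done₄ sum₄) (≤-reflexive (cong (λ a → 4 + 60 * a) t₃)) (λ _ q → q))
            (λ τ₅ fr₅ (zero₅ , s₅) → AfterReset.rest τ₅ fr₅ zero₅ s₅) }))))
            (≤-trans (≤-reflexive (lem t)) (+-monoˡ-≤ (380 * t) (closed≤ 623 650))) (λ _ q → q)
            where
            lem : ∀ a → (4 + 60 * a) + ((4 + 60 * a) + (11 + ((4 + 60 * a) + (300 + 200 * a + 300)))) ≡ 623 + 380 * a
            lem = solve-∀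

        exec-insert : Exec W insertP σ (1000 + 1000 * length Y) (Done (suc (suc nx)))
        exec-insert = exec-mono (exec-bind (C.exec-close σ refl refl clean refl)
            (λ τ₁ fr₁ (cl , dn≡ , _) → exec-mono (exec-if {W = W} {P₁ = reshapeP} {P₂ = skip} {T' = 1} tt
                (λ ne → Reshaped.exec-reshape τ₁ fr₁ cl dn≡ ne)
                (λ z → wp-sound skip τ₁ (idle τ₁ fr₁ cl dn≡ z)))
              (+-monoʳ-≤ 2 (+-monoˡ-≤ 1 (+-monoʳ-≤ 650 (*-monoʳ-≤ 380 (≤-trans (≤-reflexive (sym (length-slice (arrays τ₁ queue) (regs τ₁ rTail)))) (Closure.small cl)))))) (λ _ q → q)))
          (≤-trans (≤-reflexive (lem (length Y))) (+-mono-≤ {663} {1000} (closed≤ 663 1000) (*-monoˡ-≤ (length Y) (closed≤ 880 1000)))) (λ _ q → q)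
          where
          lem : ∀ a → 10 + 60 * (a + a) + (2 + (650 + 380 * (a + a) + 1)) ≡ 663 + 880 * a
          lem = solve-∀
          idle : ∀ τ₁ → Frame closeP σ τ₁ → Closure n nx par Y (View.D (view τ₁)) → (∀ p → arrays τ₁ done p ≡ occ par p (View.D (view τ₁))) → regs τ₁ rTail ≡ 0 → Done (suc (suc nx)) τ₁
          idle τ₁ fr₁ cl dn≡ z = (lem' (reg≡ fr₁ rNx) (arr≡ fr₁ parent) (arr≡ fr₁ type) (isolate none tree)
              , counted-frame {M} {σ} {τ₁} (arr≡ fr₁ parent) (arr≡ fr₁ count) (arr≡ fr₁ sumOf) counts
              , ≤-trans (≤-reflexive (reg≡ fr₁ rNx)) (≤-trans (n≤1+n nx) (n≤1+n (suc nx))))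
            , (λ p → trans (dn≡ p) (cong (occ par p) D≡[]))
            , (λ a → ≤-trans (≤-reflexive (cong (λ g → g a) (arr≡ fr₁ mark))) (≤-trans (<⇒≤ (marks a)) (≤-reflexive rx)))
            where
            D≡[] : View.D (view τ₁) ≡ []
            D≡[] = cong (slice (arrays τ₁ queue)) z
            none : ∀ v → ¬ Nbr x k v
            none v N with subst (leaf v ∈_) D≡[] (Closure.start cl (Y⇐ N))
            ... | ()
            lem' : ∀ {a a' : ℕ} {p p' q q' : ℕ → ℕ} → a ≡ a' → p ≡ p' → q ≡ q' → Cotree (suc k) 0 a' p' q' → Cotree (suc k) 0 a p q
            lem' refl refl refl T = T

    -- Reading a neighbour list and inserting its vertex

    deg≤n : ∀ v → deg v ≤ n
    deg≤n v = ≤-trans (length≤∣∣ (unique v) (λ _ → ∈⊤)) (∣p∣≤n ⊤ₛ)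

    module _ (x : Fin n) (k : ℕ) (x≡k : toℕ x ≡ k) (rest : List ℕ) where

      record Reading (us : List (Fin n)) (τ : State) : Set where
        field
          reads : Reads len τ (map toℕ us ++ rest)
          left  : regs τ rDeg ≡ length us
          rx    : regs τ rX ≡ leaf x
          uniq  : Unique (View.D (view τ))
          Y⇒    : ∀ {y} → y ∈ View.D (view τ) → ∃[ v ] (y ≡ leaf v × Nbr x k v)
          Y⇐    : ∀ {v} → Nbr x k v → leaf v ∈ View.D (view τ) ⊎ v ∈ us
          todo  : ∀ {v} → v ∈ us → leaf v ∉ View.D (view τ) × x ~ v
          us-uniq : Unique us
          room  : regs τ rTail + length us ≤ deg x

      read-step : ∀ u us τ → Reading (u ∷ us) τ → regs τ rDeg ≢ 0 → Exec W readB τ (time readB) (Reading us)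
      read-step u us τ rd _ = wp-sound readB τ ((tt , 1≤W) , (tt , 1≤W , ≤-trans (≤-reflexive (trans (+-comm _ 1) (cong suc (proj₁ head)))) (≤-trans (leaf≤ u) (<⇒≤ n<W))) ,
          (tt , 1≤W , ≤-trans (proj₂ head) len≤W) , (tt , tt) , push , nopush)
        where
        open Reading rd
        head = reads-head {len} {τ} reads
        a = arrays τ input (regs τ rPos) + 1
        a≡ : a ≡ leaf u
        a≡ = trans (+-comm _ 1) (cong suc (proj₁ head))
        q = arrays τ queue
        t = regs τ rTail
        t<n : t + 1 ≤ n
        t<n = ≤-trans (≤-trans (+-monoʳ-≤ t (s≤s z≤n)) room) (deg≤n x)
        deg' : regs τ rDeg ∸ 1 ≡ length us
        deg' = cong (_∸ 1) left
        σ₁ = setReg rPos (regs τ rPos + 1) (setReg rA a (setReg rDeg (regs τ rDeg ∸ 1) τ))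
        push : regs τ rX ∸ a ≢ 0 → wp W (queue [ reg rTail ]:= reg rA ⨾ rTail := reg rTail ⊕ const 1) (Reading us) σ₁
        push nz = tt , tt , (tt , 1≤W , ≤-trans t<n (<⇒≤ n<W)) , record
          { reads = reads-tail {len} {τ} {setReg rTail (t + 1) (setCell queue t a σ₁)} refl refl reads ; left = deg' ; rx = rx
          ; uniq = subst Unique (sym D≡) (unique-cons (λ m → proj₁ (todo (here refl)) m) uniq)
          ; Y⇒ = λ {y} m → old (subst (y ∈_) D≡ m)
          ; Y⇐ = λ {v} N → new N (Y⇐ N)
          ; todo = λ {v} m → (λ m' → fresh m (subst (leaf v ∈_) D≡ m')) , proj₂ (todo (there m))
          ; us-uniq = unique-tail us-uniq
          ; room = ≤-trans (≤-reflexive (+-assoc t 1 (length us))) room }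
          where
          D≡ : slice (q [ t ↦ a ]) (t + 1) ≡ leaf u ∷ slice q t
          D≡ = trans (cong (slice (q [ t ↦ a ])) (+-comm t 1)) (trans (slice-push q t a) (cong (_∷ slice q t) a≡))
          u<k : toℕ u < k
          u<k = ≤-pred (≤-trans (≰⇒> (λ le → nz (m≤n⇒m∸n≡0 (≤-trans (≤-reflexive rx) (≤-trans le (≤-reflexive (sym a≡))))))) (s≤s (≤-reflexive x≡k)))
          old : ∀ {y} → y ∈ leaf u ∷ slice q t → ∃[ v ] (y ≡ leaf v × Nbr x k v)
          old (here e) = u , e , proj₂ (todo (here refl)) , u<k
          old (there m) = Y⇒ m
          new : ∀ {v} → Nbr x k v → leaf v ∈ slice q t ⊎ v ∈ u ∷ us → leaf v ∈ slice (q [ t ↦ a ]) (t + 1) ⊎ v ∈ us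
          new {v} N (inj₁ m) = inj₁ (subst (leaf v ∈_) (sym D≡) (there m))
          new {v} N (inj₂ (here refl)) = inj₁ (subst (leaf v ∈_) (sym D≡) (here refl))
          new N (inj₂ (there m)) = inj₂ m
          fresh : ∀ {v} → v ∈ us → leaf v ∉ leaf u ∷ slice q t
          fresh m (here e) = unique-head us-uniq (subst (_∈ us) (leaf-injective e) m)
          fresh m (there m') = proj₁ (todo (there m)) m'
        nopush : regs τ rX ∸ a ≡ 0 → Reading us σ₁
        nopush z = record
          { reads = reads-tail {len} {τ} {σ₁} refl refl reads ; left = deg' ; rx = rx ; uniq = uniq ; Y⇒ = Y⇒
          ; Y⇐ = λ {v} N → dismiss N (Y⇐ N) ; todo = λ m → todo (there m) ; us-uniq = unique-tail us-uniq
          ; room = ≤-trans (+-monoʳ-≤ t (n≤1+n (length us))) room }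
          where
          dismiss : ∀ {v} → Nbr x k v → leaf v ∈ slice q t ⊎ v ∈ u ∷ us → leaf v ∈ slice q t ⊎ v ∈ us
          dismiss N (inj₁ m) = inj₁ m
          dismiss N (inj₂ (there m)) = inj₂ m
          dismiss (_ , lt) (inj₂ (here refl)) = ⊥-elim (<⇒≱ lt (≤-trans (≤-reflexive (sym x≡k)) (≤-pred (≤-trans (≤-reflexive (sym rx)) (≤-trans (m∸n≡0⇒m≤n z) (≤-reflexive a≡))))))

      exec-load : ∀ σ → regs σ rX ≡ k → Reads len σ (deg x ∷ map toℕ (neighbours x) ++ rest) →
        Exec W loadP σ (20 + 40 * deg x) (λ τ → Reading [] τ)
      exec-load σ rx rd = exec-mono (exec-bind {W = W} (wp-sound {W = W} (rX := reg rX ⊕ const 1 ⨾ rDeg := input ! reg rPos ⨾ rPos := reg rPos ⊕ const 1 ⨾ rTail := const 0) {λ τ → τ ≡ σ₁} σ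
          ((tt , 1≤W , ≤-trans (≤-reflexive x+1) (≤-trans (leaf≤ x) (<⇒≤ n<W))) , tt , (tt , 1≤W , ≤-trans (proj₂ head) len≤W) , z≤n , refl))
          (λ { _ _ refl → exec-while Reading (reg rDeg) (λ _ → time readB) (λ _ _ _ → tt) (λ τ r → Reading.left r) read-step (neighbours x) σ₁ init }))
        (≤-trans (≤-reflexive (cong (13 +_) (totalCost-const 2 (time readB) (neighbours x)))) (+-mono-≤ {15} {20} (closed≤ 15 20) (*-monoˡ-≤ (deg x) (closed≤ (2 + time readB) 40))))
        (λ τ (l , r , z) → subst (λ us → Reading us τ) (empty l (trans (sym (Reading.left r)) z)) r)
        where
        head = reads-head {len} {σ} rd
        x+1 : regs σ rX + 1 ≡ leaf x
        x+1 = trans (+-comm _ 1) (cong suc (trans rx (sym x≡k)))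
        σ₁ = setReg rTail 0 (setReg rPos (regs σ rPos + 1) (setReg rDeg (arrays σ input (regs σ rPos)) (setReg rX (regs σ rX + 1) σ)))
        init : Reading (neighbours x) σ₁
        init = record { reads = reads-tail {len} {σ} {σ₁} refl refl rd ; left = proj₁ head ; rx = x+1 ; uniq = [] ; Y⇒ = λ ()
          ; Y⇐ = λ {v} (a , _) → inj₂ (Equivalence.from (correct x v) a) ; todo = λ {v} m → (λ ()) , Equivalence.to (correct x v) m ; us-uniq = unique x ; room = ≤-refl }
        empty : ∀ (l : List (Fin n)) → length l ≡ 0 → l ≡ []
        empty [] e = refl


    record Ready (k : ℕ) (τ : State) : Set where
      field
        tree   : Cotree k 0 (regs τ rNx) (arrays τ parent) (arrays τ type)
        counts : Counted M τ
        clean  : ∀ p → arrays τ done p ≡ 0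
        marks  : ∀ a → arrays τ mark a ≤ k
        rx     : regs τ rX ≡ k
        rn     : regs τ rN ≡ n
        nx≤    : regs τ rNx ≤ suc n + (k + k)

    exec-vertex : ∀ x k → toℕ x ≡ k → suc n + (k + k) + 2 ≤ M → ∀ rest σ → Ready k σ → Reads len σ (deg x ∷ map toℕ (neighbours x) ++ rest) →
      Exec W vertexP σ (1100 + 1100 * deg x) (λ τ → Ready (suc k) τ × Reads len τ rest)
    exec-vertex x k x≡k room rest σ rdy rd = exec-mono (exec-bind (exec-load x k x≡k rest σ rx rd)
        (λ τ fr r → exec-mono (exec-frame (Choosing.exec-insert x k x≡k τ (nx-room fr) (loaded τ fr r)))
          (+-monoʳ-≤ 1000 (*-monoʳ-≤ 1000 (≤-trans (≤-reflexive (length-slice _ _)) (≤-trans (m≤m+n _ 0) (Reading.room r)))))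
          (λ τ' (fr' , (T' , cs' , le') , zero' , mk') → record
            { tree = T' ; counts = cs' ; clean = zero' ; marks = λ a → ≤-trans (mk' a) (≤-reflexive (cong suc x≡k))
            ; rx = trans (reg≡ fr' rX) (trans (Reading.rx r) (cong suc x≡k)) ; rn = trans (reg≡ fr' rN) (trans (reg≡ fr rN) rn)
            ; nx≤ = ≤-trans le' (≤-trans (s≤s (s≤s (≤-trans (≤-reflexive (reg≡ fr rNx)) nx≤))) (≤-reflexive (lem n k))) }
            , (λ i → trans (cong₂ (λ f p → f (p + i)) (arr≡ fr' input) (reg≡ fr' rPos)) (proj₁ (Reading.reads r) i))
            , trans (cong (_+ length rest) (reg≡ fr' rPos)) (proj₂ (Reading.reads r)))))
      (≤-trans (≤-reflexive (lem' (deg x))) (+-mono-≤ (closed≤ 1020 1100) (*-monoˡ-≤ (deg x) (closed≤ 1040 1100)))) (λ _ q → q)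
      where
      open Ready rdy
      lem : ∀ n k → suc (suc (suc n + (k + k))) ≡ suc n + (suc k + suc k)
      lem = solve-∀
      lem' : ∀ d → 20 + 40 * d + (1000 + 1000 * d) ≡ 1020 + 1040 * d
      lem' = solve-∀
      nx-room : ∀ {τ} → Frame loadP σ τ → suc (regs τ rNx) < M
      nx-room fr = ≤-trans (≤-trans (≤-reflexive (+-comm 2 _)) (+-monoˡ-≤ 2 (≤-trans (≤-reflexive (reg≡ fr rNx)) nx≤))) room
      loaded : ∀ τ → Frame loadP σ τ → Reading x k x≡k rest [] τ → Loaded x k x≡k τ
      loaded τ fr r = record
        { tree = lem3 (reg≡ fr rNx) (arr≡ fr parent) (arr≡ fr type) tree
        ; counts = counted-frame {M} {σ} {τ} (arr≡ fr parent) (arr≡ fr count) (arr≡ fr sumOf) counts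
        ; clean = λ p → trans (cong (λ f → f p) (arr≡ fr done)) (clean p)
        ; marks = λ a → ≤-trans (s≤s (≤-trans (≤-reflexive (cong (λ f → f a) (arr≡ fr mark))) (marks a))) (≤-reflexive (trans (cong suc (sym x≡k)) (sym (Reading.rx r))))
        ; rx = Reading.rx r ; uniq = Reading.uniq r ; Y⇒ = Reading.Y⇒ r ; Y⇐ = λ N → [ (λ m → m) , (λ ()) ]′ (Reading.Y⇐ r N) }
        where
        lem3 : ∀ {a a' : ℕ} {p p' q q' : ℕ → ℕ} → a ≡ a' → p ≡ p' → q ≡ q' → Cotree k 0 a' p' q' → Cotree k 0 a p q
        lem3 refl refl refl T = T

    -- Evaluating the nodes in queue order

    module Collecting {nx : ℕ} {par typ q : ℕ → ℕ} {t : ℕ} (T : Cotree n 0 nx par typ) (t≤W : t ≤ W)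
      {Y : List ℕ} (cl : Closure n nx par Y (slice q t)) (Y-all : ∀ v → leaf v ∈ Y) (Y-leaf : ∀ {y} → y ∈ Y → ∃[ v ] y ≡ leaf v)
      (order : ∀ j → j < t → n < q j → ∀ c → par c ≡ q j → c ∈ slice q j) where
      open Cotree T

      D = slice q t

      D-node : ∀ {d} → d ∈ D → d ≢ 0 × d < nx
      D-node m with Closure.kind cl m
      ... | inj₂ (p , lt) = inner≢0 p , lt
      ... | inj₁ y with Y-leaf y
      ...   | v , refl = (λ ()) , ≤-trans (s≤s (leaf≤ v)) n<nx

      -- Started from all leaves, the closure contains every node in use except the root, by
      -- induction on the rank: the children of an inner node have smaller rank.
      D-all : ∀ k {c} → rank c ≤ k → c ≢ 0 → c < nx → c ∈ D
      D-all k {c} le nz lt with c ≤? n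
      ... | yes c≤n with leaf-of nz c≤n
      ...   | v , refl = Closure.start cl (Y-all v)
      D-all zero {c} le nz lt | no c≰n with other-child (≰⇒> c≰n) lt 0
      ... | d , pd , nd = ⊥-elim (<⇒≱ (rank< nd) (≤-trans (≤-trans (≤-reflexive (cong rank pd)) le) z≤n))
      D-all (suc k) {c} le nz lt | no c≰n = Closure.up cl (≰⇒> c≰n) lt λ d pd →
        let (nd , d<) = child-node pd nz in D-all k (≤-pred (≤-trans (rank< nd) (≤-trans (≤-reflexive (cong rank pd)) le))) nd d<

      children-before : ∀ i → i ≤ t → ∀ {d c} → d ∈ slice q i → par c ≡ d → c ∈ slice q i
      children-before i le {d} {c} m pc with ∈-slice⁻ q i m
      ... | j , j<i , refl with Closure.kind cl (slice-⊆ q le m)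
      ...   | inj₂ (nj , _) = slice-⊆ q (<⇒≤ j<i) (order j (<-≤-trans j<i le) nj c pc)
      ...   | inj₁ y with Y-leaf y
      ...     | v , e = ⊥-elim (childless v c (trans pc e))

      down-closed : ∀ i → i ≤ t → ∀ {c d} → d ∈ slice q i → par ⊢ c ⊑ d → c ∈ slice q i
      down-closed i le m stay = m
      down-closed i le m (step nz p) = children-before i le (down-closed i le m p) refl

      -- `own v` is the lowest ancestor of `v` that has not been processed; this is what
      -- `above-leaf`, `pending` and `lowest` say together.
      record Inv (l : List ⊤) (τ : State) : Set where
        field
          own  : Fin n → ℕ
          par≡ : arrays τ parent ≡ par
          typ≡ : arrays τ type ≡ typ
          q≡   : arrays τ queue ≡ q
          t≡   : regs τ rTail ≡ t
          fuel : regs τ rI + length l ≡ t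
          above-leaf : ∀ v → par ⊢ leaf v ⊑ own v
          pending : ∀ v → own v ∉ slice q (regs τ rI)
          lowest  : ∀ {v a} → par ⊢ leaf v ⊑ a → a ∉ slice q (regs τ rI) → par ⊢ own v ⊑ a
          slots   : ∀ a → a ∉ slice q (regs τ rI) → Slot own τ a

      step-inv : ∀ l τ → Inv (tt ∷ l) τ → regs τ rTail ∸ regs τ rI ≢ 0 → Exec W mergeB τ (time mergeB) (Inv l)
      step-inv l τ inv _ = exec-bind {W = W} (wp-sound {W = W} (rA := queue ! reg rI ⨾ rI := reg rI ⊕ const 1 ⨾ rP := parent ! reg rA) {λ τ' → τ' ≡ σ₁} τ
          (tt , (tt , 1≤W , ≤-trans (≤-trans (≤-reflexive (+-comm i 1)) i<t) t≤W) , tt , refl))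
        λ { _ _ refl → exec-mono (exec-frame MS.exec-merge) ≤-refl next }
        where
        open Inv inv
        i = regs τ rI
        a = arrays τ queue i
        p = arrays τ parent a
        σ₁ = setReg rP p (setReg rI (i + 1) (setReg rA a τ))
        i<t : i < t
        i<t = ≤-trans (m≤m+n (suc i) (length l)) (≤-reflexive (trans (sym (+-suc i (length l))) fuel))
        a≡ : a ≡ q i
        a≡ = cong (λ f → f i) q≡
        p≡ : p ≡ par a
        p≡ = cong (λ f → f a) par≡
        P = slice q i
        a∈D : a ∈ slice q (suc i)
        a∈D = here a≡
        a-node = D-node (slice-⊆ q i<t a∈D)
        a∉P : a ∉ P
        a∉P m = unique-head (slice-unique q i<t (Closure.unique cl)) (subst (_∈ P) a≡ m)
        below-P : ∀ {c} → par c ≡ a → c ∈ P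
        below-P {c} pc with children-before (suc i) i<t a∈D pc
        ... | there m = m
        ... | here e = ⊥-elim (<⇒≢ (rank< (λ e0 → proj₁ a-node (trans (sym pc) (trans (cong par e0) par0)))) (cong rank (trans e (trans (sym a≡) (sym pc)))))
        p∉P : p ∉ P
        p∉P m = a∉P (children-before i (<⇒≤ i<t) m (sym p≡))
        p≢a : p ≢ a
        p≢a e = <⇒≢ (rank< (proj₁ a-node)) (cong rank (trans (sym e) p≡))
        own' : Fin n → ℕ
        own' v with own v ≟ a
        ... | yes _ = p
        ... | no _ = own v
        changed : ∀ {v} → own v ≡ a → own' v ≡ p
        changed {v} e with own v ≟ a
        ... | yes _ = refl
        ... | no ne = ⊥-elim (ne e)
        unchanged : ∀ {v} → own v ≢ a → own' v ≡ own v
        unchanged {v} ne with own v ≟ a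
        ... | yes e = ⊥-elim (ne e)
        ... | no _ = refl
        best-a : Best (λ v → own v ≡ a) (arrays τ nxt) (arrays τ gam a) (arrays τ iso a) (arrays τ hd a) (arrays τ tl a)
        best-a = pick (slots a a∉P)
          where
          pick : Slot own τ a → _
          pick (inj₂ b) = b
          -- The record of `a` is not empty: otherwise the owner of a leaf below `a` would lie at or
          -- below a child of `a`, but all of these have been processed.
          pick (inj₁ (_ , _ , none)) with some-leaf (proj₁ a-node) (proj₂ a-node)
          ... | v , r = ⊥-elim (pending v (outside-child (⊑-last (lowest r a∉P) (none v))))
            where
            outside-child : ∃[ d ] (par d ≡ a × d ≢ 0 × par ⊢ own v ⊑ d) → own v ∈ P
            outside-child (d , pd , _ , r') = down-closed i (<⇒≤ i<t) (below-P pd) r'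
        -- A vertex owned by `p` lies below a child of `p` other than `a`, so the type of `p`
        -- decides its adjacency to the vertices owned by `a`.
        adjacent : ∀ {v w} → own v ≡ p → own w ≡ a → Agrees (arrays τ type p) (λ w → v ~ w) w × v ≢ w
        adjacent {v} {w} ev ew with leaf-below-parent {v} {p} {a} (sym p≡) (subst (par ⊢ leaf v ⊑_) ev (above-leaf v))
        ... | d , pd , nd , r = ((λ t → proj₁ (f (trans tp t))) , (λ e → trans (sym tp) (g (e , Fin.toℕ<n v , Fin.toℕ<n w)))) , (λ { refl → p≢a (trans (sym ev) ew) })
          where
          d≢a : d ≢ a
          d≢a refl = parent-above (proj₁ a-node) refl (subst (λ c → par ⊢ c ⊑ a) (trans ev p≡) (lowest r a∉P))
          ag = adj nd (proj₁ a-node) d≢a (trans pd p≡) r (subst (par ⊢ leaf w ⊑_) ew (above-leaf w))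
          f = proj₁ ag
          g = proj₂ ag
          tp : typ (par d) ≡ arrays τ type p
          tp = trans (cong typ pd) (cong (λ h → h p) (sym typ≡))
        module MS = MergeStep W 1≤W n<W own own' σ₁ p≢a changed unchanged (slots p p∉P) best-a
          (λ nz {v} {w} ev ew → proj₁ (proj₁ (adjacent {v} {w} ev ew)) (trans (cong (λ h → h p) typ≡) (zero-or-one p (λ z → nz (trans (cong (λ h → h p) typ≡) z)))))
          (λ z {v} {w} ev ew → proj₂ (adjacent {v} {w} ev ew) , λ e → 0≢1+n (trans (sym z) (proj₂ (proj₁ (adjacent {v} {w} ev ew)) e)))
        i₁ : ∀ {τ'} → Frame mergeP σ₁ τ' → regs τ' rI ≡ suc i
        i₁ fr = trans (reg≡ fr rI) (+-comm i 1)
        next : ∀ τ' → Frame mergeP σ₁ τ' × MS.Post τ' → Inv l τ'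
        next τ' (fr , po) = record
          { own = own' ; par≡ = trans (arr≡ fr parent) par≡ ; typ≡ = trans (arr≡ fr type) typ≡ ; q≡ = trans (arr≡ fr queue) q≡ ; t≡ = trans (reg≡ fr rTail) t≡
          ; fuel = trans (cong (_+ length l) (i₁ fr)) (trans (sym (+-suc i (length l))) fuel)
          ; above-leaf = abv ; pending = λ v m → pend v (now m) ; lowest = λ r m → low' r (λ m' → m (sym-now m'))
          ; slots = λ b m → po b (λ { refl → m (sym-now a∈D) }) (slots b (λ m' → m (sym-now (there m')))) }
          where
          now : ∀ {c} → c ∈ slice q (regs τ' rI) → c ∈ slice q (suc i)
          now {c} = subst (λ j → c ∈ slice q j) (i₁ fr)
          sym-now : ∀ {c} → c ∈ slice q (suc i) → c ∈ slice q (regs τ' rI)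
          sym-now {c} = subst (λ j → c ∈ slice q j) (sym (i₁ fr))
          abv : ∀ v → par ⊢ leaf v ⊑ own' v
          abv v with own v ≟ a
          ... | yes e = ⊑-trans (subst (par ⊢ leaf v ⊑_) e (above-leaf v)) (step (proj₁ a-node) (subst (λ c → par ⊢ par a ⊑ c) (sym p≡) stay))
          ... | no _ = above-leaf v
          pend : ∀ v → own' v ∉ slice q (suc i)
          pend v m with own v ≟ a
          pend v (here e) | yes _ = p≢a (trans e (sym a≡))
          pend v (there m) | yes _ = p∉P m
          pend v (here e) | no ne = ne (trans e (sym a≡))
          pend v (there m) | no ne = pending v m
          low' : ∀ {v b} → par ⊢ leaf v ⊑ b → b ∉ slice q (suc i) → par ⊢ own' v ⊑ b
          low' {v} {b} r m with own v ≟ a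
          ... | no _ = lowest r (λ m' → m (there m'))
          ... | yes e = subst (λ c → par ⊢ c ⊑ b) (sym p≡) (⊑-step⁻ (subst (λ c → par ⊢ c ⊑ b) e (lowest r (λ m' → m (there m')))) (λ { refl → m a∈D }))

      exec-collect : ∀ σ → arrays σ parent ≡ par → arrays σ type ≡ typ → arrays σ queue ≡ q → regs σ rTail ≡ t → (∀ a → Slot leaf σ a) →
        Exec W collectP σ (10 + 200 * t) (λ τ → ∃[ own ] ((∀ v → own v ≡ 0) × Slot own τ 0))
      exec-collect σ pe te qe le sl = exec-mono (exec-seq (wp-sound (rI := const 0) σ (z≤n ,
          exec-while {A = ⊤} Inv (reg rTail ⊖ reg rI) (λ _ → time mergeB) (λ _ _ _ → tt , tt) stop (λ { tt l τ j g → step-inv l τ j g }) (replicate t tt) _ init)))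
        (≤-trans (≤-reflexive (cong (2 +_) (trans (totalCost-const 4 (time mergeB) (replicate t tt)) (cong (λ k → 4 + (4 + time mergeB) * k) (length-replicate t)))))
          (+-mono-≤ {6} {10} (closed≤ 6 10) (*-monoˡ-≤ t (closed≤ (4 + time mergeB) 200)))) fin
        where
        init : Inv (replicate t tt) (setReg rI 0 σ)
        init = record { own = leaf ; par≡ = pe ; typ≡ = te ; q≡ = qe ; t≡ = le ; fuel = length-replicate t ; above-leaf = λ v → stay ; pending = λ v ()
          ; lowest = λ r _ → r ; slots = λ a _ → sl a }
        stop : ∀ τ → Inv [] τ → regs τ rTail ∸ regs τ rI ≡ 0
        stop τ inv = m≤n⇒m∸n≡0 (≤-reflexive (trans (Inv.t≡ inv) (trans (sym (Inv.fuel inv)) (+-identityʳ _))))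
        fin : ∀ τ → ∃[ l ] (Inv l τ × regs τ rTail ∸ regs τ rI ≡ 0) → ∃[ own ] ((∀ v → own v ≡ 0) × Slot own τ 0)
        fin τ (l , inv , z) = own , root , slots 0 (λ m → proj₁ (D-node (all⊆ m)) refl)
          where
          open Inv inv
          t≡i : regs τ rI ≡ t
          t≡i = ≤-antisym (≤-trans (m≤m+n _ (length l)) (≤-reflexive fuel)) (≤-trans (≤-reflexive (sym t≡)) (m∸n≡0⇒m≤n z))
          all⊆ : ∀ {c} → c ∈ slice q (regs τ rI) → c ∈ D
          all⊆ {c} = subst (λ j → c ∈ slice q j) t≡i
          root : ∀ v → own v ≡ 0
          root v with own v ≟ 0
          ... | yes e = e
          ... | no ne = ⊥-elim (pending v (subst (λ j → own v ∈ slice q j) (sym t≡i) (D-all _ ≤-refl ne (own<nx (leaf-below (above-leaf v))))))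
            where
            own<nx : own v ≡ leaf v ⊎ (∃[ d ] (par d ≡ own v × d ≢ 0 × par ⊢ leaf v ⊑ d)) → own v < nx
            own<nx (inj₁ e) = ≤-trans (s≤s (≤-trans (≤-reflexive e) (leaf≤ v))) n<nx
            own<nx (inj₂ (d , pd , _)) = proj₂ (parent-inner pd ne)

    -- Initialisation and the loop over all vertices

    block : Fin n → List ℕ
    block v = deg v ∷ map toℕ (neighbours v)

    empty-tree : Cotree 0 0 (suc n) (λ _ → 0) (λ _ → 0)
    empty-tree = record
      { core = record { rank = rk ; rank< = rk< ; par0 = refl ; childless = λ v c () ; adj = λ nd nd' ne e p p' → (λ ()) , λ { (_ , () , _) } }
      ; low = λ c → inj₁ refl ; fresh = λ c _ → refl ; n<nx = ≤-refl ; binary = λ _ → z≤n ; typ0 = refl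
      ; alt = λ a na an → ⊥-elim (<⇒≱ na (≤-pred an)) ; two = λ a na an → ⊥-elim (<⇒≱ na (≤-pred an)) ; outside = λ _ _ → refl }
      where
      rk : ℕ → ℕ
      rk zero = 1
      rk (suc _) = 0
      rk< : ∀ {c} → c ≢ 0 → rk c < 1
      rk< {zero} ne = ⊥-elim (ne refl)
      rk< {suc c} _ = ≤-refl


    Zeroed : State → Set
    Zeroed τ = (∀ a → arrays τ gam a ≡ 0) × (∀ a → arrays τ hd a ≡ 0)

    exec-init : ∀ enc → let l = n ∷ enc in 1 + length enc ≡ len →
      Exec W initP (initial l) (40 + 40 * M) (λ τ → Ready 0 τ × Reads len τ enc × Zeroed τ)
    exec-init enc le = exec-mono (exec-frame (exec-bind {W = W} (wp-sound {W = W} (rN := input ! const 0 ⨾ rPos := const 1 ⨾ rNx := reg rN ⊕ const 1 ⨾ rA := (reg rN ⊕ reg rN) ⊕ (reg rN ⊕ const 3)) {λ τ → τ ≡ σ₁} σ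
          (z≤n , 1≤W , (tt , 1≤W , ≤-trans (≤-reflexive (+-comm n 1)) n<W) ,
            ((tt , tt , ≤-trans (m≤m+n (n + n) (n + 3)) M≤W) , (tt , ≤-trans (≤-trans (m≤n+m 3 n) (m≤n+m (n + 3) (n + n))) M≤W , ≤-trans (m≤n+m (n + 3) (n + n)) M≤W) , M≤W) , refl))
        (λ { _ _ refl → exec-while {A = ⊤} Inv (reg rA ⊖ reg rI) (λ _ → 16) (λ _ _ _ → tt , tt) (λ τ (_ , _ , e , f , _) → m≤n⇒m∸n≡0 (≤-trans (≤-reflexive e) (≤-trans (≤-reflexive (sym f)) (≤-reflexive (+-identityʳ _)))))
            (λ { tt l τ j g → iterate l τ j }) (replicate M tt) σ₁ ((λ p → refl) , (λ p → refl) , refl , length-replicate M , refl , refl) })))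
      (≤-trans (≤-reflexive (cong (17 +_) (trans (totalCost-const 4 16 (replicate M tt)) (cong (λ k → 4 + 20 * k) (length-replicate M))))) (+-mono-≤ {21} {40} (closed≤ 21 40) (*-monoˡ-≤ M (closed≤ 20 40))))
      fin
      where
      σ = initial (n ∷ enc)
      σ₁ = setReg rA M (setReg rNx (n + 1) (setReg rPos 1 (setReg rN n σ)))
      zeros : ℕ → ℕ
      zeros _ = 0
      Inv : List ⊤ → State → Set
      Inv l τ = (∀ p → arrays τ count p ≡ occ zeros p (ids (regs τ rI))) × (∀ p → arrays τ sumOf p ≡ total (λ i → i) zeros p (ids (regs τ rI)))
        × regs τ rA ≡ M × regs τ rI + length l ≡ M × regs τ rN ≡ n × (regs τ rX , regs τ rPos , regs τ rNx) ≡ (0 , 1 , n + 1)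
      iterate : ∀ l τ → Inv (tt ∷ l) τ → Exec W _ τ 16 (Inv l)
      iterate l τ (c , s , a , f , en , es) = wp-sound (count [ const 0 ]:= count ! const 0 ⊕ const 1 ⨾ sumOf [ const 0 ]:= sumOf ! const 0 ⊕ reg rI ⨾ rI := reg rI ⊕ const 1) τ
          (z≤n , (z≤n , 1≤W , ≤-trans (≤-reflexive c0) (≤-trans (occ-ids≤ zeros 0 (suc i)) (≤-trans i<M M≤W))) , z≤n ,
            (z≤n , tt , ≤-trans (≤-reflexive s0) (≤-trans (total-id≤ zeros 0 (suc i)) (≤-trans (*-mono-≤ i<M i<M) MM≤W))) ,
            (tt , 1≤W , ≤-trans (≤-reflexive (+-comm i 1)) (≤-trans i<M M≤W)) ,
            c' , s' , a , trans (cong (_+ length l) (+-comm i 1)) (trans (sym (+-suc i (length l))) f) , en , es)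
        where
        i = regs τ rI
        i<M : suc i ≤ M
        i<M = ≤-trans (m≤m+n (suc i) (length l)) (≤-reflexive (trans (sym (+-suc i (length l))) f))
        c0 : arrays τ count 0 + 1 ≡ occ zeros 0 (ids (suc i))
        c0 = trans (+-comm _ 1) (cong suc (c 0))
        s0 : arrays τ sumOf 0 + i ≡ total (λ i → i) zeros 0 (ids (suc i))
        s0 = trans (+-comm _ i) (cong (i +_) (s 0))
        ids≡ : ids (i + 1) ≡ ids (suc i)
        ids≡ = cong ids (+-comm i 1)
        c' : ∀ p → (arrays τ count [ 0 ↦ arrays τ count 0 + 1 ]) p ≡ occ zeros p (ids (i + 1))
        c' zero = trans c0 (cong (occ zeros 0) (sym ids≡))
        c' (suc p) = trans (c (suc p)) (cong (occ zeros (suc p)) (sym ids≡))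
        s' : ∀ p → (arrays τ sumOf [ 0 ↦ arrays τ sumOf 0 + i ]) p ≡ total (λ i → i) zeros p (ids (i + 1))
        s' zero = trans s0 (cong (total (λ i → i) zeros 0) (sym ids≡))
        s' (suc p) = trans (s (suc p)) (cong (total (λ i → i) zeros (suc p)) (sym ids≡))
      fin : ∀ τ → Frame initP σ τ × ∃[ l ] (Inv l τ × regs τ rA ∸ regs τ rI ≡ 0) → Ready 0 τ × Reads len τ enc × Zeroed τ
      fin τ (fr , l , (c , s , a , f , en , es) , z) = record
          { tree = lem nx≡ (arr≡ fr parent) (arr≡ fr type) empty-tree
          ; counts = (λ p → trans (c p) (cong₂ (λ q i → occ q p (ids i)) (sym (arr≡ fr parent)) i≡M)) , (λ p → trans (s p) (cong₂ (λ q i → total (λ i → i) q p (ids i)) (sym (arr≡ fr parent)) i≡M))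
          ; clean = λ p → cong (λ g → g p) (arr≡ fr done) ; marks = λ p → ≤-reflexive (cong (λ g → g p) (arr≡ fr mark))
          ; rx = cong proj₁ es ; rn = en ; nx≤ = ≤-reflexive (trans nx≡ (sym (+-identityʳ (suc n)))) }
        , ((λ i → trans (cong₂ (λ g p → g (p + i)) (arr≡ fr input) pos≡) refl) , trans (cong (_+ length enc) pos≡) le)
        , ((λ p → cong (λ g → g p) (arr≡ fr gam)) , (λ p → cong (λ g → g p) (arr≡ fr hd)))
        where
        pos≡ : regs τ rPos ≡ 1
        pos≡ = cong (proj₁ ∘ proj₂) es
        nx≡ : regs τ rNx ≡ suc n
        nx≡ = trans (cong (proj₂ ∘ proj₂) es) (+-comm n 1)
        i≡M : regs τ rI ≡ M
        i≡M = ≤-antisym (≤-trans (m≤m+n _ (length l)) (≤-reflexive f)) (≤-trans (≤-reflexive (sym a)) (m∸n≡0⇒m≤n z))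
        lem : ∀ {a a' : ℕ} {p p' q q' : ℕ → ℕ} → a ≡ a' → p ≡ p' → q ≡ q' → Cotree 0 0 a' p' q' → Cotree 0 0 a p q
        lem refl refl refl T = T

    exec-vertices : ∀ σ → Ready 0 σ → Reads len σ (concatMap block (allFin n)) → Zeroed σ →
      Exec W vertices σ (totalCost 4 (λ v → 1100 + 1100 * deg v) (allFin n)) (λ τ → Ready n τ × Zeroed τ)
    exec-vertices σ rdy rd (z , z') = exec-mono (exec-frame (exec-while Inv (reg rN ⊖ reg rX) (λ v → 1100 + 1100 * deg v) (λ _ _ _ → tt , tt) stop iterate (allFin n) σ (0 , from-allFin n , rdy , rd))) ≤-refl fin
      where
      Inv : List (Fin n) → State → Set
      Inv vs τ = ∃[ k ] (From k vs × Ready k τ × Reads len τ (concatMap block vs))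
      stop : ∀ τ → Inv [] τ → regs τ rN ∸ regs τ rX ≡ 0
      stop τ (_ , [] , r , _) = m≤n⇒m∸n≡0 (≤-reflexive (trans (Ready.rn r) (sym (Ready.rx r))))
      iterate : ∀ v vs τ → Inv (v ∷ vs) τ → regs τ rN ∸ regs τ rX ≢ 0 → Exec W vertexP τ (1100 + 1100 * deg v) (Inv vs)
      iterate v vs τ (k , (e ∷ fr) , r , rd) _ = exec-mono (exec-vertex v k e room (concatMap block vs) τ r rd) ≤-refl (λ τ' (r' , rd') → suc k , fr , r' , rd')
        where
        lem : ∀ n k → suc n + (k + k) + 2 ≡ (suc k + suc k) + (n + 1)
        lem = solve-∀
        k<n : suc k ≤ n
        k<n = ≤-trans (≤-reflexive (cong suc (sym e))) (Fin.toℕ<n v)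
        room : suc n + (k + k) + 2 ≤ M
        room = ≤-trans (≤-reflexive (lem n k)) (+-mono-≤ (+-mono-≤ k<n k<n) (+-monoʳ-≤ n (closed≤ 1 3)))
      fin : ∀ τ → Frame vertices σ τ × ∃[ vs ] (Inv vs τ × regs τ rN ∸ regs τ rX ≡ 0) → Ready n τ × Zeroed τ
      fin τ (fr , vs , (k , f , r , _) , z₀) = subst (λ k → Ready k τ) (k≡n f) r , (λ a → trans (cong (λ g → g a) (arr≡ fr gam)) (z a)) , (λ a → trans (cong (λ g → g a) (arr≡ fr hd)) (z' a))
        where
        k≡n : ∀ {vs} → From k vs → k ≡ n
        k≡n [] = refl
        k≡n (_∷_ {v = v} e _) = ⊥-elim (<⇒≱ (≤-trans (≤-reflexive (cong suc (sym e))) (Fin.toℕ<n v)) (≤-trans (≤-reflexive (sym (Ready.rn r))) (≤-trans (m∸n≡0⇒m≤n z₀) (≤-reflexive (Ready.rx r)))))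

    -- From the cotree to the output

    Seeded : ℕ → State → ℕ → Set
    Seeded i τ a = ((1 ≤ a × a ≤ i) × arrays τ gam a ≡ 1 × arrays τ iso a ≡ 1 × arrays τ hd a ≡ a × arrays τ tl a ≡ a)
      ⊎ (¬ (1 ≤ a × a ≤ i) × arrays τ gam a ≡ 0 × arrays τ hd a ≡ 0)

    exec-seed : ∀ σ → regs σ rN ≡ n → Zeroed σ → Exec W seedP σ (10 + 40 * n)
      (λ τ → regs τ rTail ≡ n × slice (arrays τ queue) (regs τ rTail) ≡ slice suc n × (∀ a → Slot leaf τ a))
    exec-seed σ rn (zg , zh) = exec-mono (exec-seq (wp-sound (rTail := const 0) σ (z≤n ,
        exec-while {A = ⊤} Inv (reg rN ⊖ reg rTail) (λ _ → time seedB) (λ _ _ _ → tt , tt) (λ τ (e , f , _) → m≤n⇒m∸n≡0 (≤-reflexive (trans e (trans (sym f) (+-identityʳ _)))))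
          (λ { tt l τ j _ → iterate l τ j }) (replicate n tt) _ (rn , length-replicate n , (λ j ()) , λ a → inj₂ ((λ (p , q) → <⇒≱ p q) , zg a , zh a)))))
      (≤-trans (≤-reflexive (cong (2 +_) (trans (totalCost-const 4 (time seedB) (replicate n tt)) (cong (λ k → 4 + (4 + time seedB) * k) (length-replicate n)))))
        (+-mono-≤ {6} {10} (closed≤ 6 10) (*-monoˡ-≤ n (closed≤ (4 + time seedB) 40)))) fin
      where
      Inv : List ⊤ → State → Set
      Inv l τ = regs τ rN ≡ n × regs τ rTail + length l ≡ n × (∀ j → j < regs τ rTail → arrays τ queue j ≡ suc j) × (∀ a → Seeded (regs τ rTail) τ a)
      iterate : ∀ l τ → Inv (tt ∷ l) τ → Exec W seedB τ (time seedB) (Inv l)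
      iterate l τ (e , f , qs , tb) = wp-sound seedB τ ((tt , 1≤W , ≤-trans (≤-reflexive (+-comm i 1)) (≤-trans i<n (<⇒≤ n<W))) , tt , tt , tt ,
          tt , 1≤W , tt , 1≤W , tt , tt , tt , tt , e , trans (cong (_+ length l) (+-comm i 1)) (trans (sym (+-suc i (length l))) f) , qs' , tb')
        where
        i = regs τ rTail
        i<n : suc i ≤ n
        i<n = ≤-trans (m≤m+n (suc i) (length l)) (≤-reflexive (trans (sym (+-suc i (length l))) f))
        qs' : ∀ j → j < i + 1 → (arrays τ queue [ i ↦ i + 1 ]) j ≡ suc j
        qs' j lt with i ≟ j
        ... | yes refl = trans (update-eq (arrays τ queue) i refl) (+-comm i 1)
        ... | no ne = trans (update-neq (arrays τ queue) i ne) (qs j (≤∧≢⇒< (≤-pred (≤-trans lt (≤-reflexive (+-comm i 1)))) (ne ∘ sym)))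
        tb' : ∀ a → Seeded (i + 1) (setCell tl (i + 1) (i + 1) (setCell hd (i + 1) (i + 1) (setCell iso (i + 1) 1 (setCell gam (i + 1) 1 τ)))) a
        tb' a with i + 1 ≟ a
        ... | yes refl = inj₁ ((≤-trans (s≤s z≤n) (≤-reflexive (+-comm 1 i)) , ≤-refl) , update-eq (arrays τ gam) (i + 1) refl , update-eq (arrays τ iso) (i + 1) refl
              , update-eq (arrays τ hd) (i + 1) refl , update-eq (arrays τ tl) (i + 1) refl)
        ... | no ne with tb a
        ...   | inj₁ ((p , q) , g , io , h , t) = inj₁ ((p , ≤-trans q (m≤m+n i 1)) , trans (update-neq (arrays τ gam) (i + 1) ne) g , trans (update-neq (arrays τ iso) (i + 1) ne) io
              , trans (update-neq (arrays τ hd) (i + 1) ne) h , trans (update-neq (arrays τ tl) (i + 1) ne) t)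
        ...   | inj₂ (r , g , h) = inj₂ ((λ (p , q) → r (p , ≤-pred (≤∧≢⇒< (≤-trans q (≤-reflexive (+-comm i 1))) (λ e → ne (trans (+-comm i 1) (sym e)))) ))
              , trans (update-neq (arrays τ gam) (i + 1) ne) g , trans (update-neq (arrays τ hd) (i + 1) ne) h)
      fin : ∀ τ → ∃[ l ] (Inv l τ × regs τ rN ∸ regs τ rTail ≡ 0) → regs τ rTail ≡ n × slice (arrays τ queue) (regs τ rTail) ≡ slice suc n × (∀ a → Slot leaf τ a)
      fin τ (l , (e , f , qs , tb) , z) = t≡n , trans (slice-ext (regs τ rTail) qs) (cong (slice suc) t≡n) , slot
        where
        t≡n : regs τ rTail ≡ n
        t≡n = ≤-antisym (≤-trans (m≤m+n _ (length l)) (≤-reflexive f)) (≤-trans (≤-reflexive (sym e)) (m∸n≡0⇒m≤n z))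
        slot : ∀ a → Slot leaf τ a
        slot a with tb a
        ... | inj₂ (r , g , h) = inj₁ (h , g , λ v ev → r (subst (1 ≤_) ev (s≤s z≤n) , ≤-trans (≤-reflexive (sym ev)) (≤-trans (leaf≤ v) (≤-reflexive (sym t≡n)))))
        ... | inj₁ ((p , q) , g , io , h , t) with leaf-of {a} (λ a0 → <⇒≱ p (≤-trans (≤-reflexive a0) z≤n)) (≤-trans q (≤-reflexive t≡n))
        ...   | v , refl = inj₂ (best-≡ g io h t (best-leaf v refl leaf-injective))

    Result : State → Set
    Result τ = ∃[ S ] (Outputs τ (length S ∷ map toℕ S) × Legal Everything (reverse S) × Max Everything (length S))

    -- The linked list starts with the last vertex of the sequence, so the cells are filled from
    -- index `length L` down to 1, and `acc` is the end of the output that is already written. Cell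
    -- 0 keeps the length.
    exec-output : ∀ σ L → (L ≡ [] ⊎ ∃[ t ] Seg (arrays σ nxt) (arrays σ hd 0) t L) → length L ≡ arrays σ gam 0 →
      Exec W outputP σ (20 + 20 * length L) (λ τ → Outputs τ (length (reverse L) ∷ map toℕ (reverse L)))
    exec-output σ L seg len≡ = exec-mono (exec-bind {W = W} (wp-sound {W = W} (output [ const 0 ]:= gam ! const 0 ⨾ rK := gam ! const 0 ⨾ rA := hd ! const 0) {λ τ → τ ≡ σ₁} σ
          (z≤n , z≤n , z≤n , z≤n , refl))
        (λ { _ _ refl → exec-while Inv (reg rK) (λ _ → time outB) (λ _ _ _ → tt) (λ τ (_ , e , _) → e) iterate L σ₁ ([] , sym len≡ , seg , [] , sym len≡ , refl) }))
      (≤-trans (≤-reflexive (cong (10 +_) (totalCost-const 2 (time outB) L))) (+-mono-≤ {12} {20} (closed≤ 12 20) (*-monoˡ-≤ (length L) (closed≤ (2 + time outB) 20))))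
      fin
      where
      σ₁ = setReg rA (arrays σ hd 0) (setReg rK (arrays σ gam 0) (setCell output 0 (arrays σ gam 0) σ))
      Inv : List (Fin n) → State → Set
      Inv l τ = ∃[ acc ] (regs τ rK ≡ length l × (l ≡ [] ⊎ ∃[ t ] Seg (arrays τ nxt) (regs τ rA) t l) × At (arrays τ output) (suc (regs τ rK)) (map toℕ acc)
        × arrays τ output 0 ≡ length L × l ʳ++ acc ≡ reverse L)
      iterate : ∀ v l τ → Inv (v ∷ l) τ → regs τ rK ≢ 0 → Exec W outB τ (time outB) (Inv l)
      iterate v l τ (acc , k , inj₂ (t , sg) , at , o , r) _ = wp-sound outB τ (tt , (tt , 1≤W) , tt , (tt , 1≤W) ,
          v ∷ acc , cong (_∸ 1) k , next sg , subst (λ j → At (arrays τ output [ K ↦ regs τ rA ∸ 1 ]) j (map toℕ (v ∷ acc))) K≡ (trans (update-eq (arrays τ output) K refl) (a≡ sg) ∷ at-update ≤-refl at)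
          , trans (update-neq (arrays τ output) K (λ e → 1+n≢0 (trans (sym k) e))) o , r)
        where
        K = regs τ rK
        K≡ : K ≡ suc (K ∸ 1)
        K≡ = trans k (cong (λ j → suc (j ∸ 1)) (sym k))
        a≡ : ∀ {h t} → Seg (arrays τ nxt) h t (v ∷ l) → h ∸ 1 ≡ toℕ v
        a≡ last = refl
        a≡ (link _ _) = refl
        next : ∀ {h t} → Seg (arrays τ nxt) h t (v ∷ l) → l ≡ [] ⊎ ∃[ t ] Seg (arrays τ nxt) (arrays τ nxt h) t l
        next last = inj₁ refl
        next (link e s) = inj₂ (_ , subst (λ h → Seg (arrays τ nxt) h _ l) (sym e) s)
      fin : ∀ τ → ∃[ l ] (Inv l τ × regs τ rK ≡ 0) → Outputs τ (length (reverse L) ∷ map toℕ (reverse L))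
      fin τ (l , (acc , k , _ , at , o , r) , z) = outs l (trans (sym k) z) r
        where
        outs : ∀ l → length l ≡ 0 → l ʳ++ acc ≡ reverse L → Outputs τ (length (reverse L) ∷ map toℕ (reverse L))
        outs [] _ refl Fin.zero = trans o (sym (length-reverse L))
        outs [] _ refl (Fin.suc i) = trans (cong (λ j → arrays τ output (suc j + toℕ i)) (sym z)) (at-lookup at i)

    exec-final : ∀ σ → Ready n σ → Zeroed σ → Exec W finalP σ (100 + 1000 * n) Result
    exec-final σ rdy z = exec-mono (exec-bind (exec-seed σ (Ready.rn rdy) z)
        (λ τ₁ fr₁ (tl₁ , Y₁ , sl₁) → let open AfterSeed τ₁ fr₁ tl₁ Y₁ sl₁ in
          exec-bind (exec-mono C.exec-close′ (≤-reflexive (cong (λ k → 10 + 60 * (k + k)) (length-slice suc n))) (λ _ q → q))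
        (λ τ₂ fr₂ (cl , _ , ord) → let open AfterClose τ₂ fr₂ cl ord in
          exec-bind (exec-mono (Col.exec-collect τ₂ refl refl refl refl slots₂) (+-monoʳ-≤ 10 (*-monoʳ-≤ 200 t≤)) (λ _ q → q))
        (λ τ₃ _ (own , root , s) → finish τ₃ own root s))))
      (≤-trans (≤-reflexive (lem n)) (+-mono-≤ (closed≤ 50 100) (*-monoˡ-≤ n (closed≤ 580 1000)))) (λ _ q → q)
      where
      open Ready rdy
      lem : ∀ n → (10 + 40 * n) + ((10 + 60 * (n + n)) + ((10 + 200 * (n + n)) + (20 + 20 * n))) ≡ 50 + 580 * n
      lem = solve-∀
      lem3 : ∀ {a a' : ℕ} {p p' q q' : ℕ → ℕ} → a ≡ a' → p ≡ p' → q ≡ q' → Cotree n 0 a' p' q' → Cotree n 0 a p q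
      lem3 refl refl refl T = T
      nx≤M : regs σ rNx ≤ M
      nx≤M = ≤-trans nx≤ (≤-trans (≤-reflexive (comm n)) (+-monoʳ-≤ (n + n) (+-monoʳ-≤ n (closed≤ 1 3))))
        where
        comm : ∀ n → suc n + (n + n) ≡ (n + n) + (n + 1)
        comm = solve-∀
      module AfterSeed (τ₁ : State) (fr₁ : Frame seedP σ τ₁) (tl₁ : regs τ₁ rTail ≡ n) (Y₁ : slice (arrays τ₁ queue) (regs τ₁ rTail) ≡ slice suc n) (sl₁ : ∀ a → Slot leaf τ₁ a) where
        T₁ : Cotree n 0 (regs τ₁ rNx) (arrays τ₁ parent) (arrays τ₁ type)
        T₁ = lem3 (reg≡ fr₁ rNx) (arr≡ fr₁ parent) (arr≡ fr₁ type) tree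
        counts₁ : Counted M τ₁
        counts₁ = counted-frame {M} {σ} {τ₁} (arr≡ fr₁ parent) (arr≡ fr₁ count) (arr≡ fr₁ sumOf) counts
        module C where
          open Closing T₁ (≤-trans (≤-reflexive (reg≡ fr₁ rNx)) nx≤M) (proj₁ counts₁) (slice-suc-unique n) (slice-suc-≤ n) public
          exec-close′ = exec-close τ₁ refl refl (λ p → trans (cong (λ f → f p) (arr≡ fr₁ done)) (clean p)) Y₁
        module AfterClose (τ₂ : State) (fr₂ : Frame closeP τ₁ τ₂) (cl : Closure n (regs τ₁ rNx) (arrays τ₁ parent) (slice suc n) (slice (arrays τ₂ queue) (regs τ₂ rTail)))
          (ord : ∀ j → j < regs τ₂ rTail → n < arrays τ₂ queue j → ∀ c → arrays τ₁ parent c ≡ arrays τ₂ queue j → c ∈ slice (arrays τ₂ queue) j) where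
          t≤ : regs τ₂ rTail ≤ n + n
          t≤ = ≤-trans (≤-reflexive (sym (length-slice _ _))) (≤-trans (Closure.small cl) (≤-reflexive (cong (λ k → k + k) (length-slice suc n))))
          T₂ : Cotree n 0 (regs τ₁ rNx) (arrays τ₂ parent) (arrays τ₂ type)
          T₂ = lem3 refl (arr≡ fr₂ parent) (arr≡ fr₂ type) T₁
          module Col = Collecting T₂ (≤-trans t≤ (≤-trans (m≤m+n (n + n) (n + 3)) M≤W))
            (subst (λ p → Closure n (regs τ₁ rNx) p (slice suc n) (slice (arrays τ₂ queue) (regs τ₂ rTail))) (sym (arr≡ fr₂ parent)) cl)
            (λ v → slice-suc-∈ n (Fin.toℕ<n v))
            (λ m → leaf-of (proj₁ (slice-suc-≤ n m)) (proj₂ (slice-suc-≤ n m)))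
            (λ j lt nj c pc → ord j lt nj c (trans (cong (λ f → f c) (sym (arr≡ fr₂ parent))) pc))
          slots₂ : ∀ a → Slot leaf τ₂ a
          slots₂ a = move-slot (arr≡ fr₂ gam) (arr≡ fr₂ iso) (arr≡ fr₂ hd) (arr≡ fr₂ tl) (arr≡ fr₂ nxt) (sl₁ a)
            where
            move-slot : arrays τ₂ gam ≡ arrays τ₁ gam → arrays τ₂ iso ≡ arrays τ₁ iso → arrays τ₂ hd ≡ arrays τ₁ hd → arrays τ₂ tl ≡ arrays τ₁ tl → arrays τ₂ nxt ≡ arrays τ₁ nxt →
              Slot leaf τ₁ a → Slot leaf τ₂ a
            move-slot eg ei eh et en (inj₁ (h , g , none)) = inj₁ (trans (cong (λ f → f a) eh) h , trans (cong (λ f → f a) eg) g , none)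
            move-slot eg ei eh et en (inj₂ b) = inj₂ (best-≡ (cong (λ f → f a) eg) (cong (λ f → f a) ei) (cong (λ f → f a) eh) (cong (λ f → f a) et)
              (best-frame (λ {v} _ → cong (λ f → f (leaf v)) en) b))
      finish : ∀ τ own → (∀ v → own v ≡ 0) → Slot own τ 0 → Exec W outputP τ (20 + 20 * n) Result
      -- The root owns every vertex, so its record can be empty only for the graph without vertices.
      finish τ own root (inj₁ (h , g , none)) = exec-mono (exec-output τ [] (inj₁ refl) (sym g)) (+-monoʳ-≤ 20 z≤n)
        (λ τ' o → [] , o , [] , λ { [] _ → z≤n ; (v ∷ _) _ → ⊥-elim (none v (root v)) })
      finish τ own root (inj₂ b) = exec-mono (exec-output τ L (inj₂ (_ , seg)) (Best.len b)) (+-monoʳ-≤ 20 (*-monoʳ-≤ 20 (≤-trans (≤-reflexive (Best.len b)) g≤n)))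
        (λ τ' o → reverse L , o , subst (Legal Everything) (sym (reverse-involutive L)) (legal-mono _ legal)
          , λ S l → ≤-trans (max S (legal-mono (λ {v} _ → root v) l)) (≤-reflexive (trans (sym (Best.len b)) (sym (length-reverse L)))))
        where open Best b hiding (len)

    running-time : ℕ
    running-time = (40 + 40 * M) + (totalCost 4 (λ v → 1100 + 1100 * deg v) (allFin n) + (100 + 1000 * n))

    exec-program : 1 + (n + degrees (allFin n)) ≡ len → Exec W program (initial (encode A)) running-time Result
    exec-program eq = exec-bind (exec-init (concatMap block (allFin n)) (trans (cong suc (trans (length-blocks (allFin n)) (cong (_+ degrees (allFin n)) all≡n))) eq))
      (λ τ _ (rdy , rd , z) → exec-bind (exec-vertices τ rdy rd z) (λ τ' _ (rdy' , z') → exec-final τ' rdy' z'))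

theorem1 : Σ[ P ∈ Program ] Σ[ c ∈ ℕ ] Σ[ d ∈ ℕ ]
    (∀ {n : ℕ} (G : Graph n) → IsCograph G → NoIsolatedVertices G →
    (A : AdjacencyLists G) →
    Σ[ t ∈ ℕ ] Σ[ σ ∈ State ] Σ[ γ ∈ ℕ ] Σ[ S ∈ List (Fin n) ]
    (Run (wordBound d (size G)) P (initial (encode A)) t σ
    × t ≤ c * (1 + size G)
    × Outputs σ (γ ∷ map toℕ S)
    × IsGrundyDoubleDominationNumber G γ
    × IsGDDS G S))
theorem1 = program , 4688 , 5 , λ {n} G cog ni A →
  let module B = Bounds n (Graph.∣E∣ G)
      handshake = Correctness.Sizes.handshake G A
      t , τ , run , le , S , out , legal , mx = Correctness.Bounded.exec-program G cog A (wordBound 5 (size G)) _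
        B.1≤word B.n<word (B.input≤word handshake) B.M≤word B.MM≤word refl
      gdds = Correctness.max-legal⇒gdds G ni S legal mx
  in t , τ , length S , S , run , ≤-trans le (Correctness.Sizes.running-time-≤ G A) , out , (S , gdds , refl) , gdds
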